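{- Let $\mathcal{C}$ be a finite abstract simplicial complex, let $\mathcal{V}=\{V_1,\ldots,V_n\}$ be a partition of its vertex set $V(\mathcal{C})$, and let $\eta \in \{\eta_\pi,\eta_H\}$. If $\eta(\mathcal{C}[V_I]) \ge |I|+1$ for all nonempty $I \subseteq [n]$, where $V_I = \bigcup_{i\in I} V_i$, then the reconfiguration graph $\mathbf{RG}(\mathcal{C},\mathcal{V})$ is connected.
   Context: For a subset $X$ of the ground set, $\mathcal{C}[X]=\{\sigma\in\mathcal{C}:\sigma\subseteq X\}$. A complex is homotopically $k$-connected if for every $-1\le j\le k$ every continuous map $S^j\to\|\mathcal{C}\|$ extends to $B^{j+1}$ (being $(-1)$-connected means having nonempty geometric realization, i.e. at least one vertex). $\eta_\pi(\mathcal{C})$ is $2$ plus the largest $k\ge -2$ such that $\mathcal{C}$ is homotopically $j$-connected for all $j\le k$ (so $\eta_\pi=0$ if $\mathcal{C}$ has no vertices, and $\eta_\pi=\infty$ if it is $k$-connected for all $k$). $\eta_H(\mathcal{C})$ is $2$ plus the largest $k\ge-2$ such that the reduced simplicial homology $\widetilde H_j(\mathcal{C};\mathbb{Q})$ vanishes for all $-1\le j\le k$ (where $\widetilde H_{ -1}=0$ means $\mathcal{C}$ has at least one vertex), possibly $\infty$. A colorful simplex of $(\mathcal{C},\mathcal{V})$ is a simplex of $\mathcal{C}$ containing exactly one vertex from each $V_i$. $\mathbf{RG}(\mathcal{C},\mathcal{V})$ has the colorful simplices as vertices, two being adjacent if their union is a simplex of $\mathcal{C}$ of size $n+1$. -}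

module Defs where

open import Data.Bool.Base using (if_then_else_)
open import Data.Fin.Base using (Fin)
open import Data.Fin.Properties using (_<?_)
open import Data.Fin.Subset using (Subset; _∈_; _⊆_; _∪_; _∩_; ⋃; ⁅_⁆; ∣_∣; Nonempty) renaming (⊥ to ∅)
open import Data.Fin.Subset.Properties using (_∈?_; _⊆?_; ⊆-trans; ⊥⊆)
open import Data.List.Base using (map; filter; allFin)
open import Data.Nat.Base as ℕ using (ℕ; zero; suc)
import Data.Nat.Properties as ℕ
open import Data.Product.Base using (Σ; ∃; _×_; _,_; proj₁; proj₂)
open import Data.Rational.Base as ℚ using (ℚ; 0ℚ; 1ℚ; ½)
import Data.Rational.Properties as ℚ
open import Data.Rational.Solver using (module +-*-Solver)
open import Data.Sum.Base using (inj₁; inj₂)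
open import Data.Vec.Base using (tabulate)
open import Data.Vec.Functional using (Vector; foldr)
open import Function.Bundles using (_⇔_)
open import Level using (0ℓ)
open import Relation.Binary.Core using (Rel)
open import Relation.Binary.Construct.Closure.ReflexiveTransitive using (Star)
open import Relation.Binary.PropositionalEquality using (_≡_; refl; sym; cong; cong₂; subst)
open import Relation.Nullary using (¬_)
open import Relation.Nullary.Decidable using (does; _×-dec_)
open import Relation.Unary using (Pred; Decidable)

-- The ground set is Fin N; a ground element v is a vertex of the complex
-- only if {v} is a face.  The empty simplex is always a face, so "C has no
-- vertices" means that ∅ is the only face.
record Complex (N : ℕ) : Set₁ where
  field
    Face        : Pred (Subset N) 0ℓ
    Face?       : Decidable Face
    ∅-face      : Face ∅
    down-closed : ∀ {σ τ} → τ ⊆ σ → Face σ → Face τ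

open Complex public

IsVertex : ∀ {N} → Complex N → Pred (Fin N) 0ℓ
IsVertex C v = Face C ⁅ v ⁆

_[_] : ∀ {N} → Complex N → Subset N → Complex N
C [ X ] = record
  { Face        = λ σ → Face C σ × σ ⊆ X
  ; Face?       = λ σ → Face? C σ ×-dec (σ ⊆? X)
  ; ∅-face      = ∅-face C , ⊥⊆
  ; down-closed = λ τ⊆σ (σ∈C , σ⊆X) → down-closed C τ⊆σ σ∈C , ⊆-trans τ⊆σ σ⊆X
  }

record Partition {N} (C : Complex N) (n : ℕ) : Set where
  field
    part     : Fin n → Subset N
    nonempty : ∀ i → Nonempty (part i)
    disjoint : ∀ {i j v} → v ∈ part i → v ∈ part j → i ≡ j
    covers   : ∀ v → IsVertex C v ⇔ ∃ λ i → v ∈ part i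

open Partition public

V[_,_] : ∀ {N n} {C : Complex N} → Partition C n → Subset n → Subset N
V[_,_] {n = n} 𝒱 I = ⋃ (map (part 𝒱) (filter (_∈? I) (allFin n)))

-- The vertex set of a graph is a predicate on A, so that vertices are
-- compared as elements of A and not together with proofs of the predicate.
record Graph (A : Set) : Set₁ where
  field
    Vertex : Pred A 0ℓ
    Adj    : Rel A 0ℓ

Connected : ∀ {A} → Graph A → Set
Connected G =
  ∃ Vertex × (∀ u v → Vertex u → Vertex v → Star (λ a b → Vertex a × Vertex b × Adj a b) u v)
  where open Graph G

Colorful : ∀ {N n} (C : Complex N) → Partition C n → Pred (Subset N) 0ℓ
Colorful C 𝒱 σ = Face C σ × (∀ i → ∣ σ ∩ part 𝒱 i ∣ ≡ 1)

RG : ∀ {N n} (C : Complex N) → Partition C n → Graph (Subset N)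
RG {n = n} C 𝒱 = record
  { Vertex = Colorful C 𝒱
  ; Adj    = λ σ τ → Face C (σ ∪ τ) × ∣ σ ∪ τ ∣ ≡ n ℕ.+ 1
  }

below : ∀ {N} → Fin N → Subset N
below v = tabulate (λ u → does (u <? v))

[-1]^_ : ℕ → ℚ
[-1]^ zero  = 1ℚ
[-1]^ suc k = ℚ.- ([-1]^ k)

-- Chain C d is the space of (d - 1)-chains: rational combinations of the
-- faces with d elements, each oriented by the order of Fin N.  In particular
-- Chain C 0 is spanned by the empty simplex (the augmentation).
Chain : ∀ {N} → Complex N → ℕ → Set
Chain {N} C d = Σ (Subset N → ℚ) λ c → ∀ σ → ¬ (Face C σ × ∣ σ ∣ ≡ d) → c σ ≡ 0ℚ

-- The boundary [v₀ … vₖ] ↦ Σᵢ (-1)ⁱ [v₀ … v̂ᵢ … vₖ], by coefficients: τ occurs in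
-- the boundary of τ ∪ {v}, v ∉ τ, with sign given by the position of v.
∂ : ∀ {N} → (Subset N → ℚ) → (Subset N → ℚ)
∂ c τ = foldr ℚ._+_ 0ℚ λ v →
  if does (v ∈? τ) then 0ℚ else ([-1]^ ∣ τ ∩ below v ∣) ℚ.* c (τ ∪ ⁅ v ⁆)

-- Vanishing of the reduced homology in degree d - 1: cycles are boundaries.
H̃[_-1]≡0 : ∀ {N} → ℕ → Complex N → Set
H̃[ d -1]≡0 C = (z : Chain C d) → (∀ τ → ∂ (proj₁ z) τ ≡ 0ℚ) →
  Σ (Chain C (suc d)) λ b → ∀ σ → ∂ (proj₁ b) σ ≡ proj₁ z σ

record ℝ : Set where
  field
    seq    : ℕ → ℚ
    cauchy : ∀ ε → 0ℚ ℚ.< ε →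
             ∃ λ M → ∀ m n → M ℕ.≤ m → M ℕ.≤ n → ℚ.∣ seq m ℚ.- seq n ∣ ℚ.< ε

open ℝ public

infix 4 _≃_ _<_ _≤_
infixl 6 _+_
infixl 7 _*_

_≃_ : Rel ℝ 0ℓ
x ≃ y = ∀ ε → 0ℚ ℚ.< ε → ∃ λ M → ∀ n → M ℕ.≤ n → ℚ.∣ seq x n ℚ.- seq y n ∣ ℚ.< ε

_<_ : Rel ℝ 0ℓ
x < y = ∃ λ ε → 0ℚ ℚ.< ε × ∃ λ M → ∀ n → M ℕ.≤ n → seq x n ℚ.+ ε ℚ.< seq y n

_≤_ : Rel ℝ 0ℓ
x ≤ y = ¬ (y < x)

half-pos : ∀ {ε} → 0ℚ ℚ.< ε → 0ℚ ℚ.< ½ ℚ.* ε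
half-pos {ε} 0<ε = subst (ℚ._< ½ ℚ.* ε) (ℚ.*-zeroʳ ½) (ℚ.*-monoʳ-<-pos ½ 0<ε)

halves : ∀ ε → ½ ℚ.* ε ℚ.+ ½ ℚ.* ε ≡ ε
halves = solve 1 (λ e → con ½ :* e :+ con ½ :* e := e) refl
  where open +-*-Solver

eventually-bounded : (x : ℝ) → ∃ λ M → ∀ n → M ℕ.≤ n →
  ℚ.∣ seq x n ∣ ℚ.< 1ℚ ℚ.+ ℚ.∣ seq x M ∣
eventually-bounded x with cauchy x 1ℚ (ℚ.positive⁻¹ 1ℚ)
... | M , close = M , λ n M≤n → let a = seq x n ; b = seq x M in begin-strict
  ℚ.∣ a ∣                     ≡⟨ cong ℚ.∣_∣ (solve 2 (λ p q → p := (p :- q) :+ q) refl a b) ⟩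
  ℚ.∣ (a ℚ.- b) ℚ.+ b ∣       ≤⟨ ℚ.∣p+q∣≤∣p∣+∣q∣ (a ℚ.- b) b ⟩
  ℚ.∣ a ℚ.- b ∣ ℚ.+ ℚ.∣ b ∣   <⟨ ℚ.+-monoˡ-< ℚ.∣ b ∣ (close n M M≤n ℕ.≤-refl) ⟩
  1ℚ ℚ.+ ℚ.∣ b ∣              ∎
  where open ℚ.≤-Reasoning
        open +-*-Solver

fromℚ : ℚ → ℝ
fromℚ q = record
  { seq    = λ _ → q
  ; cauchy = λ ε 0<ε → 0 , λ _ _ _ _ →
      subst (λ p → ℚ.∣ p ∣ ℚ.< ε) (sym (ℚ.+-inverseʳ q)) 0<ε
  }

0ℝ 1ℝ : ℝ
0ℝ = fromℚ 0ℚ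
1ℝ = fromℚ 1ℚ

_+_ : ℝ → ℝ → ℝ
x + y = record { seq = λ n → seq x n ℚ.+ seq y n ; cauchy = +-cauchy }
  where
  open ℚ.≤-Reasoning
  open +-*-Solver
  +-cauchy : ∀ ε → 0ℚ ℚ.< ε → ∃ λ M → ∀ m n → M ℕ.≤ m → M ℕ.≤ n →
    ℚ.∣ (seq x m ℚ.+ seq y m) ℚ.- (seq x n ℚ.+ seq y n) ∣ ℚ.< ε
  +-cauchy ε 0<ε with cauchy x _ (half-pos 0<ε) | cauchy y _ (half-pos 0<ε)
  ... | M₁ , p | M₂ , q = M₁ ℕ.⊔ M₂ , λ m n M≤m M≤n →
    let a = seq x m ; b = seq y m ; c = seq x n ; d = seq y n in begin-strict
    ℚ.∣ (a ℚ.+ b) ℚ.- (c ℚ.+ d) ∣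
      ≡⟨ cong ℚ.∣_∣ (solve 4 (λ a b c d → (a :+ b) :- (c :+ d) := (a :- c) :+ (b :- d)) refl a b c d) ⟩
    ℚ.∣ (a ℚ.- c) ℚ.+ (b ℚ.- d) ∣
      ≤⟨ ℚ.∣p+q∣≤∣p∣+∣q∣ (a ℚ.- c) (b ℚ.- d) ⟩
    ℚ.∣ a ℚ.- c ∣ ℚ.+ ℚ.∣ b ℚ.- d ∣
      <⟨ ℚ.+-mono-< (p m n (ℕ.m⊔n≤o⇒m≤o M₁ M₂ M≤m) (ℕ.m⊔n≤o⇒m≤o M₁ M₂ M≤n))
                    (q m n (ℕ.m⊔n≤o⇒n≤o M₁ M₂ M≤m) (ℕ.m⊔n≤o⇒n≤o M₁ M₂ M≤n)) ⟩
    ½ ℚ.* ε ℚ.+ ½ ℚ.* ε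
      ≡⟨ halves ε ⟩
    ε ∎

_*_ : ℝ → ℝ → ℝ
x * y = record { seq = λ n → seq x n ℚ.* seq y n ; cauchy = *-cauchy }
  where
  open ℚ.≤-Reasoning
  open +-*-Solver
  *-cauchy : ∀ ε → 0ℚ ℚ.< ε → ∃ λ M → ∀ m n → M ℕ.≤ m → M ℕ.≤ n →
    ℚ.∣ (seq x m ℚ.* seq y m) ℚ.- (seq x n ℚ.* seq y n) ∣ ℚ.< ε
  *-cauchy ε 0<ε = M , close
    where
    M₁ = proj₁ (eventually-bounded x)
    M₂ = proj₁ (eventually-bounded y)
    A  = 1ℚ ℚ.+ ℚ.∣ seq x M₁ ∣
    B  = 1ℚ ℚ.+ ℚ.∣ seq y M₂ ∣
    instance
      A-pos : ℚ.Positive A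
      A-pos = ℚ.pos+nonNeg⇒pos 1ℚ ℚ.∣ seq x M₁ ∣ {{ℚ.∣-∣-nonNeg (seq x M₁)}}
      B-pos : ℚ.Positive B
      B-pos = ℚ.pos+nonNeg⇒pos 1ℚ ℚ.∣ seq y M₂ ∣ {{ℚ.∣-∣-nonNeg (seq y M₂)}}
      AB-pos : ℚ.Positive (A ℚ.+ B)
      AB-pos = ℚ.pos+pos⇒pos A B
      AB≢0 : ℚ.NonZero (A ℚ.+ B)
      AB≢0 = ℚ.pos⇒nonZero (A ℚ.+ B)
      ε-pos : ℚ.Positive ε
      ε-pos = ℚ.positive 0<ε
      1/AB-pos : ℚ.Positive (ℚ.1/ (A ℚ.+ B))
      1/AB-pos = ℚ.1/pos⇒pos (A ℚ.+ B)
    δ = ε ℚ.* ℚ.1/ (A ℚ.+ B)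
    0<δ : 0ℚ ℚ.< δ
    0<δ = ℚ.positive⁻¹ δ {{ℚ.pos*pos⇒pos ε (ℚ.1/ (A ℚ.+ B))}}
    M₃ = proj₁ (cauchy x δ 0<δ)
    M₄ = proj₁ (cauchy y δ 0<δ)
    M  = (M₁ ℕ.⊔ M₂) ℕ.⊔ (M₃ ℕ.⊔ M₄)
    module _ {n} (M≤n : M ℕ.≤ n) where
      M₁₂≤n = ℕ.m⊔n≤o⇒m≤o (M₁ ℕ.⊔ M₂) (M₃ ℕ.⊔ M₄) M≤n
      M₃₄≤n = ℕ.m⊔n≤o⇒n≤o (M₁ ℕ.⊔ M₂) (M₃ ℕ.⊔ M₄) M≤n
      M₁≤n = ℕ.m⊔n≤o⇒m≤o M₁ M₂ M₁₂≤n
      M₂≤n = ℕ.m⊔n≤o⇒n≤o M₁ M₂ M₁₂≤n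
      M₃≤n = ℕ.m⊔n≤o⇒m≤o M₃ M₄ M₃₄≤n
      M₄≤n = ℕ.m⊔n≤o⇒n≤o M₃ M₄ M₃₄≤n
    close : ∀ m n → M ℕ.≤ m → M ℕ.≤ n →
      ℚ.∣ (seq x m ℚ.* seq y m) ℚ.- (seq x n ℚ.* seq y n) ∣ ℚ.< ε
    close m n M≤m M≤n = begin-strict
      ℚ.∣ a ℚ.* b ℚ.- c ℚ.* d ∣
        ≡⟨ cong ℚ.∣_∣ (solve 4 (λ a b c d → a :* b :- c :* d := a :* (b :- d) :+ (a :- c) :* d) refl a b c d) ⟩
      ℚ.∣ a ℚ.* (b ℚ.- d) ℚ.+ (a ℚ.- c) ℚ.* d ∣
        ≤⟨ ℚ.∣p+q∣≤∣p∣+∣q∣ (a ℚ.* (b ℚ.- d)) ((a ℚ.- c) ℚ.* d) ⟩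
      ℚ.∣ a ℚ.* (b ℚ.- d) ∣ ℚ.+ ℚ.∣ (a ℚ.- c) ℚ.* d ∣
        ≡⟨ cong₂ ℚ._+_ (ℚ.∣p*q∣≡∣p∣*∣q∣ a (b ℚ.- d)) (ℚ.∣p*q∣≡∣p∣*∣q∣ (a ℚ.- c) d) ⟩
      ℚ.∣ a ∣ ℚ.* ℚ.∣ b ℚ.- d ∣ ℚ.+ ℚ.∣ a ℚ.- c ∣ ℚ.* ℚ.∣ d ∣
        ≤⟨ ℚ.+-mono-≤
             (ℚ.*-monoʳ-≤-nonNeg ℚ.∣ b ℚ.- d ∣ {{ℚ.∣-∣-nonNeg (b ℚ.- d)}} (ℚ.<⇒≤ (proj₂ (eventually-bounded x) m (M₁≤n M≤m))))
             (ℚ.*-monoˡ-≤-nonNeg ℚ.∣ a ℚ.- c ∣ {{ℚ.∣-∣-nonNeg (a ℚ.- c)}} (ℚ.<⇒≤ (proj₂ (eventually-bounded y) n (M₂≤n M≤n)))) ⟩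
      A ℚ.* ℚ.∣ b ℚ.- d ∣ ℚ.+ ℚ.∣ a ℚ.- c ∣ ℚ.* B
        <⟨ ℚ.+-mono-<
             (ℚ.*-monoʳ-<-pos A (proj₂ (cauchy y δ 0<δ) m n (M₄≤n M≤m) (M₄≤n M≤n)))
             (ℚ.*-monoˡ-<-pos B (proj₂ (cauchy x δ 0<δ) m n (M₃≤n M≤m) (M₃≤n M≤n))) ⟩
      A ℚ.* δ ℚ.+ δ ℚ.* B
        ≡⟨ solve 4 (λ A B e r → A :* (e :* r) :+ (e :* r) :* B := e :* ((A :+ B) :* r)) refl A B ε (ℚ.1/ (A ℚ.+ B)) ⟩
      ε ℚ.* ((A ℚ.+ B) ℚ.* ℚ.1/ (A ℚ.+ B))
        ≡⟨ cong (ε ℚ.*_) (ℚ.*-inverseʳ (A ℚ.+ B)) ⟩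
      ε ℚ.* 1ℚ
        ≡⟨ ℚ.*-identityʳ ε ⟩
      ε ∎
      where
      a = seq x m
      b = seq y m
      c = seq x n
      d = seq y n

≃⇒≤ : ∀ {x y} → x ≃ y → x ≤ y
≃⇒≤ {x} {y} x≃y (ε , 0<ε , M₁ , y+ε<x) with x≃y ε 0<ε
... | M₂ , close = ℚ.<-irrefl refl (begin-strict
  b ℚ.+ ε                 <⟨ y+ε<x m (ℕ.m≤m⊔n M₁ M₂) ⟩
  a                       ≡⟨ solve 2 (λ a b → a := b :+ (a :- b)) refl a b ⟩
  b ℚ.+ (a ℚ.- b)         ≤⟨ ℚ.+-monoʳ-≤ b (p≤∣p∣ (a ℚ.- b)) ⟩
  b ℚ.+ ℚ.∣ a ℚ.- b ∣     <⟨ ℚ.+-monoʳ-< b (close m (ℕ.m≤n⊔m M₁ M₂)) ⟩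
  b ℚ.+ ε                 ∎)
  where
  open ℚ.≤-Reasoning
  open +-*-Solver
  m = M₁ ℕ.⊔ M₂
  a = seq x m
  b = seq y m
  p≤∣p∣ : ∀ p → p ℚ.≤ ℚ.∣ p ∣
  p≤∣p∣ p with ℚ.≤-total 0ℚ p
  ... | inj₁ 0≤p = ℚ.≤-reflexive (sym (ℚ.0≤p⇒∣p∣≡p 0≤p))
  ... | inj₂ p≤0 = ℚ.≤-trans p≤0 (ℚ.0≤∣p∣ p)

Subspace : ℕ → Set₁
Subspace m = Pred (Vector ℝ m) 0ℓ

sum : ∀ {m} → Vector ℝ m → ℝ
sum = foldr _+_ 0ℝ

normSq : ∀ {m} → Vector ℝ m → ℝ
normSq x = sum (λ i → x i * x i)

-- The sphere of dimension d - 1 and the ball of dimension d, both in ℝᵈ;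
-- Sphere 0 is empty and Ball 0 is a point.
Sphere Ball : ∀ d → Subspace d
Sphere d x = normSq x ≃ 1ℝ
Ball   d x = normSq x ≤ 1ℝ

Sphere⊆Ball : ∀ {d} → ∃ (Sphere d) → ∃ (Ball d)
Sphere⊆Ball {d} (x , ∥x∥²≃1) = x , ≃⇒≤ {normSq x} {1ℝ} ∥x∥²≃1

-- Distance less than ε in the maximum metric.
Close : ∀ {m} → ℚ → Rel (Vector ℝ m) 0ℓ
Close ε x y = ∀ i → x i < y i + fromℚ ε × y i < x i + fromℚ ε

-- Continuity in Bishop's sense: for maps on a compact space, which is the only
-- case used here, continuity is uniform continuity.  It implies that f
-- respects _≃_.
Continuous : ∀ {m n} {X : Subspace m} {Y : Subspace n} → (∃ X → ∃ Y) → Set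
Continuous {X = X} f = ∀ ε → 0ℚ ℚ.< ε → ∃ λ δ → 0ℚ ℚ.< δ ×
  (∀ (x y : ∃ X) → Close δ (proj₁ x) (proj₁ y) → Close ε (proj₁ (f x)) (proj₁ (f y)))

-- The geometric realization in barycentric coordinates.  The last component
-- says that the support {v | 0 < x v} is a face; as the support of a real
-- vector is not a decidable subset, this is expressed through the finite sets
-- it contains.
∥_∥ : ∀ {N} → Complex N → Subspace N
∥ C ∥ x = (∀ v → 0ℝ ≤ x v) × (sum x ≃ 1ℝ) ×
  (∀ τ → (∀ v → v ∈ τ → 0ℝ < x v) → Face C τ)

-- Every continuous map from the (d - 1)-sphere extends to the d-ball.
SphereMapsExtend : ∀ {N} → ℕ → Complex N → Set
SphereMapsExtend d C =
  (f : ∃ (Sphere d) → ∃ ∥ C ∥) → Continuous f →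
  Σ (∃ (Ball d) → ∃ ∥ C ∥) λ F → Continuous F ×
    (∀ x v → proj₁ (F (Sphere⊆Ball x)) v ≃ proj₁ (f x) v)

-- Homotopical (K - 2)-connectivity; here j = d - 1 ranges over -1 ≤ j ≤ K - 2.
HomotopicallyConnected[_-2] : ∀ {N} → ℕ → Complex N → Set
HomotopicallyConnected[ K -2] C = ∀ d → d ℕ.< K → SphereMapsExtend d C

data Parameter : Set where
  η-π η-H : Parameter

-- Admissible η K C: the number k = K - 2 ≥ -2 belongs to the set whose largest
-- element, increased by 2, is η(C).
Admissible : ∀ {N} → Parameter → ℕ → Complex N → Set
Admissible η-π K C = ∀ K′ → K′ ℕ.≤ K → HomotopicallyConnected[ K′ -2] C
Admissible η-H K C = ∀ d → d ℕ.< K → H̃[ d -1]≡0 C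

-- η(C) ≥ m, for the ℕ ∪ {∞}-valued supremum η(C) of all admissible K.
_⟨_⟩≥_ : ∀ {N} → Parameter → Complex N → ℕ → Set
η ⟨ C ⟩≥ m = ∃ λ K → m ℕ.≤ K × Admissible η K C

{-# OPTIONS --safe #-}
module Submission where

-- The homotopical case is reduced to the homological one.  Let C be (K - 2)-connected.  The cone over a
-- simplex σ is modelled by the cube [0 , M]^σ with apex 0, and maps from these cubes to C that restrict to
-- σ on the outer faces are built skeleton by skeleton.  They are kept in discrete form, as labellings of lattice
-- points by vertices such that the labels of each lattice cube span a simplex: interpolating a labelling of the
-- boundary gives a map of the sphere, and labelling a fine grid by the heavy barycentric coordinates of an
-- extension to the ball gives the next cube.  Pushing forward the fundamental chains of the cubes yields a
-- contraction of the chain complex of C in degrees below K - 1.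
--
-- In the homological case, acyclic carriers give chains f I on C [ V_I ] with ∂ (f I) = Σ ± f (I ∖ i).  Summing the
-- coefficients of f [n] over the colourful simplices gives 1 (an algebraic Sperner lemma), so a colourful simplex
-- exists.  For colourful σ and τ, the two chain maps carried by σ and by τ are chain homotopic.  An n-simplex of C
-- that contains a colourful simplex has exactly two colourful facets, and these are adjacent, so the boundary of the
-- homotopy has coefficient sum 0 over each component of the reconfiguration graph; hence σ and τ lie in the same one.

open import Data.Bool.Base using (Bool; true; false; if_then_else_; not; _∨_)
import Data.Bool.Properties as Bool
open import Data.Empty using (⊥-elim)
open import Data.Fin.Base using (Fin; zero; suc)
open import Data.Fin.Properties as Fin using (all?; any?; suc-injective)
open import Data.Fin.Subset using (Subset; inside; outside; _∈_; _∉_; _⊆_; _∪_; _∩_; ⁅_⁆; ∣_∣; Nonempty; ⋃; ⊤) renaming (⊥ to ∅; _-_ to _∖_)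
open import Data.Fin.Subset.Properties using (_∈?_; ∪-identityʳ; ∣⊥∣≡0; x∈⁅x⁆; p─⊥≡p; _⊆?_; ⊆-antisym; ⊆-trans; x∈p∪q⁻; x∈p∪q⁺; x∈p∩q⁺; x∈p∩q⁻; x∈⁅y⁆⇒x≡y; x∈p∧x≢y⇒x∈p-y; p─q⊆p; Empty-unique; ∣⁅x⁆∣≡1; p⊆p∪q; q⊆p∪q; ∉⊥; ∈⊤; anySubset?; nonempty?; ∣p∣≤n; ∣⊤∣≡n; p⊂q⇒∣p∣<∣q∣; p⊆q⇒∣p∣≤∣q∣)
import Data.Integer.Base as ℤ
import Data.Integer.Properties as ℤ
open import Data.List.Base as List using (List; []; _∷_; filter; allFin)
open import Data.List.Membership.Propositional using () renaming (_∈_ to _∈ₗ_)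
open import Data.List.Membership.Propositional.Properties using (∈-filter⁺; ∈-filter⁻; ∈-allFin; ∈-map⁺; ∈-map⁻)
open import Data.List.Relation.Unary.Any using (here; there)
open import Data.Nat.Base as ℕ using (ℕ; zero; suc; z≤n; s≤s)
open import Data.Nat.DivMod using (m≡m%n+[m/n]*n; m/n*n≤m; m%n≤n; m%n<n; m<n⇒m/n≡0; /-monoˡ-≤; m*n/n≡m; m<n*o⇒m/o<n)
import Data.Nat.Properties as ℕ
open import Data.Product.Base using (Σ; ∃; _×_; _,_; proj₁; proj₂)
open import Data.Rational.Base as ℚ using (ℚ; 0ℚ; 1ℚ; ½; _+_; _*_; -_; _-_; _≤_; _<_; mkℚ; toℚᵘ)
import Data.Rational.Properties as ℚ
open import Data.Rational.Solver using (module +-*-Solver)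
import Data.Rational.Unnormalised.Base as ℚᵘ
import Data.Rational.Unnormalised.Properties as ℚᵘ
open import Data.Sum.Base using (_⊎_; inj₁; inj₂; [_,_]′)
open import Data.Vec.Base using ([]; _∷_; here; there; tabulate; Vec; lookup; _[_]≔_; map)
open import Data.Vec.Functional using (Vector; foldr)
open import Data.Vec.Properties using (≡-dec; lookup∘update; lookup∘update′; lookup∘tabulate; lookup-map)
open import Defs as ℝ using (∂; below; [-1]^_; Complex; Face; Face?; ∅-face; down-closed; _[_]; Partition; part; disjoint; covers; V[_,_]; Graph; Connected; Colorful; RG; Chain; H̃[_-1]≡0; ℝ; seq; cauchy; fromℚ; 0ℝ; 1ℝ; normSq; Sphere; Ball; ∥_∥; Close; Continuous; SphereMapsExtend; Sphere⊆Ball; Parameter; η-π; η-H; _⟨_⟩≥_)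
open import Function.Base using (_∘_; case_of_)
open import Function.Bundles using (Equivalence)
open import Relation.Binary.Construct.Closure.ReflexiveTransitive using (Star; _◅_; _◅◅_) renaming (ε to nil)
open import Relation.Binary.PropositionalEquality using (_≡_; _≢_; refl; sym; trans; cong; cong₂; subst; module ≡-Reasoning; subst₂)
open import Relation.Nullary using (¬_; yes; no; Dec)
open import Relation.Nullary.Decidable using (does; _×-dec_; ¬?; dec-true; dec-false; decidable-stable)

open +-*-Solver using (solve; _:=_; _:+_; _:*_; _:-_; :-_; con)

-- Contractions, transposed boundaries and cones

-- The obstacle in the homotopical case is that neither the support of a real point nor its side of
-- the sphere is decidable. All case distinctions are therefore made at rational lattice points, and
-- real maps enter only through strict inequalities with a fixed margin, such as a barycentric
-- coordinate above `θ N`. Passing to a finer grid relabels the lower skeleton by rounding; this is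
-- harmless because rounding fixes 0 and sends unit cubes into unit cubes. The Sperner condition,
-- that a label has a positive coordinate, survives the refinement and suffices to identify the
-- outer boundary: its chain map is diagonal, and a diagonal chain map is determined by its value on
-- the empty simplex. On the algebraic side the boundary is contraction with the constant form `𝟙`.
-- On chains whose vertices lie in the colour classes, `𝟙` is the sum of the indicators of the
-- classes, and contracting twice by one indicator gives 0; hence a boundary has colourful sum 0.

infixr 7 _⌟_

-- The contraction of c by the linear form w: the coefficient of τ is the sum over v ∉ τ of
-- ± w v * c (τ ∪ ⁅ v ⁆), with the signs of ∂.
_⌟_ : ∀ {N} → (Fin N → ℚ) → (Subset N → ℚ) → Subset N → ℚ
(w ⌟ c) []            = 0ℚ
(w ⌟ c) (outside ∷ τ) = w zero * c (inside ∷ τ) + ((w ∘ suc) ⌟ (c ∘ (outside ∷_))) τ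
(w ⌟ c) (inside ∷ τ)  = - ((w ∘ suc) ⌟ (c ∘ (inside ∷_))) τ

-- One induction serves congruence, vanishing and scaling, through the choice of `k`. Terms are
-- compared only at `v ∉ τ`, where `τ ∪ ⁅ v ⁆` has one element more than `τ`, so knowledge of the
-- support of `c` can be used.
⌟-local : ∀ {N} {w w′ : Fin N → ℚ} {c c′ : Subset N → ℚ} k τ →
  (∀ v → v ∉ τ → w v * c (τ ∪ ⁅ v ⁆) ≡ k * (w′ v * c′ (τ ∪ ⁅ v ⁆))) → (w ⌟ c) τ ≡ k * (w′ ⌟ c′) τ
⌟-local k [] eq = sym (ℚ.*-zeroʳ k)
⌟-local {w = w} {w′} {c} {c′} k (outside ∷ τ) eq = trans
  (cong₂ _+_
    (subst (λ ρ → w zero * c (inside ∷ ρ) ≡ k * (w′ zero * c′ (inside ∷ ρ))) (∪-identityʳ τ) (eq zero λ ()))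
    (⌟-local k τ λ v v∉ → eq (suc v) λ { (there v∈) → v∉ v∈ }))
  (sym (ℚ.*-distribˡ-+ k _ _))
⌟-local k (inside ∷ τ) eq = trans
  (cong -_ (⌟-local k τ λ v v∉ → eq (suc v) λ { (there v∈) → v∉ v∈ }))
  (ℚ.neg-distribʳ-* k _)

⌟-cong : ∀ {N} {w w′ : Fin N → ℚ} {c c′ : Subset N → ℚ} τ →
  (∀ v → v ∉ τ → w v * c (τ ∪ ⁅ v ⁆) ≡ w′ v * c′ (τ ∪ ⁅ v ⁆)) → (w ⌟ c) τ ≡ (w′ ⌟ c′) τ
⌟-cong {w′ = w′} {c′ = c′} τ eq =
  trans (⌟-local 1ℚ τ λ v v∉ → trans (eq v v∉) (sym (ℚ.*-identityˡ (w′ v * c′ (τ ∪ ⁅ v ⁆)))))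
    (ℚ.*-identityˡ ((w′ ⌟ c′) τ))

⌟-congʳ : ∀ {N} (w : Fin N → ℚ) {c c′ : Subset N → ℚ} → (∀ σ → c σ ≡ c′ σ) → ∀ τ → (w ⌟ c) τ ≡ (w ⌟ c′) τ
⌟-congʳ w eq τ = ⌟-cong τ λ v _ → cong (w v *_) (eq _)

⌟-vanish : ∀ {N} {w : Fin N → ℚ} {c : Subset N → ℚ} τ →
  (∀ v → v ∉ τ → w v * c (τ ∪ ⁅ v ⁆) ≡ 0ℚ) → (w ⌟ c) τ ≡ 0ℚ
⌟-vanish {w = w} {c} τ eq =
  trans (⌟-local {w′ = w} {c′ = c} 0ℚ τ λ v v∉ → trans (eq v v∉) (sym (ℚ.*-zeroˡ (w v * c (τ ∪ ⁅ v ⁆)))))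
    (ℚ.*-zeroˡ ((w ⌟ c) τ))

⌟-zero : ∀ {N} (w : Fin N → ℚ) {c : Subset N → ℚ} → (∀ σ → c σ ≡ 0ℚ) → ∀ τ → (w ⌟ c) τ ≡ 0ℚ
⌟-zero w c≡0 τ = ⌟-vanish τ λ v _ → trans (cong (w v *_) (c≡0 _)) (ℚ.*-zeroʳ (w v))

⌟-scale : ∀ {N} (w : Fin N → ℚ) k (c : Subset N → ℚ) τ → (w ⌟ (λ σ → k * c σ)) τ ≡ k * (w ⌟ c) τ
⌟-scale w k c τ = ⌟-local k τ λ v _ →
  solve 3 (λ w k c → w :* (k :* c) := k :* (w :* c)) refl (w v) k (c (τ ∪ ⁅ v ⁆))

⌟-neg : ∀ {N} (w : Fin N → ℚ) (c : Subset N → ℚ) τ → (w ⌟ (λ σ → - c σ)) τ ≡ - (w ⌟ c) τ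
⌟-neg w c τ = trans
  (⌟-local (- 1ℚ) τ λ v _ → solve 2 (λ w c → w :* (:- c) := con (- 1ℚ) :* (w :* c)) refl (w v) (c (τ ∪ ⁅ v ⁆)))
  (solve 1 (λ x → con (- 1ℚ) :* x := :- x) refl ((w ⌟ c) τ))

⌟-+ : ∀ {N} (w : Fin N → ℚ) (c c′ : Subset N → ℚ) τ → (w ⌟ (λ σ → c σ + c′ σ)) τ ≡ (w ⌟ c) τ + (w ⌟ c′) τ
⌟-+ w c c′ [] = refl
⌟-+ w c c′ (outside ∷ τ) = trans
  (cong (w zero * (c (inside ∷ τ) + c′ (inside ∷ τ)) +_) (⌟-+ (w ∘ suc) (c ∘ (outside ∷_)) (c′ ∘ (outside ∷_)) τ))
  (solve 5 (λ w a b x y → w :* (a :+ b) :+ (x :+ y) := (w :* a :+ x) :+ (w :* b :+ y)) refl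
    (w zero) (c (inside ∷ τ)) (c′ (inside ∷ τ))
    (((w ∘ suc) ⌟ (c ∘ (outside ∷_))) τ) (((w ∘ suc) ⌟ (c′ ∘ (outside ∷_))) τ))
⌟-+ w c c′ (inside ∷ τ) = trans
  (cong -_ (⌟-+ (w ∘ suc) (c ∘ (inside ∷_)) (c′ ∘ (inside ∷_)) τ))
  (ℚ.neg-distrib-+ (((w ∘ suc) ⌟ (c ∘ (inside ∷_))) τ) (((w ∘ suc) ⌟ (c′ ∘ (inside ∷_))) τ))

⌟-+ˡ : ∀ {N} (w w′ : Fin N → ℚ) (c : Subset N → ℚ) τ → ((λ v → w v + w′ v) ⌟ c) τ ≡ (w ⌟ c) τ + (w′ ⌟ c) τ
⌟-+ˡ w w′ c [] = refl
⌟-+ˡ w w′ c (outside ∷ τ) = trans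
  (cong ((w zero + w′ zero) * c (inside ∷ τ) +_) (⌟-+ˡ (w ∘ suc) (w′ ∘ suc) (c ∘ (outside ∷_)) τ))
  (solve 5 (λ a b c x y → (a :+ b) :* c :+ (x :+ y) := (a :* c :+ x) :+ (b :* c :+ y)) refl
    (w zero) (w′ zero) (c (inside ∷ τ))
    (((w ∘ suc) ⌟ (c ∘ (outside ∷_))) τ) (((w′ ∘ suc) ⌟ (c ∘ (outside ∷_))) τ))
⌟-+ˡ w w′ c (inside ∷ τ) = trans
  (cong -_ (⌟-+ˡ (w ∘ suc) (w′ ∘ suc) (c ∘ (inside ∷_)) τ))
  (ℚ.neg-distrib-+ (((w ∘ suc) ⌟ (c ∘ (inside ∷_))) τ) (((w′ ∘ suc) ⌟ (c ∘ (inside ∷_))) τ))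

⌟-out : ∀ {N} (w : Fin N → ℚ) k (c c′ : Subset N → ℚ) τ →
  (w ⌟ (λ ρ → k * c ρ + c′ ρ)) τ ≡ k * (w ⌟ c) τ + (w ⌟ c′) τ
⌟-out w k c c′ τ = trans (⌟-+ w (λ ρ → k * c ρ) c′ τ) (cong (_+ (w ⌟ c′) τ) (⌟-scale w k c τ))

-- Removing two vertices in the other order changes the sign. Two different forms are allowed
-- because both cases matter: equal forms give square zero, as 2 is invertible in ℚ, and indicators
-- of colour classes can be permuted up to sign.
⌟-anticomm : ∀ {N} (w x : Fin N → ℚ) (c : Subset N → ℚ) τ → (w ⌟ x ⌟ c) τ ≡ - (x ⌟ w ⌟ c) τ
⌟-anticomm w x c [] = refl
⌟-anticomm w x c (outside ∷ τ) = begin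
  w zero * (- q) + (w′ ⌟ (λ ρ → x zero * c (inside ∷ ρ) + (x′ ⌟ c₀) ρ)) τ
    ≡⟨ cong (w zero * (- q) +_) (⌟-out w′ (x zero) c₁ (x′ ⌟ c₀) τ) ⟩
  w zero * (- q) + (x zero * p + (w′ ⌟ x′ ⌟ c₀) τ)
    ≡⟨ cong (λ z → w zero * (- q) + (x zero * p + z)) (⌟-anticomm w′ x′ c₀ τ) ⟩
  w zero * (- q) + (x zero * p + (- r))
    ≡⟨ solve 5 (λ w x p q r → w :* (:- q) :+ (x :* p :+ (:- r)) := :- (x :* (:- p) :+ (w :* q :+ r))) refl
         (w zero) (x zero) p q r ⟩
  - (x zero * (- p) + (w zero * q + r))
    ≡⟨ cong (λ z → - (x zero * (- p) + z)) (sym (⌟-out x′ (w zero) c₁ (w′ ⌟ c₀) τ)) ⟩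
  - (x zero * (- p) + (x′ ⌟ (λ ρ → w zero * c (inside ∷ ρ) + (w′ ⌟ c₀) ρ)) τ) ∎
  where
  open ≡-Reasoning
  w′ = w ∘ suc
  x′ = x ∘ suc
  c₀ = c ∘ (outside ∷_)
  c₁ = c ∘ (inside ∷_)
  p = (w′ ⌟ c₁) τ
  q = (x′ ⌟ c₁) τ
  r = (x′ ⌟ w′ ⌟ c₀) τ
⌟-anticomm w x c (inside ∷ τ) = cong -_ (begin
  (w′ ⌟ (λ ρ → - (x′ ⌟ c₁) ρ)) τ ≡⟨ ⌟-neg w′ (x′ ⌟ c₁) τ ⟩
  - (w′ ⌟ x′ ⌟ c₁) τ             ≡⟨ cong -_ (⌟-anticomm w′ x′ c₁ τ) ⟩
  - (- (x′ ⌟ w′ ⌟ c₁) τ)         ≡⟨ cong -_ (sym (⌟-neg x′ (w′ ⌟ c₁) τ)) ⟩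
  - (x′ ⌟ (λ ρ → - (w′ ⌟ c₁) ρ)) τ ∎)
  where
  open ≡-Reasoning
  w′ = w ∘ suc
  x′ = x ∘ suc
  c₁ = c ∘ (inside ∷_)

p≡-p⇒p≡0 : ∀ {p} → p ≡ - p → p ≡ 0ℚ
p≡-p⇒p≡0 {p} eq = begin
  p             ≡⟨ solve 1 (λ p → p := con ½ :* (p :+ p)) refl p ⟩
  ½ * (p + p)   ≡⟨ cong (λ z → ½ * (p + z)) eq ⟩
  ½ * (p - p)   ≡⟨ solve 1 (λ p → con ½ :* (p :- p) := con 0ℚ) refl p ⟩
  0ℚ            ∎
  where open ≡-Reasoning

⌟-square : ∀ {N} (w : Fin N → ℚ) (c : Subset N → ℚ) τ → (w ⌟ w ⌟ c) τ ≡ 0ℚ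
⌟-square w c τ = p≡-p⇒p≡0 (⌟-anticomm w w c τ)

foldr-cong : ∀ {n} {f g : Vector ℚ n} → (∀ i → f i ≡ g i) → foldr _+_ 0ℚ f ≡ foldr _+_ 0ℚ g
foldr-cong {zero}  eq = refl
foldr-cong {suc n} eq = cong₂ _+_ (eq zero) (foldr-cong (eq ∘ suc))

foldr-neg : ∀ {n} (f : Vector ℚ n) → foldr _+_ 0ℚ (λ i → - f i) ≡ - foldr _+_ 0ℚ f
foldr-neg {zero}  f = refl
foldr-neg {suc n} f = trans (cong (- f zero +_) (foldr-neg (f ∘ suc))) (sym (ℚ.neg-distrib-+ (f zero) (foldr _+_ 0ℚ (f ∘ suc))))

∣τ∩∅∣≡0 : ∀ {N} (τ : Subset N) → ∣ τ ∩ tabulate (λ _ → false) ∣ ≡ 0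
∣τ∩∅∣≡0 []            = refl
∣τ∩∅∣≡0 (outside ∷ τ) = ∣τ∩∅∣≡0 τ
∣τ∩∅∣≡0 (inside ∷ τ)  = ∣τ∩∅∣≡0 τ

𝟙 : ∀ {N} → Fin N → ℚ
𝟙 _ = 1ℚ

-- An element `zero` of `τ` lies below every other vertex and so flips all signs of `∂`; this is the
-- minus in the `inside` clause of `_⌟_`. For `v = zero` nothing lies below and the sign is
-- positive.
∂≡𝟙⌟ : ∀ {N} (c : Subset N → ℚ) τ → ∂ c τ ≡ (𝟙 ⌟ c) τ
∂≡𝟙⌟ c [] = refl
∂≡𝟙⌟ c (outside ∷ τ) = cong₂ _+_
  (cong₂ (λ k ρ → ([-1]^ k) * c (inside ∷ ρ)) (∣τ∩∅∣≡0 τ) (∪-identityʳ τ))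
  (∂≡𝟙⌟ (c ∘ (outside ∷_)) τ)
∂≡𝟙⌟ {suc N} c (inside ∷ τ) = trans (ℚ.+-identityˡ (foldr _+_ 0ℚ (term (λ x → - x))))
  (trans (foldr-cong rest) (trans (foldr-neg (term λ x → x)) (cong -_ (∂≡𝟙⌟ (c ∘ (inside ∷_)) τ))))
  where
  term : (ℚ → ℚ) → Fin N → ℚ
  term s v = if does (v ∈? τ) then 0ℚ else s ([-1]^ ∣ τ ∩ below v ∣) * c (inside ∷ (τ ∪ ⁅ v ⁆))
  rest : ∀ v → term (λ x → - x) v ≡ - term (λ x → x) v
  rest v with does (v ∈? τ)
  ... | true  = refl
  ... | false = sym (ℚ.neg-distribˡ-* ([-1]^ ∣ τ ∩ below v ∣) (c (inside ∷ (τ ∪ ⁅ v ⁆))))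

-- alternating f σ is the sum of ± f i (σ ∖ i) over i ∈ σ, with the signs of ∂.
alternating : ∀ {N} → (Fin N → Subset N → ℚ) → Subset N → ℚ
alternating f []            = 0ℚ
alternating f (outside ∷ σ) = alternating (λ i τ → f (suc i) (outside ∷ τ)) σ
alternating f (inside ∷ σ)  = f zero (outside ∷ σ) - alternating (λ i τ → f (suc i) (inside ∷ τ)) σ

∂ᵗ : ∀ {N} → (Subset N → ℚ) → Subset N → ℚ
∂ᵗ f = alternating (λ _ → f)

alternating-cong : ∀ {N} {f g : Fin N → Subset N → ℚ} σ →
  (∀ {i} → i ∈ σ → f i (σ ∖ i) ≡ g i (σ ∖ i)) → alternating f σ ≡ alternating g σ
alternating-cong [] eq = refl
alternating-cong (outside ∷ σ) eq = alternating-cong σ λ i∈ → eq (there i∈)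
alternating-cong {f = f} {g} (inside ∷ σ) eq = cong₂ _-_
  (subst (λ ρ → f zero (outside ∷ ρ) ≡ g zero (outside ∷ ρ)) (p─⊥≡p σ) (eq here))
  (alternating-cong σ λ i∈ → eq (there i∈))

alternating-+ : ∀ {N} (f g : Fin N → Subset N → ℚ) σ →
  alternating (λ i τ → f i τ + g i τ) σ ≡ alternating f σ + alternating g σ
alternating-+ f g [] = refl
alternating-+ f g (outside ∷ σ) = alternating-+ (λ i τ → f (suc i) (outside ∷ τ)) (λ i τ → g (suc i) (outside ∷ τ)) σ
alternating-+ f g (inside ∷ σ) = trans
  (cong (λ z → (f zero (outside ∷ σ) + g zero (outside ∷ σ)) - z) (alternating-+ f₁ g₁ σ))
  (solve 4 (λ a b x y → (a :+ b) :- (x :+ y) := (a :- x) :+ (b :- y)) refl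
    (f zero (outside ∷ σ)) (g zero (outside ∷ σ)) (alternating f₁ σ) (alternating g₁ σ))
  where
  f₁ = λ i τ → f (suc i) (inside ∷ τ)
  g₁ = λ i τ → g (suc i) (inside ∷ τ)

alternating-scale : ∀ {N} k (f : Fin N → Subset N → ℚ) σ → alternating (λ i τ → k * f i τ) σ ≡ k * alternating f σ
alternating-scale k f [] = sym (ℚ.*-zeroʳ k)
alternating-scale k f (outside ∷ σ) = alternating-scale k (λ i τ → f (suc i) (outside ∷ τ)) σ
alternating-scale k f (inside ∷ σ) = trans
  (cong (λ z → k * f zero (outside ∷ σ) - z) (alternating-scale k f₁ σ))
  (solve 3 (λ k a x → k :* a :- k :* x := k :* (a :- x)) refl k (f zero (outside ∷ σ)) (alternating f₁ σ))
  where f₁ = λ i τ → f (suc i) (inside ∷ τ)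

alternating-vanish : ∀ {N} {f : Fin N → Subset N → ℚ} σ → (∀ {i} → i ∈ σ → f i (σ ∖ i) ≡ 0ℚ) → alternating f σ ≡ 0ℚ
alternating-vanish {f = f} σ eq = trans
  (alternating-cong {g = λ i τ → 0ℚ * f i τ} σ λ {i} i∈ → trans (eq i∈) (sym (ℚ.*-zeroˡ (f i (σ ∖ i)))))
  (trans (alternating-scale 0ℚ f σ) (ℚ.*-zeroˡ (alternating f σ)))

alternating-neg : ∀ {N} (f : Fin N → Subset N → ℚ) σ → alternating (λ i τ → - f i τ) σ ≡ - alternating f σ
alternating-neg f σ = trans
  (alternating-cong {g = λ i τ → (- 1ℚ) * f i τ} σ λ {i} _ → solve 1 (λ x → :- x := con (- 1ℚ) :* x) refl (f i (σ ∖ i)))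
  (trans (alternating-scale (- 1ℚ) f σ) (solve 1 (λ x → con (- 1ℚ) :* x := :- x) refl (alternating f σ)))

alternating-∸ : ∀ {N} (f g : Fin N → Subset N → ℚ) σ →
  alternating (λ i τ → f i τ - g i τ) σ ≡ alternating f σ - alternating g σ
alternating-∸ f g σ = trans (alternating-+ f (λ i τ → - g i τ) σ) (cong (alternating f σ +_) (alternating-neg g σ))

∂ᵗ-cong : ∀ {N} {f g : Subset N → ℚ} σ → (∀ {i} → i ∈ σ → f (σ ∖ i) ≡ g (σ ∖ i)) → ∂ᵗ f σ ≡ ∂ᵗ g σ
∂ᵗ-cong = alternating-cong

∂ᵗ-+ : ∀ {N} (f g : Subset N → ℚ) σ → ∂ᵗ (λ τ → f τ + g τ) σ ≡ ∂ᵗ f σ + ∂ᵗ g σ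
∂ᵗ-+ f g = alternating-+ (λ _ → f) (λ _ → g)

∂ᵗ-scale : ∀ {N} k (f : Subset N → ℚ) σ → ∂ᵗ (λ τ → k * f τ) σ ≡ k * ∂ᵗ f σ
∂ᵗ-scale k f = alternating-scale k (λ _ → f)

∂ᵗ-vanish : ∀ {N} {f : Subset N → ℚ} σ → (∀ {i} → i ∈ σ → f (σ ∖ i) ≡ 0ℚ) → ∂ᵗ f σ ≡ 0ℚ
∂ᵗ-vanish = alternating-vanish

∂ᵗ-neg : ∀ {N} (f : Subset N → ℚ) σ → ∂ᵗ (λ τ → - f τ) σ ≡ - ∂ᵗ f σ
∂ᵗ-neg f = alternating-neg (λ _ → f)

-- Deleting two indices in the two orders gives opposite signs. The family may depend on one of the
-- deleted indices, as the lower faces of a cube do; a constant family gives `∂ᵗ-square`.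
∂ᵗ-alternating : ∀ {N} (f : Fin N → Subset N → ℚ) σ → ∂ᵗ (alternating f) σ ≡ - alternating (λ i → ∂ᵗ (f i)) σ
∂ᵗ-alternating f [] = refl
∂ᵗ-alternating f (outside ∷ σ) = ∂ᵗ-alternating (λ i τ → f (suc i) (outside ∷ τ)) σ
∂ᵗ-alternating f (inside ∷ σ) = begin
  alternating f₀ σ - ∂ᵗ (λ τ → g τ - alternating f₁ τ) σ
    ≡⟨ cong (λ z → alternating f₀ σ - z) (trans (alternating-∸ (λ _ → g) (λ _ → alternating f₁) σ)
         (cong (λ z → ∂ᵗ g σ - z) (∂ᵗ-alternating f₁ σ))) ⟩
  alternating f₀ σ - (∂ᵗ g σ - (- a))
    ≡⟨ solve 3 (λ x y z → x :- (y :- (:- z)) := :- (y :- (x :- z))) refl (alternating f₀ σ) (∂ᵗ g σ) a ⟩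
  - (∂ᵗ g σ - (alternating f₀ σ - a))
    ≡⟨ cong (λ z → - (∂ᵗ g σ - z)) (sym (alternating-∸ f₀ (λ i → ∂ᵗ (f₁ i)) σ)) ⟩
  - (∂ᵗ g σ - alternating (λ i τ → f₀ i τ - ∂ᵗ (f₁ i) τ) σ) ∎
  where
  open ≡-Reasoning
  g = λ τ → f zero (outside ∷ τ)
  f₀ = λ i τ → f (suc i) (outside ∷ τ)
  f₁ = λ i τ → f (suc i) (inside ∷ τ)
  a = alternating (λ i → ∂ᵗ (f₁ i)) σ

∂ᵗ-square : ∀ {N} (f : Subset N → ℚ) σ → ∂ᵗ (∂ᵗ f) σ ≡ 0ℚ
∂ᵗ-square f σ = p≡-p⇒p≡0 (∂ᵗ-alternating (λ _ → f) σ)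

⌟-∂ᵗ : ∀ {N n} (w : Fin N → ℚ) (f : Subset n → Subset N → ℚ) I τ →
  (w ⌟ (λ ρ → ∂ᵗ (λ J → f J ρ) I)) τ ≡ ∂ᵗ (λ J → (w ⌟ f J) τ) I
⌟-∂ᵗ w f [] τ = ⌟-zero w (λ _ → refl) τ
⌟-∂ᵗ w f (outside ∷ I) τ = ⌟-∂ᵗ w (f ∘ (outside ∷_)) I τ
⌟-∂ᵗ w f (inside ∷ I) τ = trans
  (⌟-+ w (f (outside ∷ I)) (λ ρ → - ∂ᵗ (λ J → f (inside ∷ J) ρ) I) τ)
  (cong ((w ⌟ f (outside ∷ I)) τ +_) (trans
    (⌟-neg w (λ ρ → ∂ᵗ (λ J → f (inside ∷ J) ρ) I) τ)
    (cong -_ (⌟-∂ᵗ w (f ∘ (inside ∷_)) I τ))))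

-- Exterior multiplication by `v`, the sign counting the elements of `ρ` below `v`. Only values of
-- `c` at sets without `v` are read, so simplices that already contain `v` contribute nothing.
cone : ∀ {N} → Fin N → (Subset N → ℚ) → Subset N → ℚ
cone zero    c (outside ∷ ρ) = 0ℚ
cone zero    c (inside ∷ ρ)  = c (outside ∷ ρ)
cone (suc v) c (outside ∷ ρ) = cone v (c ∘ (outside ∷_)) ρ
cone (suc v) c (inside ∷ ρ)  = - cone v (c ∘ (inside ∷_)) ρ

cone-+ : ∀ {N} v (c c′ : Subset N → ℚ) ρ → cone v (λ σ → c σ + c′ σ) ρ ≡ cone v c ρ + cone v c′ ρ
cone-+ zero    c c′ (outside ∷ ρ) = refl
cone-+ zero    c c′ (inside ∷ ρ)  = refl
cone-+ (suc v) c c′ (outside ∷ ρ) = cone-+ v (c ∘ (outside ∷_)) (c′ ∘ (outside ∷_)) ρ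
cone-+ (suc v) c c′ (inside ∷ ρ)  =
  trans (cong -_ (cone-+ v (c ∘ (inside ∷_)) (c′ ∘ (inside ∷_)) ρ))
    (ℚ.neg-distrib-+ (cone v (c ∘ (inside ∷_)) ρ) (cone v (c′ ∘ (inside ∷_)) ρ))

cone-scale : ∀ {N} v k (c : Subset N → ℚ) ρ → cone v (λ σ → k * c σ) ρ ≡ k * cone v c ρ
cone-scale zero    k c (outside ∷ ρ) = sym (ℚ.*-zeroʳ k)
cone-scale zero    k c (inside ∷ ρ)  = refl
cone-scale (suc v) k c (outside ∷ ρ) = cone-scale v k (c ∘ (outside ∷_)) ρ
cone-scale (suc v) k c (inside ∷ ρ)  =
  trans (cong -_ (cone-scale v k (c ∘ (inside ∷_)) ρ)) (ℚ.neg-distribʳ-* k (cone v (c ∘ (inside ∷_)) ρ))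

cone-local : ∀ {N} v {c c′ : Subset N → ℚ} ρ → (v ∈ ρ → c (ρ ∖ v) ≡ c′ (ρ ∖ v)) → cone v c ρ ≡ cone v c′ ρ
cone-local zero    (outside ∷ ρ) eq = refl
cone-local zero {c} {c′} (inside ∷ ρ) eq =
  subst (λ υ → c (outside ∷ υ) ≡ c′ (outside ∷ υ)) (p─⊥≡p ρ) (eq here)
cone-local (suc v) (outside ∷ ρ) eq = cone-local v ρ λ v∈ → eq (there v∈)
cone-local (suc v) (inside ∷ ρ)  eq = cong -_ (cone-local v ρ λ v∈ → eq (there v∈))

cone-vanish : ∀ {N} v {c : Subset N → ℚ} ρ → (v ∈ ρ → c (ρ ∖ v) ≡ 0ℚ) → cone v c ρ ≡ 0ℚ
cone-vanish v {c} ρ eq = trans (cone-local v {c′ = λ σ → 0ℚ * c σ} ρ λ v∈ → trans (eq v∈) (sym (ℚ.*-zeroˡ (c (ρ ∖ v)))))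
  (trans (cone-scale v 0ℚ c ρ) (ℚ.*-zeroˡ (cone v c ρ)))

cone-neg : ∀ {N} v (c : Subset N → ℚ) ρ → cone v (λ σ → - c σ) ρ ≡ - cone v c ρ
cone-neg v c ρ = trans
  (cone-local v ρ λ _ → solve 1 (λ x → :- x := con (- 1ℚ) :* x) refl (c (ρ ∖ v)))
  (trans (cone-scale v (- 1ℚ) c ρ) (solve 1 (λ x → con (- 1ℚ) :* x := :- x) refl (cone v c ρ)))

-- Interior multiplication is an antiderivation for exterior multiplication, and `𝟙` takes the value
-- 1 at `v`. On a cycle the second term drops out and the cone is a filling.
∂-cone : ∀ {N} v (c : Subset N → ℚ) τ → (𝟙 ⌟ cone v c) τ ≡ c τ - cone v (𝟙 ⌟ c) τ
∂-cone zero c (outside ∷ τ) = trans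
  (cong (1ℚ * c (outside ∷ τ) +_) (⌟-zero 𝟙 (λ _ → refl) τ))
  (solve 1 (λ x → con 1ℚ :* x :+ con 0ℚ := x :- con 0ℚ) refl (c (outside ∷ τ)))
∂-cone zero c (inside ∷ τ) =
  solve 2 (λ x y → :- y := x :- (con 1ℚ :* x :+ y)) refl (c (inside ∷ τ)) ((𝟙 ⌟ (c ∘ (outside ∷_))) τ)
∂-cone (suc v) c (outside ∷ τ) = begin
  1ℚ * (- x) + (𝟙 ⌟ cone v c₀) τ
    ≡⟨ cong (1ℚ * (- x) +_) (∂-cone v c₀ τ) ⟩
  1ℚ * (- x) + (y - z)
    ≡⟨ solve 3 (λ x y z → con 1ℚ :* (:- x) :+ (y :- z) := y :- (con 1ℚ :* x :+ z)) refl x y z ⟩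
  y - (1ℚ * x + z)
    ≡⟨ cong (λ u → y - (u + z)) (sym (cone-scale v 1ℚ c₁ τ)) ⟩
  y - (cone v (λ ρ → 1ℚ * c₁ ρ) τ + z)
    ≡⟨ cong (λ u → y - u) (sym (cone-+ v (λ ρ → 1ℚ * c₁ ρ) (𝟙 ⌟ c₀) τ)) ⟩
  y - cone v (λ ρ → 1ℚ * c₁ ρ + (𝟙 ⌟ c₀) ρ) τ ∎
  where
  open ≡-Reasoning
  c₀ = c ∘ (outside ∷_)
  c₁ = c ∘ (inside ∷_)
  x = cone v c₁ τ
  y = c₀ τ
  z = cone v (𝟙 ⌟ c₀) τ
∂-cone (suc v) c (inside ∷ τ) = begin
  - (𝟙 ⌟ (λ ρ → - cone v c₁ ρ)) τ
    ≡⟨ cong -_ (trans (⌟-neg 𝟙 (cone v c₁) τ) (cong -_ (∂-cone v c₁ τ))) ⟩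
  - (- (x - y))
    ≡⟨ solve 2 (λ x y → :- (:- (x :- y)) := x :- (:- (:- y))) refl x y ⟩
  x - (- (- y))
    ≡⟨ cong (λ u → x - (- u)) (sym (cone-neg v (𝟙 ⌟ c₁) τ)) ⟩
  x - (- cone v (λ ρ → - (𝟙 ⌟ c₁) ρ) τ) ∎
  where
  open ≡-Reasoning
  c₁ = c ∘ (inside ∷_)
  x = c₁ τ
  y = cone v (𝟙 ⌟ c₁) τ

-- Acyclic carriers and sums over colourful simplices

∣p∖x∣ : ∀ {n} {p : Subset n} {x} → x ∈ p → suc ∣ p ∖ x ∣ ≡ ∣ p ∣
∣p∖x∣ {p = inside ∷ p}  {zero}  here       = cong (λ q → suc ∣ q ∣) (p─⊥≡p p)
∣p∖x∣ {p = inside ∷ p}  {suc x} (there x∈) = cong suc (∣p∖x∣ x∈)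
∣p∖x∣ {p = outside ∷ p} {suc x} (there x∈) = ∣p∖x∣ x∈

x∉p∖x : ∀ {n} (p : Subset n) x → x ∉ p ∖ x
x∉p∖x (_ ∷ p) (suc x) (there x∈) = x∉p∖x p x x∈

∣p∣≡0⇒p≡∅ : ∀ {n} (p : Subset n) → ∣ p ∣ ≡ 0 → p ≡ ∅
∣p∣≡0⇒p≡∅ []            _   = refl
∣p∣≡0⇒p≡∅ (outside ∷ p) ∣p∣≡0 = cong (outside ∷_) (∣p∣≡0⇒p≡∅ p ∣p∣≡0)

∣p∣≡suc⇒nonempty : ∀ {n m} (p : Subset n) → ∣ p ∣ ≡ suc m → Nonempty p
∣p∣≡suc⇒nonempty {n} p ∣p∣≡ with nonempty? p
... | yes ne = ne
... | no ¬ne rewrite Empty-unique ¬ne = case trans (sym (∣⊥∣≡0 n)) ∣p∣≡ of λ ()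

∣p∣≡1⇒unique : ∀ {n} (p : Subset n) → ∣ p ∣ ≡ 1 → ∀ {x y} → x ∈ p → y ∈ p → x ≡ y
∣p∣≡1⇒unique (outside ∷ p) eq (there x∈) (there y∈) = cong suc (∣p∣≡1⇒unique p eq x∈ y∈)
∣p∣≡1⇒unique (inside ∷ p)  eq {x} {y} x∈ y∈ rewrite ∣p∣≡0⇒p≡∅ p (ℕ.suc-injective eq) = zeros x∈ y∈
  where
  zeros : ∀ {x y} → x ∈ inside ∷ ∅ → y ∈ inside ∷ ∅ → x ≡ y
  zeros here       here       = refl
  zeros (there x∈) _          = ⊥-elim (∉⊥ x∈)
  zeros here       (there y∈) = ⊥-elim (∉⊥ y∈)

Supported : ∀ {N} → Complex N → ℕ → (Subset N → ℚ) → Set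
Supported X d c = ∀ σ → ¬ (Face X σ × ∣ σ ∣ ≡ d) → c σ ≡ 0ℚ

Supported? : ∀ {N} {X : Complex N} {d c} → Supported X d c → ∀ σ → (Face X σ × ∣ σ ∣ ≡ d) ⊎ c σ ≡ 0ℚ
Supported? {X = X} {d} supp σ with Face? X σ ×-dec (∣ σ ∣ ℕ.≟ d)
... | yes σ∈ = inj₁ σ∈
... | no  σ∉ = inj₂ (supp σ σ∉)

-- The parameters cover two uses: `κ = 1`, `u = 0`, `e = 0` yields a chain map from the full simplex
-- on `Fin n`, and `κ = - 1`, `e = 1` with `u` a difference of two such maps yields a chain
-- homotopy. The condition `∂u` is what makes the chain to be filled a cycle.
module _ {n N} (X : Subset n → Complex N)
  (X-mono : ∀ {I J ρ} → I ⊆ J → Face (X I) ρ → Face (X J) ρ)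
  (e : ℕ) (κ : ℚ) (u : Subset n → Subset N → ℚ) (h₀ : Subset N → ℚ)
  (h₀-supp : Supported (X ∅) e h₀) (∂h₀ : ∀ τ → (𝟙 ⌟ h₀) τ ≡ u ∅ τ)
  (∂u : ∀ I τ → (𝟙 ⌟ u I) τ ≡ - (κ * ∂ᵗ (λ J → u J τ) I))
  (u-supp : ∀ I d → Nonempty I → suc d ≡ ∣ I ∣ ℕ.+ e → Supported (X I) d (u I))
  (acyclic : ∀ I d → Nonempty I → suc d ≡ ∣ I ∣ ℕ.+ e → H̃[ d -1]≡0 (X I))
  where

  IsCarried : (Subset n → Subset N → ℚ) → Subset n → Set
  IsCarried h I = Supported (X I) (∣ I ∣ ℕ.+ e) (h I) ×
    (∀ τ → (𝟙 ⌟ h I) τ ≡ u I τ + κ * ∂ᵗ (λ J → h J τ) I)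

  private
    Stage : ℕ → Set
    Stage m = ∃ λ h → (∀ ρ → h ∅ ρ ≡ h₀ ρ) × (∀ I → ∣ I ∣ ℕ.≤ m → IsCarried h I)

    start : Stage 0
    start = (λ _ → h₀) , (λ _ → refl) , λ I ∣I∣≤0 → subst (IsCarried (λ _ → h₀)) (sym (∣p∣≡0⇒p≡∅ I (ℕ.n≤0⇒n≡0 ∣I∣≤0)))
      ( subst (λ d → Supported (X ∅) (d ℕ.+ e) h₀) (sym (∣⊥∣≡0 n)) h₀-supp
      , λ τ → trans (∂h₀ τ) (sym (trans (cong (λ z → u ∅ τ + κ * z) (∂ᵗ-vanish {n} {λ _ → h₀ τ} ∅ λ i∈ → ⊥-elim (∉⊥ i∈)))
          (solve 2 (λ x k → x :+ k :* con 0ℚ := x) refl (u ∅ τ) κ))) )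

    step : ∀ m → Stage m → Stage (suc m)
    step m (h , h∅ , carried) = h′ , h′∅ , carried′
      where
      rhs : Subset n → Subset N → ℚ
      rhs I ρ = u I ρ + κ * ∂ᵗ (λ J → h J ρ) I

      module _ (I : Subset n) (∣I∣≡ : ∣ I ∣ ≡ suc m) where
        ne : Nonempty I
        ne = ∣p∣≡suc⇒nonempty I ∣I∣≡
        size : suc (m ℕ.+ e) ≡ ∣ I ∣ ℕ.+ e
        size = cong (ℕ._+ e) (sym ∣I∣≡)
        ∣I∖i∣ : ∀ {i} → i ∈ I → ∣ I ∖ i ∣ ≡ m
        ∣I∖i∣ i∈ = ℕ.suc-injective (trans (∣p∖x∣ i∈) ∣I∣≡)
        facet : ∀ {i} → i ∈ I → IsCarried h (I ∖ i)
        facet i∈ = carried _ (ℕ.≤-reflexive (∣I∖i∣ i∈))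

        rhs-supp : Supported (X I) (m ℕ.+ e) (rhs I)
        rhs-supp ρ ρ∉ = trans
          (cong₂ (λ a b → a + κ * b) (u-supp I (m ℕ.+ e) ne size ρ ρ∉) (∂ᵗ-vanish I λ {i} i∈ →
            proj₁ (facet i∈) ρ λ (ρ∈ , ∣ρ∣≡) →
              ρ∉ (X-mono (p─q⊆p I ⁅ i ⁆) ρ∈ , trans ∣ρ∣≡ (cong (ℕ._+ e) (∣I∖i∣ i∈)))))
          (solve 1 (λ k → con 0ℚ :+ k :* con 0ℚ := con 0ℚ) refl κ)

        -- By the equations for the facets, the boundary of `∂ᵗ h` is `∂ᵗ u` plus a multiple of the
        -- square of `∂ᵗ`, which vanishes; the rest cancels against `∂u`.
        rhs-cycle : ∀ τ → (𝟙 ⌟ rhs I) τ ≡ 0ℚ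
        rhs-cycle τ = begin
          (𝟙 ⌟ rhs I) τ
            ≡⟨ ⌟-+ 𝟙 (u I) (λ ρ → κ * ∂ᵗ (λ J → h J ρ) I) τ ⟩
          (𝟙 ⌟ u I) τ + (𝟙 ⌟ (λ ρ → κ * ∂ᵗ (λ J → h J ρ) I)) τ
            ≡⟨ cong₂ _+_ (∂u I τ) (trans (⌟-scale 𝟙 κ (λ ρ → ∂ᵗ (λ J → h J ρ) I) τ) (cong (κ *_) ∂∂ᵗh)) ⟩
          - (κ * a) + κ * (a + κ * 0ℚ)
            ≡⟨ solve 2 (λ k a → :- (k :* a) :+ k :* (a :+ k :* con 0ℚ) := con 0ℚ) refl κ a ⟩
          0ℚ ∎
          where
          open ≡-Reasoning
          a = ∂ᵗ (λ J → u J τ) I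
          ∂∂ᵗh : (𝟙 ⌟ (λ ρ → ∂ᵗ (λ J → h J ρ) I)) τ ≡ a + κ * 0ℚ
          ∂∂ᵗh = begin
            (𝟙 ⌟ (λ ρ → ∂ᵗ (λ J → h J ρ) I)) τ
              ≡⟨ ⌟-∂ᵗ 𝟙 h I τ ⟩
            ∂ᵗ (λ J → (𝟙 ⌟ h J) τ) I
              ≡⟨ ∂ᵗ-cong I (λ i∈ → proj₂ (facet i∈) τ) ⟩
            ∂ᵗ (λ J → u J τ + κ * ∂ᵗ (λ J → h J τ) J) I
              ≡⟨ ∂ᵗ-+ (λ J → u J τ) (λ J → κ * ∂ᵗ (λ J → h J τ) J) I ⟩
            a + ∂ᵗ (λ J → κ * ∂ᵗ (λ J → h J τ) J) I
              ≡⟨ cong (a +_) (trans (∂ᵗ-scale κ (∂ᵗ (λ J → h J τ)) I) (cong (κ *_) (∂ᵗ-square (λ J → h J τ) I))) ⟩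
            a + κ * 0ℚ ∎

        filling : Σ (Chain (X I) (suc (m ℕ.+ e))) λ b → ∀ σ → ∂ (proj₁ b) σ ≡ rhs I σ
        filling = acyclic I (m ℕ.+ e) ne size (rhs I , rhs-supp)
          λ τ → trans (∂≡𝟙⌟ (rhs I) τ) (rhs-cycle τ)

      pick : ∀ I → Dec (∣ I ∣ ≡ suc m) → Subset N → ℚ
      pick I (yes ∣I∣≡) = proj₁ (proj₁ (filling I ∣I∣≡))
      pick I (no _)     = h I

      h′ : Subset n → Subset N → ℚ
      h′ I = pick I (∣ I ∣ ℕ.≟ suc m)

      h′-old : ∀ I → ∣ I ∣ ≢ suc m → h′ I ≡ h I
      h′-old I ∣I∣≢ with ∣ I ∣ ℕ.≟ suc m
      ... | yes ∣I∣≡ = ⊥-elim (∣I∣≢ ∣I∣≡)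
      ... | no _     = refl

      h′∅ : ∀ ρ → h′ ∅ ρ ≡ h₀ ρ
      h′∅ ρ = trans (cong (λ c → c ρ) (h′-old ∅ λ eq → case trans (sym (∣⊥∣≡0 n)) eq of λ ())) (h∅ ρ)

      carried′ : ∀ I → ∣ I ∣ ℕ.≤ suc m → IsCarried h′ I
      -- Facets of `I` have fewer than `suc m` elements, so the redefinition has not touched the
      -- chains on the right-hand side.
      carried′ I ∣I∣≤ = proj₁ both , λ τ → trans (proj₂ both τ) (cong (λ z → u I τ + κ * z)
          (sym (∂ᵗ-cong I λ {i} i∈ → cong (λ c → c τ) (h′-old (I ∖ i)
            λ eq → ℕ.<-irrefl eq (ℕ.≤-trans (ℕ.≤-reflexive (∣p∖x∣ i∈)) ∣I∣≤)))))
        where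
        both : Supported (X I) (∣ I ∣ ℕ.+ e) (h′ I) × (∀ τ → (𝟙 ⌟ h′ I) τ ≡ rhs I τ)
        both with ∣ I ∣ ℕ.≟ suc m
        ... | no  ∣I∣≢ = carried I (ℕ.≤-pred (ℕ.≤∧≢⇒< ∣I∣≤ ∣I∣≢))
        ... | yes ∣I∣≡ =
          let (b , b-supp) , ∂b = filling I ∣I∣≡ in
          subst (λ d → Supported (X I) (d ℕ.+ e) b) (sym ∣I∣≡) b-supp ,
          λ τ → trans (sym (∂≡𝟙⌟ b τ)) (∂b τ)

    stage : ∀ m → Stage m
    stage zero    = start
    stage (suc m) = step m (stage m)

  carrier : ∃ λ h → (∀ ρ → h ∅ ρ ≡ h₀ ρ) × (∀ I → IsCarried h I)
  carrier = let h , h∅ , carried = stage n in h , h∅ , λ I → carried I (∣p∣≤n I)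

-- Sums over rainbow sets

⟦_⟧ : ∀ {N} → Subset N → Fin N → ℚ
⟦ V ⟧ v = if does (v ∈? V) then 1ℚ else 0ℚ

⟦⟧-∈ : ∀ {N} {V : Subset N} {v} → v ∈ V → ⟦ V ⟧ v ≡ 1ℚ
⟦⟧-∈ {V = V} {v} v∈ = cong (λ b → if b then 1ℚ else 0ℚ) (dec-true (v ∈? V) v∈)

⟦⟧-∉ : ∀ {N} {V : Subset N} {v} → v ∉ V → ⟦ V ⟧ v ≡ 0ℚ
⟦⟧-∉ {V = V} {v} v∉ = cong (λ b → if b then 1ℚ else 0ℚ) (dec-false (v ∈? V) v∉)

-- Up to sign, Φ (V₁ ∷ … ∷ Vₘ ∷ []) c sums the coefficients of c over the sets {v₁, …, vₘ} with vᵢ ∈ Vᵢ,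
-- oriented by the order of the Vᵢ.
Φ : ∀ {N} → List (Subset N) → (Subset N → ℚ) → ℚ
Φ []       c = c ∅
Φ (V ∷ Vs) c = Φ Vs (⟦ V ⟧ ⌟ c)

Rainbow : ∀ {N} → List (Subset N) → Subset N → Set
Rainbow []       ρ = ρ ≡ ∅
Rainbow (V ∷ Vs) ρ = ∃ λ τ → ∃ λ v → Rainbow Vs τ × v ∈ V × v ∉ τ × ρ ≡ τ ∪ ⁅ v ⁆

Φ-cong : ∀ {N} (Vs : List (Subset N)) {c c′ : Subset N → ℚ} → (∀ ρ → Rainbow Vs ρ → c ρ ≡ c′ ρ) → Φ Vs c ≡ Φ Vs c′
Φ-cong []       eq = eq ∅ refl
Φ-cong (V ∷ Vs) {c} {c′} eq = Φ-cong Vs λ τ τ∈ → ⌟-cong τ (term τ τ∈)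
  where
  term : ∀ τ → Rainbow Vs τ → ∀ v → v ∉ τ → ⟦ V ⟧ v * c (τ ∪ ⁅ v ⁆) ≡ ⟦ V ⟧ v * c′ (τ ∪ ⁅ v ⁆)
  term τ τ∈ v v∉ with v ∈? V
  ... | yes v∈ = cong (1ℚ *_) (eq (τ ∪ ⁅ v ⁆) (τ , v , τ∈ , v∈ , v∉ , refl))
  ... | no _   = trans (ℚ.*-zeroˡ (c (τ ∪ ⁅ v ⁆))) (sym (ℚ.*-zeroˡ (c′ (τ ∪ ⁅ v ⁆))))

Φ-zero : ∀ {N} (Vs : List (Subset N)) {c : Subset N → ℚ} → (∀ ρ → c ρ ≡ 0ℚ) → Φ Vs c ≡ 0ℚ
Φ-zero []       c≡0 = c≡0 ∅
Φ-zero (V ∷ Vs) c≡0 = Φ-zero Vs (⌟-zero ⟦ V ⟧ c≡0)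

Φ-+ : ∀ {N} (Vs : List (Subset N)) (c c′ : Subset N → ℚ) → Φ Vs (λ ρ → c ρ + c′ ρ) ≡ Φ Vs c + Φ Vs c′
Φ-+ []       c c′ = refl
Φ-+ (V ∷ Vs) c c′ = trans (Φ-cong Vs λ τ _ → ⌟-+ ⟦ V ⟧ c c′ τ) (Φ-+ Vs (⟦ V ⟧ ⌟ c) (⟦ V ⟧ ⌟ c′))

Φ-neg : ∀ {N} (Vs : List (Subset N)) (c : Subset N → ℚ) → Φ Vs (λ ρ → - c ρ) ≡ - Φ Vs c
Φ-neg []       c = refl
Φ-neg (V ∷ Vs) c = trans (Φ-cong Vs λ τ _ → ⌟-neg ⟦ V ⟧ c τ) (Φ-neg Vs (⟦ V ⟧ ⌟ c))

Φ-∂ᵗ : ∀ {N n} (Vs : List (Subset N)) (f : Subset n → Subset N → ℚ) I →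
  Φ Vs (λ ρ → ∂ᵗ (λ J → f J ρ) I) ≡ ∂ᵗ (λ J → Φ Vs (f J)) I
Φ-∂ᵗ []       f I = refl
Φ-∂ᵗ (V ∷ Vs) f I = trans (Φ-cong Vs λ τ _ → ⌟-∂ᵗ ⟦ V ⟧ f I τ) (Φ-∂ᵗ Vs (λ J → ⟦ V ⟧ ⌟ f J) I)

-- Anticommutativity brings the contraction by `⟦ V ⟧` next to `c` at the cost of a sign.
Φ-vanish : ∀ {N} {V : Subset N} {Vs} → V ∈ₗ Vs → {c : Subset N → ℚ} → (∀ τ → (⟦ V ⟧ ⌟ c) τ ≡ 0ℚ) → Φ Vs c ≡ 0ℚ
Φ-vanish {Vs = V ∷ Vs} (here refl) eq = Φ-zero Vs eq
Φ-vanish {V = V} {W ∷ Vs} (there V∈) {c} eq = Φ-vanish V∈ λ τ →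
  trans (⌟-anticomm ⟦ V ⟧ ⟦ W ⟧ c τ) (cong -_ (⌟-zero ⟦ W ⟧ eq τ))

total : ∀ {N} → List (Subset N) → Fin N → ℚ
total []       v = 0ℚ
total (V ∷ Vs) v = ⟦ V ⟧ v + total Vs v

-- Each class of `Ws` is contracted once more by `Φ Vs`, and contracting twice by the same form
-- gives 0.
Φ-total : ∀ {N} {Vs : List (Subset N)} Ws → (∀ {W} → W ∈ₗ Ws → W ∈ₗ Vs) → (c : Subset N → ℚ) → Φ Vs (total Ws ⌟ c) ≡ 0ℚ
Φ-total {Vs = Vs} []       Ws⊆ c = Φ-zero Vs λ τ → ⌟-vanish τ λ v _ → ℚ.*-zeroˡ (c (τ ∪ ⁅ v ⁆))
Φ-total {Vs = Vs} (W ∷ Ws) Ws⊆ c = begin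
  Φ Vs (total (W ∷ Ws) ⌟ c)
    ≡⟨ Φ-cong Vs (λ τ _ → ⌟-+ˡ ⟦ W ⟧ (total Ws) c τ) ⟩
  Φ Vs (λ τ → (⟦ W ⟧ ⌟ c) τ + (total Ws ⌟ c) τ)
    ≡⟨ Φ-+ Vs (⟦ W ⟧ ⌟ c) (total Ws ⌟ c) ⟩
  Φ Vs (⟦ W ⟧ ⌟ c) + Φ Vs (total Ws ⌟ c)
    ≡⟨ cong₂ _+_ (Φ-vanish (Ws⊆ (here refl)) (⌟-square ⟦ W ⟧ c)) (Φ-total Ws (Ws⊆ ∘ there) c) ⟩
  0ℚ ∎
  where open ≡-Reasoning

classes : ∀ {n N} → (Fin n → Subset N) → Subset n → List (Subset N)
classes V []            = []
classes V (outside ∷ I) = classes (V ∘ suc) I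
classes V (inside ∷ I)  = V zero ∷ classes (V ∘ suc) I

∈-classes : ∀ {n N} (V : Fin n → Subset N) {I i} → i ∈ I → V i ∈ₗ classes V I
∈-classes V {inside ∷ I}  here       = here refl
∈-classes V {inside ∷ I}  (there i∈) = there (∈-classes (V ∘ suc) i∈)
∈-classes V {outside ∷ I} (there i∈) = ∈-classes (V ∘ suc) i∈

Disjoint : ∀ {n N} → (Fin n → Subset N) → Set
Disjoint V = ∀ {i j v} → v ∈ V i → v ∈ V j → i ≡ j

_∈⋃_⟨_⟩ : ∀ {n N} → Fin N → (Fin n → Subset N) → Subset n → Set
v ∈⋃ V ⟨ I ⟩ = ∃ λ i → i ∈ I × v ∈ V i

total-none : ∀ {n N} (V : Fin n → Subset N) I {v} → ¬ v ∈⋃ V ⟨ I ⟩ → total (classes V I) v ≡ 0ℚ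
total-none V []            v∉ = refl
total-none V (outside ∷ I) v∉ = total-none (V ∘ suc) I λ (i , i∈ , v∈) → v∉ (suc i , there i∈ , v∈)
total-none V (inside ∷ I)  v∉ = cong₂ _+_
  (⟦⟧-∉ λ v∈ → v∉ (zero , here , v∈))
  (total-none (V ∘ suc) I λ (i , i∈ , v∈) → v∉ (suc i , there i∈ , v∈))

total-one : ∀ {n N} (V : Fin n → Subset N) → Disjoint V → ∀ I {v} → v ∈⋃ V ⟨ I ⟩ → total (classes V I) v ≡ 1ℚ
total-one V V-disj (outside ∷ I) (suc i , there i∈ , v∈) =
  total-one (V ∘ suc) (λ p q → suc-injective (V-disj p q)) I (i , i∈ , v∈)
total-one V V-disj (inside ∷ I) (zero , here , v∈) = cong₂ _+_ (⟦⟧-∈ v∈)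
  (total-none (V ∘ suc) I λ (j , _ , v∈′) → case V-disj v∈ v∈′ of λ ())
total-one V V-disj (inside ∷ I) (suc i , there i∈ , v∈) = cong₂ _+_
  (⟦⟧-∉ λ v∈′ → case V-disj v∈ v∈′ of λ ())
  (total-one (V ∘ suc) (λ p q → suc-injective (V-disj p q)) I (i , i∈ , v∈))

_∈⋃?_⟨_⟩ : ∀ {n N} v (V : Fin n → Subset N) I → Dec (v ∈⋃ V ⟨ I ⟩)
v ∈⋃? V ⟨ I ⟩ = any? λ i → (i ∈? I) ×-dec (v ∈? V i)

Within : ∀ {n N} → (Fin n → Subset N) → Subset n → (Subset N → ℚ) → Set
Within V I c = ∀ ρ v → v ∈ ρ → ¬ v ∈⋃ V ⟨ I ⟩ → c ρ ≡ 0ℚ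

module _ {n N} (V : Fin n → Subset N) (V-disj : Disjoint V) where

  𝟙⌟≡total⌟ : ∀ I {c : Subset N → ℚ} → Within V I c → ∀ τ → (𝟙 ⌟ c) τ ≡ (total (classes V I) ⌟ c) τ
  𝟙⌟≡total⌟ I {c} within τ = ⌟-cong τ term
    where
    term : ∀ v → v ∉ τ → 1ℚ * c (τ ∪ ⁅ v ⁆) ≡ total (classes V I) v * c (τ ∪ ⁅ v ⁆)
    term v _ with v ∈⋃? V ⟨ I ⟩
    ... | yes v∈ = cong (_* c (τ ∪ ⁅ v ⁆)) (sym (total-one V V-disj I v∈))
    ... | no  v∉ = trans (cong (1ℚ *_) c≡0)
                    (sym (trans (cong (total (classes V I) v *_) c≡0) (ℚ.*-zeroʳ (total (classes V I) v))))
      where c≡0 = within (τ ∪ ⁅ v ⁆) v (q⊆p∪q τ ⁅ v ⁆ (x∈⁅x⁆ v)) v∉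

  Φ-within : ∀ {I Vs i} {c : Subset N → ℚ} → V i ∈ₗ Vs → i ∉ I → Within V I c → Φ Vs c ≡ 0ℚ
  Φ-within {I} {i = i} {c} Vi∈ i∉ within = Φ-vanish Vi∈ λ τ → ⌟-vanish τ (term τ)
    where
    term : ∀ τ v → v ∉ τ → ⟦ V i ⟧ v * c (τ ∪ ⁅ v ⁆) ≡ 0ℚ
    term τ v _ with v ∈? V i
    ... | no _   = ℚ.*-zeroˡ (c (τ ∪ ⁅ v ⁆))
    ... | yes v∈ = cong (1ℚ *_) (within (τ ∪ ⁅ v ⁆) v (q⊆p∪q τ ⁅ v ⁆ (x∈⁅x⁆ v))
                    λ (j , j∈ , v∈′) → i∉ (subst (_∈ I) (V-disj v∈′ v∈) j∈))

-- Only the facet of I that misses the first class contributes to ∂ᵗ.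
Φ-carried : ∀ {n N} (V : Fin n → Subset N) → Disjoint V → (f : Subset n → Subset N → ℚ) →
  (∀ I → Within V I (f I)) → (∀ I τ → (𝟙 ⌟ f I) τ ≡ ∂ᵗ (λ J → f J τ) I) → f ∅ ∅ ≡ 1ℚ →
  ∀ I → Φ (classes V I) (f I) ≡ 1ℚ
Φ-carried V V-disj f within ∂f f∅ [] = f∅
Φ-carried V V-disj f within ∂f f∅ (s ∷ I) = by-side s
  where
  open ≡-Reasoning
  Vs = classes (V ∘ suc) I
  F = f (inside ∷ I)
  without-zero : Φ Vs (f (outside ∷ I)) ≡ 1ℚ
  without-zero = Φ-carried (V ∘ suc) (λ p q → suc-injective (V-disj p q)) (f ∘ (outside ∷_))
    (λ J ρ v v∈ v∉ → within (outside ∷ J) ρ v v∈ λ { (suc i , there i∈ , v∈′) → v∉ (i , i∈ , v∈′) })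
    (λ J τ → ∂f (outside ∷ J) τ) f∅ I
  by-side : ∀ s → Φ (classes V (s ∷ I)) (f (s ∷ I)) ≡ 1ℚ
  by-side outside = without-zero
  by-side inside = begin
    Φ Vs (⟦ V zero ⟧ ⌟ F)
      ≡⟨ sym (ℚ.+-identityʳ (Φ Vs (⟦ V zero ⟧ ⌟ F))) ⟩
    -- The added term, zero by `Φ-total`, completes `⟦ V zero ⟧` to the sum of all class indicators,
    -- which acts on `F` as the boundary.
    Φ Vs (⟦ V zero ⟧ ⌟ F) + 0ℚ
      ≡⟨ cong (Φ Vs (⟦ V zero ⟧ ⌟ F) +_) (sym (Φ-total Vs (λ W∈ → W∈) F)) ⟩
    Φ Vs (⟦ V zero ⟧ ⌟ F) + Φ Vs (total Vs ⌟ F)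
      ≡⟨ sym (Φ-+ Vs (⟦ V zero ⟧ ⌟ F) (total Vs ⌟ F)) ⟩
    Φ Vs (λ τ → (⟦ V zero ⟧ ⌟ F) τ + (total Vs ⌟ F) τ)
      ≡⟨ Φ-cong Vs (λ τ _ → trans (sym (⌟-+ˡ ⟦ V zero ⟧ (total Vs) F τ))
           (trans (sym (𝟙⌟≡total⌟ V V-disj (inside ∷ I) (within (inside ∷ I)) τ)) (∂f (inside ∷ I) τ))) ⟩
    Φ Vs (λ τ → ∂ᵗ (λ J → f J τ) (inside ∷ I))
      ≡⟨ Φ-∂ᵗ Vs f (inside ∷ I) ⟩
    Φ Vs (f (outside ∷ I)) - ∂ᵗ (λ J → Φ Vs (f (inside ∷ J))) I
      -- The facet that omits `suc i` carries no simplex with a vertex in `V (suc i)`, one of the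
      -- classes summed over.
      ≡⟨ cong₂ _-_ without-zero (∂ᵗ-vanish I λ {i} i∈ →
           Φ-within V V-disj {inside ∷ (I ∖ i)} (∈-classes (V ∘ suc) i∈) (λ { (there i∈′) → x∉p∖x I i i∈′ })
             (within (inside ∷ (I ∖ i)))) ⟩
    1ℚ ∎

rainbow⇒within : ∀ {n N} (V : Fin n → Subset N) I {ρ} → Rainbow (classes V I) ρ → ∀ {v} → v ∈ ρ → v ∈⋃ V ⟨ I ⟩
rainbow⇒within V []            refl v∈ = ⊥-elim (∉⊥ v∈)
rainbow⇒within V (outside ∷ I) ρ∈ v∈ =
  let i , i∈ , v∈′ = rainbow⇒within (V ∘ suc) I ρ∈ v∈ in suc i , there i∈ , v∈′
rainbow⇒within V (inside ∷ I) (τ , u , τ∈ , u∈ , _ , refl) v∈ with x∈p∪q⁻ τ ⁅ u ⁆ v∈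
... | inj₁ v∈τ = let i , i∈ , v∈′ = rainbow⇒within (V ∘ suc) I τ∈ v∈τ in suc i , there i∈ , v∈′
... | inj₂ v∈u rewrite x∈⁅y⁆⇒x≡y u v∈u = zero , here , u∈

rainbow⇒∣∩∣≡1 : ∀ {n N} (V : Fin n → Subset N) → Disjoint V → ∀ I {ρ} → Rainbow (classes V I) ρ →
  ∀ {i} → i ∈ I → ∣ ρ ∩ V i ∣ ≡ 1
rainbow⇒∣∩∣≡1 V V-disj (outside ∷ I) ρ∈ (there i∈) =
  rainbow⇒∣∩∣≡1 (V ∘ suc) (λ p q → suc-injective (V-disj p q)) I ρ∈ i∈
rainbow⇒∣∩∣≡1 V V-disj (inside ∷ I) (τ , u , τ∈ , u∈ , _ , refl) here =
  trans (cong ∣_∣ (⊆-antisym only one)) (∣⁅x⁆∣≡1 u)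
  where
  only : (τ ∪ ⁅ u ⁆) ∩ V zero ⊆ ⁅ u ⁆
  only x∈ with x∈p∩q⁻ (τ ∪ ⁅ u ⁆) (V zero) x∈
  ... | x∈′ , x∈V with x∈p∪q⁻ τ ⁅ u ⁆ x∈′
  ...   | inj₂ x∈u = x∈u
  ...   | inj₁ x∈τ = let _ , _ , x∈V′ = rainbow⇒within (V ∘ suc) I τ∈ x∈τ in case V-disj x∈V x∈V′ of λ ()
  one : ⁅ u ⁆ ⊆ (τ ∪ ⁅ u ⁆) ∩ V zero
  one x∈ rewrite x∈⁅y⁆⇒x≡y u x∈ = x∈p∩q⁺ (q⊆p∪q τ ⁅ u ⁆ (x∈⁅x⁆ u) , u∈)
rainbow⇒∣∩∣≡1 V V-disj (inside ∷ I) (τ , u , τ∈ , u∈ , _ , refl) {suc i} (there i∈) =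
  trans (cong ∣_∣ (⊆-antisym drop keep))
    (rainbow⇒∣∩∣≡1 (V ∘ suc) (λ p q → suc-injective (V-disj p q)) I τ∈ i∈)
  where
  drop : (τ ∪ ⁅ u ⁆) ∩ V (suc i) ⊆ τ ∩ V (suc i)
  drop x∈ with x∈p∩q⁻ (τ ∪ ⁅ u ⁆) (V (suc i)) x∈
  ... | x∈′ , x∈V with x∈p∪q⁻ τ ⁅ u ⁆ x∈′
  ...   | inj₁ x∈τ = x∈p∩q⁺ (x∈τ , x∈V)
  ...   | inj₂ x∈u rewrite x∈⁅y⁆⇒x≡y u x∈u = case V-disj u∈ x∈V of λ ()
  keep : τ ∩ V (suc i) ⊆ (τ ∪ ⁅ u ⁆) ∩ V (suc i)
  keep x∈ = let x∈τ , x∈V = x∈p∩q⁻ τ (V (suc i)) x∈ in x∈p∩q⁺ (p⊆p∪q ⁅ u ⁆ x∈τ , x∈V)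

-- The homological case

x∈⋃⁻ : ∀ {n} (ps : List (Subset n)) {x} → x ∈ ⋃ ps → ∃ λ p → p ∈ₗ ps × x ∈ p
x∈⋃⁻ []       x∈ = ⊥-elim (∉⊥ x∈)
x∈⋃⁻ (p ∷ ps) x∈ with x∈p∪q⁻ p (⋃ ps) x∈
... | inj₁ x∈p  = p , here refl , x∈p
... | inj₂ x∈ps = let q , q∈ , x∈q = x∈⋃⁻ ps x∈ps in q , there q∈ , x∈q

x∈⋃⁺ : ∀ {n} {ps : List (Subset n)} {p x} → p ∈ₗ ps → x ∈ p → x ∈ ⋃ ps
x∈⋃⁺ (here refl) x∈ = x∈p∪q⁺ (inj₁ x∈)
x∈⋃⁺ {ps = q ∷ _} (there p∈) x∈ = x∈p∪q⁺ {p = q} (inj₂ (x∈⋃⁺ p∈ x∈))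

module _ {N n} {C : Complex N} (𝒱 : Partition C n) where

  ∈V⇒∈⋃ : ∀ I {v} → v ∈ V[ 𝒱 , I ] → v ∈⋃ part 𝒱 ⟨ I ⟩
  ∈V⇒∈⋃ I v∈ with x∈⋃⁻ (List.map (part 𝒱) (filter (_∈? I) (allFin n))) v∈
  ... | p , p∈ , v∈p with ∈-map⁻ (part 𝒱) p∈
  ...   | i , i∈ , refl = i , proj₂ (∈-filter⁻ (_∈? I) {xs = allFin n} i∈) , v∈p

  ∈⋃⇒∈V : ∀ I {v} → v ∈⋃ part 𝒱 ⟨ I ⟩ → v ∈ V[ 𝒱 , I ]
  ∈⋃⇒∈V I (i , i∈ , v∈) = x∈⋃⁺ (∈-map⁺ (part 𝒱) (∈-filter⁺ (_∈? I) (∈-allFin i) i∈)) v∈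

-- Components of a finite graph

count : ∀ {N} → (Subset N → Bool) → ℕ
count {zero}  P = if P [] then 1 else 0
count {suc N} P = count (P ∘ (outside ∷_)) ℕ.+ count (P ∘ (inside ∷_))

_⇒ᵇ_ : ∀ {N} → (Subset N → Bool) → (Subset N → Bool) → Set
P ⇒ᵇ Q = ∀ σ → P σ ≡ true → Q σ ≡ true

count-mono : ∀ {N} {P Q : Subset N → Bool} → P ⇒ᵇ Q → count P ℕ.≤ count Q
count-mono {zero} {P} {Q} P⇒Q with P [] in P[] | Q [] in Q[]
... | false | _     = z≤n
... | true  | true  = ℕ.≤-refl
... | true  | false = case trans (sym Q[]) (P⇒Q [] P[]) of λ ()
count-mono {suc N} P⇒Q = ℕ.+-mono-≤ (count-mono (P⇒Q ∘ (outside ∷_))) (count-mono (P⇒Q ∘ (inside ∷_)))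

count-strict : ∀ {N} {P Q : Subset N → Bool} → P ⇒ᵇ Q → ∀ σ → P σ ≡ false → Q σ ≡ true → count P ℕ.< count Q
count-strict {zero} {P} {Q} P⇒Q [] Pσ Qσ rewrite Pσ | Qσ = s≤s z≤n
count-strict {suc N} P⇒Q (outside ∷ σ) Pσ Qσ =
  ℕ.+-mono-<-≤ (count-strict (P⇒Q ∘ (outside ∷_)) σ Pσ Qσ) (count-mono (P⇒Q ∘ (inside ∷_)))
count-strict {suc N} P⇒Q (inside ∷ σ) Pσ Qσ =
  ℕ.+-mono-≤-< (count-mono (P⇒Q ∘ (outside ∷_))) (count-strict (P⇒Q ∘ (inside ∷_)) σ Pσ Qσ)

_≟ₛ_ : ∀ {N} (σ τ : Subset N) → Dec (σ ≡ τ)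
_≟ₛ_ = ≡-dec Bool._≟_

-- Membership is Boolean because it becomes a 0-1 coefficient of chains; `sound` turns it back into
-- a path.
record Component {N} (R : Subset N → Subset N → Set) (u : Subset N) : Set where
  field
    S      : Subset N → Bool
    start  : S u ≡ true
    closed : ∀ a b → S a ≡ true → R a b → S b ≡ true
    sound  : ∀ a → S a ≡ true → Star R u a

component : ∀ {N} {R : Subset N → Subset N → Set} → (∀ a b → Dec (R a b)) → ∀ u → Component R u
component {N} {R} R? u = grow (suc (count (not ∘ S₀))) S₀ (ℕ.≤-refl) (dec-true (u ≟ₛ u) refl) sound₀
  where
  S₀ : Subset N → Bool
  S₀ a = does (u ≟ₛ a)
  sound₀ : ∀ a → S₀ a ≡ true → Star R u a
  sound₀ a eq with u ≟ₛ a
  sound₀ a eq | yes refl = nil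
  sound₀ a () | no _

  -- The fuel `k` bounds the number of subsets still outside `S`, which drops whenever an edge
  -- leaving `S` is found.
  grow : ∀ k S → count (not ∘ S) ℕ.< k → S u ≡ true → (∀ a → S a ≡ true → Star R u a) → Component R u
  grow (suc k) S (s≤s bound) start sound
    with anySubset? (λ a → anySubset? λ b → (S a Bool.≟ true) ×-dec R? a b ×-dec (S b Bool.≟ false))
  ... | no none = record { S = S ; start = start ; sound = sound
                         ; closed = λ a b Sa Rab → Bool.¬-not λ Sb → none (a , b , Sa , Rab , Sb) }
  ... | yes (a , b , Sa , Rab , Sb) = grow k S′ (ℕ.<-≤-trans smaller bound) (⊇S u start) sound′
    where
    S′ : Subset N → Bool
    S′ c = does (b ≟ₛ c) ∨ S c
    ⊇S : S ⇒ᵇ S′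
    ⊇S c Sc rewrite Sc = Bool.∨-zeroʳ (does (b ≟ₛ c))
    S′b : S′ b ≡ true
    S′b rewrite dec-true (b ≟ₛ b) refl = refl
    smaller : count (not ∘ S′) ℕ.< count (not ∘ S)
    smaller = count-strict shrink b (cong not S′b) (cong not Sb)
      where
      shrink : (not ∘ S′) ⇒ᵇ (not ∘ S)
      shrink c ¬S′c with S c in Sc
      ... | false = refl
      ... | true  = trans (cong not (sym (Bool.∨-zeroʳ (does (b ≟ₛ c))))) ¬S′c
    sound′ : ∀ c → S′ c ≡ true → Star R u c
    sound′ c eq with b ≟ₛ c
    ... | yes refl = sound a Sa ◅◅ (Rab ◅ nil)
    ... | no _     = sound c eq

-- The empty simplex with coefficient 1, from which every carried chain map starts; it serves also
-- as the indicator of `∅`.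
point : ∀ {N} → Subset N → ℚ
point []            = 1ℚ
point (outside ∷ ρ) = point ρ
point (inside ∷ ρ)  = 0ℚ

∂-point : ∀ {N} (τ : Subset N) → (𝟙 ⌟ point) τ ≡ 0ℚ
∂-point []            = refl
∂-point (outside ∷ τ) = cong (1ℚ * 0ℚ +_) (∂-point τ)
∂-point (inside ∷ τ)  = cong -_ (⌟-zero 𝟙 (λ _ → refl) τ)

point-∅ : ∀ {N} → point (∅ {N}) ≡ 1ℚ
point-∅ {zero}  = refl
point-∅ {suc N} = point-∅ {N}

point-supported : ∀ {N} (X : Complex N) → Supported X 0 point
point-supported {N} X σ σ∉ = vanish σ λ eq → σ∉ (subst (Face X) (sym eq) (∅-face X) , trans (cong ∣_∣ eq) (∣⊥∣≡0 N))
  where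
  vanish : ∀ {N} (σ : Subset N) → σ ≢ ∅ → point σ ≡ 0ℚ
  vanish []            σ≢ = ⊥-elim (σ≢ refl)
  vanish (outside ∷ σ) σ≢ = vanish σ λ eq → σ≢ (cong (outside ∷_) eq)
  vanish (inside ∷ σ)  σ≢ = refl

module Connectivity {N n} (C : Complex N) (𝒱 : Partition C n)
  (acyclic : ∀ I d → Nonempty I → d ℕ.< ∣ I ∣ ℕ.+ 1 → H̃[ d -1]≡0 (C [ V[ 𝒱 , I ] ])) where

  V : Fin n → Subset N
  V = part 𝒱

  V-disj : Disjoint V
  V-disj = disjoint 𝒱

  Vs : List (Subset N)
  Vs = classes V ⊤

  Vᵢ∈Vs : ∀ i → V i ∈ₗ Vs
  Vᵢ∈Vs i = ∈-classes V {⊤} ∈⊤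

  X : Subset n → Complex N
  X I = C [ V[ 𝒱 , I ] ]

  V-mono : ∀ {I J} → I ⊆ J → V[ 𝒱 , I ] ⊆ V[ 𝒱 , J ]
  V-mono {I} {J} I⊆J v∈ = let i , i∈ , v∈′ = ∈V⇒∈⋃ 𝒱 I v∈ in ∈⋃⇒∈V 𝒱 J (i , I⊆J i∈ , v∈′)

  X-mono : ∀ {I J ρ} → I ⊆ J → Face (X I) ρ → Face (X J) ρ
  X-mono I⊆J (ρ∈ , ρ⊆) = ρ∈ , V-mono I⊆J ∘ ρ⊆

  supported⇒within : ∀ {I d c} → Supported (X I) d c → Within V I c
  supported⇒within {I} supp ρ v v∈ v∉ = supp ρ λ ((_ , ρ⊆) , _) → v∉ (∈V⇒∈⋃ 𝒱 I (ρ⊆ v∈))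

  module Carried (Y : Subset n → Complex N) (Y⊆X : ∀ {I ρ} → Face (Y I) ρ → Face (X I) ρ)
    (Y-mono : ∀ {I J ρ} → I ⊆ J → Face (Y I) ρ → Face (Y J) ρ)
    (Y-acyclic : ∀ I d → Nonempty I → d ℕ.< ∣ I ∣ → H̃[ d -1]≡0 (Y I)) where

    private
      built = carrier Y Y-mono 0 1ℚ (λ _ _ → 0ℚ) point (point-supported (Y ∅)) ∂-point
        (λ I τ → trans (⌟-zero 𝟙 (λ _ → refl) τ) (sym (cong (λ z → - (1ℚ * z)) (∂ᵗ-vanish {f = λ _ → 0ℚ} I λ _ → refl))))
        (λ _ _ _ _ _ _ → refl)
        (λ I d ne eq → Y-acyclic I d ne (ℕ.≤-reflexive (trans eq (ℕ.+-identityʳ ∣ I ∣))))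

    f : Subset n → Subset N → ℚ
    f = proj₁ built

    f-∅ : ∀ ρ → f ∅ ρ ≡ point ρ
    f-∅ = proj₁ (proj₂ built)

    f-supp : ∀ I → Supported (Y I) ∣ I ∣ (f I)
    f-supp I = subst (λ d → Supported (Y I) d (f I)) (ℕ.+-identityʳ ∣ I ∣) (proj₁ (proj₂ (proj₂ built) I))

    f-suppX : ∀ I → Supported (X I) ∣ I ∣ (f I)
    f-suppX I ρ ρ∉ = f-supp I ρ λ (ρ∈ , ∣ρ∣) → ρ∉ (Y⊆X ρ∈ , ∣ρ∣)

    ∂f : ∀ I τ → (𝟙 ⌟ f I) τ ≡ ∂ᵗ (λ J → f J τ) I
    ∂f I τ = trans (proj₂ (proj₂ (proj₂ built) I) τ)
      (solve 1 (λ x → con 0ℚ :+ con 1ℚ :* x := x) refl (∂ᵗ (λ J → f J τ) I))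

    Φf≡1 : Φ Vs (f ⊤) ≡ 1ℚ
    Φf≡1 = Φ-carried V V-disj f (λ I → supported⇒within (f-suppX I)) ∂f (trans (f-∅ ∅) (point-∅ {N})) ⊤

  rainbow⇒colours : ∀ {ρ} → Rainbow Vs ρ → ∀ i → ∣ ρ ∩ V i ∣ ≡ 1
  rainbow⇒colours ρ∈ i = rainbow⇒∣∩∣≡1 V V-disj ⊤ ρ∈ ∈⊤

  Colorful? : ∀ σ → Dec (Colorful C 𝒱 σ)
  Colorful? σ = Face? C σ ×-dec all? λ i → ∣ σ ∩ V i ∣ ℕ.≟ 1

  exists : ∃ (Colorful C 𝒱)
  exists with anySubset? Colorful?
  ... | yes found = found
  ... | no none = case trans (sym Φf≡1) (trans (Φ-cong Vs vanish) (Φ-zero Vs {λ _ → 0ℚ} λ _ → refl)) of λ ()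
    where
    open Carried X (λ ρ∈ → ρ∈) X-mono (λ I d ne d< → acyclic I d ne (ℕ.<-≤-trans d< (ℕ.m≤m+n ∣ I ∣ 1)))
    vanish : ∀ ρ → Rainbow Vs ρ → f ⊤ ρ ≡ 0ℚ
    vanish ρ ρ∈ = f-supp ⊤ ρ λ ((ρ-face , _) , _) → none (ρ , ρ-face , rainbow⇒colours ρ∈)

  -- Each vertex of `σ` lies in some class; `ρ` has a vertex in that class too, and `σ` has only one
  -- there.
  colorful-⊆ : ∀ {ρ σ} → (∀ i → ∣ ρ ∩ V i ∣ ≡ 1) → Colorful C 𝒱 σ → ρ ⊆ σ → ρ ≡ σ
  colorful-⊆ {ρ} {σ} ρ-col (σ∈ , σ-col) ρ⊆σ = ⊆-antisym ρ⊆σ λ {x} x∈σ →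
    let i , x∈V = Equivalence.to (covers 𝒱 x) (down-closed C (λ y∈ → subst (_∈ σ) (sym (x∈⁅y⁆⇒x≡y x y∈)) x∈σ) σ∈)
        y , y∈  = ∣p∣≡suc⇒nonempty (ρ ∩ V i) (ρ-col i)
        y∈ρ , y∈V = x∈p∩q⁻ ρ (V i) y∈
        y≡x = ∣p∣≡1⇒unique (σ ∩ V i) (σ-col i) (x∈p∩q⁺ (ρ⊆σ y∈ρ , y∈V)) (x∈p∩q⁺ (x∈σ , x∈V))
    in subst (_∈ ρ) y≡x y∈ρ

  module Simplex (σ : Subset N) (σ-col : Colorful C 𝒱 σ) where

    Y : Subset n → Complex N
    Y I = X I [ σ ]

    -- Y I is a simplex, so coning off a vertex fills every cycle.
    Y-acyclic : ∀ I d → Nonempty I → d ℕ.< ∣ I ∣ → H̃[ d -1]≡0 (Y I)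
    Y-acyclic I d (i , i∈) _ (z , z-supp) ∂z = (cone v z , cone-supp) , λ ρ → begin
      ∂ (cone v z) ρ           ≡⟨ ∂≡𝟙⌟ (cone v z) ρ ⟩
      (𝟙 ⌟ cone v z) ρ         ≡⟨ ∂-cone v z ρ ⟩
      z ρ - cone v (𝟙 ⌟ z) ρ   ≡⟨ cong (λ u → z ρ - u) (cone-vanish v ρ λ _ → trans (sym (∂≡𝟙⌟ z (ρ ∖ v))) (∂z (ρ ∖ v))) ⟩
      z ρ - 0ℚ                 ≡⟨ solve 1 (λ x → x :- con 0ℚ := x) refl (z ρ) ⟩
      z ρ                      ∎
      where
      open ≡-Reasoning
      v : Fin N
      v = proj₁ (∣p∣≡suc⇒nonempty (σ ∩ V i) (proj₂ σ-col i))
      v∈σ∩V : v ∈ σ × v ∈ V i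
      v∈σ∩V = x∈p∩q⁻ σ (V i) (proj₂ (∣p∣≡suc⇒nonempty (σ ∩ V i) (proj₂ σ-col i)))
      cone-supp : Supported (Y I) (suc d) (cone v z)
      cone-supp ρ ρ∉ = cone-vanish v ρ λ v∈ρ → z-supp (ρ ∖ v) λ (((_ , ⊆VI) , ⊆σ) , ∣ρ∖v∣) →
        let split : ∀ {A : Subset N} → v ∈ A → ρ ∖ v ⊆ A → ρ ⊆ A
            split {A} v∈A ⊆A {x} x∈ = case x Fin.≟ v of λ where
              (yes x≡v) → subst (_∈ A) (sym x≡v) v∈A
              (no  x≢v) → ⊆A (x∈p∧x≢y⇒x∈p-y x∈ x≢v)
            ρ⊆σ = split (proj₁ v∈σ∩V) ⊆σ
        in ρ∉ ( ((down-closed C ρ⊆σ (proj₁ σ-col) , split (∈⋃⇒∈V 𝒱 I (i , i∈ , proj₂ v∈σ∩V)) ⊆VI) , ρ⊆σ)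
              , trans (sym (∣p∖x∣ v∈ρ)) (cong suc ∣ρ∖v∣))

    open Carried Y proj₁ (λ I⊆J (ρ∈ , ρ⊆) → X-mono I⊆J ρ∈ , ρ⊆) Y-acyclic public

    f-only : ∀ ρ → Rainbow Vs ρ → ρ ≢ σ → f ⊤ ρ ≡ 0ℚ
    f-only ρ ρ∈ ρ≢σ = f-supp ⊤ ρ λ ((_ , ρ⊆σ) , _) → ρ≢σ (colorful-⊆ (rainbow⇒colours ρ∈) σ-col ρ⊆σ)

  Adjacent : Subset N → Subset N → Set
  Adjacent a b = Colorful C 𝒱 a × Colorful C 𝒱 b × Graph.Adj (RG C 𝒱) a b

  Adjacent? : ∀ a b → Dec (Adjacent a b)
  Adjacent? a b = Colorful? a ×-dec Colorful? b ×-dec Face? C (a ∪ b) ×-dec (∣ a ∪ b ∣ ℕ.≟ n ℕ.+ 1)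

  module Path (σ τ : Subset N) (σ-col : Colorful C 𝒱 σ) (τ-col : Colorful C 𝒱 τ) where
    open Component (component Adjacent? σ)
    module σ = Simplex σ σ-col
    module τ = Simplex τ τ-col

    u : Subset n → Subset N → ℚ
    u I ρ = τ.f I ρ - σ.f I ρ

    private
      -- Both chain maps take the value `point` at `∅`, so their homotopy can begin with 0.
      built = carrier X X-mono 1 (- 1ℚ) u (λ _ → 0ℚ) (λ _ _ → refl)
        (λ ρ → trans (⌟-zero 𝟙 (λ _ → refl) ρ) (sym (trans (cong₂ _-_ (τ.f-∅ ρ) (σ.f-∅ ρ)) (ℚ.+-inverseʳ (point ρ)))))
        ∂u
        (λ I d _ eq ρ ρ∉ →
          let ρ∉′ = λ (ρ∈ , ∣ρ∣) → ρ∉ (ρ∈ , ℕ.suc-injective (trans (cong suc ∣ρ∣) (trans (ℕ.+-comm 1 ∣ I ∣) (sym eq))))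
          in cong₂ _-_ (τ.f-suppX I ρ ρ∉′) (σ.f-suppX I ρ ρ∉′))
        -- Here `d` equals `∣ I ∣`: the homotopy is what uses the bound `∣ I ∣ + 1`, whereas the
        -- existence of a colourful simplex uses only degrees below `∣ I ∣`.
        (λ I d ne eq → acyclic I d ne (ℕ.≤-reflexive eq))
        where
        ∂u : ∀ I ρ → (𝟙 ⌟ u I) ρ ≡ - ((- 1ℚ) * ∂ᵗ (λ J → u J ρ) I)
        ∂u I ρ = begin
          (𝟙 ⌟ u I) ρ
            ≡⟨ trans (⌟-+ 𝟙 (τ.f I) (λ ρ → - σ.f I ρ) ρ) (cong₂ _+_ (τ.∂f I ρ) (trans (⌟-neg 𝟙 (σ.f I) ρ) (cong -_ (σ.∂f I ρ)))) ⟩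
          a - b
            ≡⟨ solve 2 (λ a b → a :- b := :- (con (- 1ℚ) :* (a :- b))) refl a b ⟩
          - ((- 1ℚ) * (a - b))
            ≡⟨ cong (λ z → - ((- 1ℚ) * z)) (sym (trans (∂ᵗ-+ (λ J → τ.f J ρ) (λ J → - σ.f J ρ) I)
                 (cong (a +_) (∂ᵗ-neg (λ J → σ.f J ρ) I)))) ⟩
          - ((- 1ℚ) * ∂ᵗ (λ J → u J ρ) I) ∎
          where
          open ≡-Reasoning
          a = ∂ᵗ (λ J → τ.f J ρ) I
          b = ∂ᵗ (λ J → σ.f J ρ) I

    h : Subset n → Subset N → ℚ
    h = proj₁ built

    h-supp : ∀ I → Supported (X I) (∣ I ∣ ℕ.+ 1) (h I)
    h-supp I = proj₁ (proj₂ (proj₂ built) I)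

    u≡ : ∀ I ρ → u I ρ ≡ (𝟙 ⌟ h I) ρ + ∂ᵗ (λ J → h J ρ) I
    u≡ I ρ = trans
      (solve 2 (λ x y → x := (x :+ con (- 1ℚ) :* y) :+ y) refl (u I ρ) (∂ᵗ (λ J → h J ρ) I))
      (cong (_+ ∂ᵗ (λ J → h J ρ) I) (sym (proj₂ (proj₂ (proj₂ built) I) ρ)))

    -- `s` is the indicator of the component of `σ`. `ŝ` transports it to simplices of size `n + 1`,
    -- so that on rainbow sets multiplying by `s` after the boundary equals multiplying by `ŝ`
    -- before it.
    s ŝ : Subset N → ℚ
    s ρ = if S ρ then 1ℚ else 0ℚ
    Ŝ? : ∀ ρ → Dec (∃ λ τ → τ ⊆ ρ × Colorful C 𝒱 τ × S τ ≡ true)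
    Ŝ? ρ = anySubset? λ τ → (τ ⊆? ρ) ×-dec Colorful? τ ×-dec (S τ Bool.≟ true)
    ŝ ρ = if does (Ŝ? ρ) then 1ℚ else 0ℚ

    -- A simplex of size n + 1 has at most two colourful facets, and they are adjacent.
    ŝ≡s : ∀ ρ v → v ∉ ρ → Colorful C 𝒱 ρ → Face C (ρ ∪ ⁅ v ⁆) → ∣ ρ ∪ ⁅ v ⁆ ∣ ≡ n ℕ.+ 1 → ŝ (ρ ∪ ⁅ v ⁆) ≡ s ρ
    ŝ≡s ρ v v∉ ρ-col ρv∈ ∣ρv∣ = cong (if_then 1ℚ else 0ℚ) agree
      where
      agree : does (Ŝ? (ρ ∪ ⁅ v ⁆)) ≡ S ρ
      agree with Ŝ? (ρ ∪ ⁅ v ⁆)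
      agree | no none with S ρ in Sρ
      ... | false = refl
      ... | true  = ⊥-elim (none (ρ , p⊆p∪q ⁅ v ⁆ , ρ-col , Sρ))
      agree | yes (π , π⊆ , π-col , Sπ) with v ∈? π
      ... | yes v∈ = sym (closed π ρ Sπ (π-col , ρ-col , subst (Face C) (sym πρ≡) ρv∈ , trans (cong ∣_∣ πρ≡) ∣ρv∣))
        where
        πρ≡ : π ∪ ρ ≡ ρ ∪ ⁅ v ⁆
        πρ≡ = ⊆-antisym
          (λ x∈ → [ π⊆ , p⊆p∪q ⁅ v ⁆ ]′ (x∈p∪q⁻ π ρ x∈))
          (λ x∈ → [ q⊆p∪q π ρ , (λ x∈v → p⊆p∪q ρ (subst (_∈ π) (sym (x∈⁅y⁆⇒x≡y v x∈v)) v∈)) ]′ (x∈p∪q⁻ ρ ⁅ v ⁆ x∈))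
      ... | no v∉π = trans (sym Sπ) (cong S (colorful-⊆ (proj₂ π-col) ρ-col λ {x} x∈ →
        [ (λ x∈ρ → x∈ρ) , (λ x∈v → ⊥-elim (v∉π (subst (_∈ π) (x∈⁅y⁆⇒x≡y v x∈v) x∈))) ]′ (x∈p∪q⁻ ρ ⁅ v ⁆ (π⊆ x∈))))

    s∂h≡∂ŝh : ∀ ρ → Rainbow Vs ρ → s ρ * (𝟙 ⌟ h ⊤) ρ ≡ (𝟙 ⌟ (λ π → ŝ π * h ⊤ π)) ρ
    s∂h≡∂ŝh ρ ρ∈ = sym (⌟-local (s ρ) ρ term)
      where
      term : ∀ v → v ∉ ρ → 1ℚ * (ŝ (ρ ∪ ⁅ v ⁆) * h ⊤ (ρ ∪ ⁅ v ⁆)) ≡ s ρ * (1ℚ * h ⊤ (ρ ∪ ⁅ v ⁆))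
      term v v∉ = [ on-face , (λ h≡0 → trans (cong (λ z → 1ℚ * (ŝ (ρ ∪ ⁅ v ⁆) * z)) h≡0)
          (trans (solve 2 (λ s t → con 1ℚ :* (s :* con 0ℚ) := t :* (con 1ℚ :* con 0ℚ)) refl (ŝ (ρ ∪ ⁅ v ⁆)) (s ρ))
            (cong (λ z → s ρ * (1ℚ * z)) (sym h≡0)))) ]′
        (Supported? {X = X ⊤} (h-supp ⊤) (ρ ∪ ⁅ v ⁆))
        where
        on-face : Face (X ⊤) (ρ ∪ ⁅ v ⁆) × ∣ ρ ∪ ⁅ v ⁆ ∣ ≡ ∣ ⊤ {n} ∣ ℕ.+ 1 →
          1ℚ * (ŝ (ρ ∪ ⁅ v ⁆) * h ⊤ (ρ ∪ ⁅ v ⁆)) ≡ s ρ * (1ℚ * h ⊤ (ρ ∪ ⁅ v ⁆))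
        on-face ((ρv∈ , _) , ∣ρv∣) = trans
          (cong (λ z → 1ℚ * (z * h ⊤ (ρ ∪ ⁅ v ⁆))) (ŝ≡s ρ v v∉ (down-closed C (p⊆p∪q ⁅ v ⁆) ρv∈ , rainbow⇒colours ρ∈)
            ρv∈ (trans ∣ρv∣ (cong (ℕ._+ 1) (∣⊤∣≡n n)))))
          (solve 2 (λ s h → con 1ℚ :* (s :* h) := s :* (con 1ℚ :* h)) refl (s ρ) (h ⊤ (ρ ∪ ⁅ v ⁆)))

    scaled-within : ∀ {I c} (k : Subset N → ℚ) → Within V I c → Within V I (λ ρ → k ρ * c ρ)
    scaled-within k within ρ v v∈ v∉ = trans (cong (k ρ *_) (within ρ v v∈ v∉)) (ℚ.*-zeroʳ (k ρ))

    -- On rainbow sets the chain is the boundary of `ŝ` times `h ⊤`, with sum 0 by `Φ-total`, plus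
    -- chains that miss a whole class and so vanish on rainbow sets.
    Φsu≡0 : Φ Vs (λ ρ → s ρ * u ⊤ ρ) ≡ 0ℚ
    Φsu≡0 = begin
      Φ Vs (λ ρ → s ρ * u ⊤ ρ)
        ≡⟨ Φ-cong Vs (λ ρ ρ∈ → trans (cong (s ρ *_) (u≡ ⊤ ρ)) (trans (ℚ.*-distribˡ-+ (s ρ) ((𝟙 ⌟ h ⊤) ρ) (∂ᵗ (λ J → h J ρ) ⊤))
             (cong₂ _+_ (trans (s∂h≡∂ŝh ρ ρ∈) (𝟙⌟≡total⌟ V V-disj ⊤ (scaled-within ŝ (supported⇒within (h-supp ⊤))) ρ))
               (sym (∂ᵗ-scale (s ρ) (λ J → h J ρ) ⊤))))) ⟩
      Φ Vs (λ ρ → (total Vs ⌟ (λ π → ŝ π * h ⊤ π)) ρ + ∂ᵗ (λ J → s ρ * h J ρ) ⊤)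
        ≡⟨ Φ-+ Vs (total Vs ⌟ (λ π → ŝ π * h ⊤ π)) (λ ρ → ∂ᵗ (λ J → s ρ * h J ρ) ⊤) ⟩
      Φ Vs (total Vs ⌟ (λ π → ŝ π * h ⊤ π)) + Φ Vs (λ ρ → ∂ᵗ (λ J → s ρ * h J ρ) ⊤)
        ≡⟨ cong₂ _+_ (Φ-total Vs (λ W∈ → W∈) (λ π → ŝ π * h ⊤ π))
             (trans (Φ-∂ᵗ Vs (λ J ρ → s ρ * h J ρ) ⊤) (∂ᵗ-vanish ⊤ λ {i} _ →
               Φ-within V V-disj {⊤ ∖ i} (Vᵢ∈Vs i) (x∉p∖x ⊤ i) (scaled-within s (supported⇒within (h-supp (⊤ ∖ i)))))) ⟩
      0ℚ ∎
      where open ≡-Reasoning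

    -- On rainbow sets `τ.f ⊤` and `σ.f ⊤` are concentrated at `τ` and `σ`. If `τ` were outside the
    -- component, `s` would kill the former and fix the latter, so the colourful sum would be -1
    -- instead of 0.
    S-τ : S τ ≡ true
    S-τ with S τ in Sτ
    ... | true  = refl
    ... | false = case trans (sym Φsu≡0) (begin
      Φ Vs (λ ρ → s ρ * u ⊤ ρ)
        ≡⟨ Φ-cong Vs only-σ ⟩
      Φ Vs (λ ρ → - σ.f ⊤ ρ)
        ≡⟨ trans (Φ-neg Vs (σ.f ⊤)) (cong -_ σ.Φf≡1) ⟩
      - 1ℚ ∎) of λ ()
      where
      open ≡-Reasoning
      only-σ : ∀ ρ → Rainbow Vs ρ → s ρ * u ⊤ ρ ≡ - σ.f ⊤ ρ
      only-σ ρ ρ∈ = begin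
        s ρ * (τ.f ⊤ ρ - σ.f ⊤ ρ)
          ≡⟨ solve 3 (λ s a b → s :* (a :- b) := s :* a :- s :* b) refl (s ρ) (τ.f ⊤ ρ) (σ.f ⊤ ρ) ⟩
        s ρ * τ.f ⊤ ρ - s ρ * σ.f ⊤ ρ
          ≡⟨ cong₂ _-_ sτ≡0 sσ≡σ ⟩
        0ℚ - σ.f ⊤ ρ
          ≡⟨ ℚ.+-identityˡ (- σ.f ⊤ ρ) ⟩
        - σ.f ⊤ ρ ∎
        where
        sτ≡0 : s ρ * τ.f ⊤ ρ ≡ 0ℚ
        sτ≡0 with ρ ≟ₛ τ
        ... | yes refl = trans (cong (λ b → (if b then 1ℚ else 0ℚ) * τ.f ⊤ ρ) Sτ) (ℚ.*-zeroˡ (τ.f ⊤ ρ))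
        ... | no  ρ≢τ  = trans (cong (s ρ *_) (τ.f-only ρ ρ∈ ρ≢τ)) (ℚ.*-zeroʳ (s ρ))
        sσ≡σ : s ρ * σ.f ⊤ ρ ≡ σ.f ⊤ ρ
        sσ≡σ with ρ ≟ₛ σ
        ... | yes refl = trans (cong (λ b → (if b then 1ℚ else 0ℚ) * σ.f ⊤ ρ) start) (ℚ.*-identityˡ (σ.f ⊤ ρ))
        ... | no  ρ≢σ  = trans (cong (s ρ *_) f≡0) (trans (ℚ.*-zeroʳ (s ρ)) (sym f≡0))
          where f≡0 = σ.f-only ρ ρ∈ ρ≢σ

    path : Star Adjacent σ τ
    path = sound τ S-τ

  connected : Connected (RG C 𝒱)
  connected = exists , λ σ τ σ-col τ-col → Path.path σ τ σ-col τ-col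

-- Chains of labelled lattice cubes

cone-alternating : ∀ {N n} v (f : Fin n → Subset n → Subset N → ℚ) σ τ →
  cone v (λ ρ → alternating (λ i υ → f i υ ρ) σ) τ ≡ alternating (λ i υ → cone v (f i υ) τ) σ
cone-alternating v f [] τ = cone-vanish v τ λ _ → refl
cone-alternating v f (outside ∷ σ) τ = cone-alternating v (λ i υ → f (suc i) (outside ∷ υ)) σ τ
cone-alternating v f (inside ∷ σ) τ = trans
  (cone-+ v (f zero (outside ∷ σ)) (λ ρ → - alternating (λ i υ → f (suc i) (inside ∷ υ) ρ) σ) τ)
  (cong (cone v (f zero (outside ∷ σ)) τ +_) (trans
    (cone-neg v (λ ρ → alternating (λ i υ → f (suc i) (inside ∷ υ) ρ) σ) τ)
    (cong -_ (cone-alternating v (λ i υ → f (suc i) (inside ∷ υ)) σ τ))))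

-- Lattice cubes are indexed by their top corner T, so that their upper faces are given by the facets of σ alone.
corner : ∀ {N} → Vec ℕ N → Subset N → Vec ℕ N
corner []      []            = []
corner (t ∷ T) (outside ∷ σ) = t ∷ corner T σ
corner (t ∷ T) (inside ∷ σ)  = ℕ.pred t ∷ corner T σ

lower : ∀ {N} → Vec ℕ N → Fin N → Vec ℕ N
lower (t ∷ T) zero    = ℕ.pred t ∷ T
lower (t ∷ T) (suc i) = t ∷ lower T i

corner-lower : ∀ {N} (T : Vec ℕ N) {σ i} → i ∈ σ → corner (lower T i) (σ ∖ i) ≡ corner T σ
corner-lower (t ∷ T) {inside ∷ σ} here = cong (λ υ → ℕ.pred t ∷ corner T υ) (p─⊥≡p σ)
corner-lower (t ∷ T) {inside ∷ σ} (there i∈) = cong (ℕ.pred t ∷_) (corner-lower T i∈)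
corner-lower (t ∷ T) {outside ∷ σ} (there i∈) = cong (t ∷_) (corner-lower T i∈)

Carried : ∀ {N} → Vec ℕ N → Subset N → Set
Carried T σ = ∀ i → i ∉ σ → lookup T i ≡ 0

corner-≤ : ∀ {N} (T : Vec ℕ N) ε i → lookup (corner T ε) i ℕ.≤ lookup T i
corner-≤ (t ∷ T) (outside ∷ ε) zero    = ℕ.≤-refl
corner-≤ (t ∷ T) (inside ∷ ε)  zero    = ℕ.pred[n]≤n
corner-≤ (t ∷ T) (outside ∷ ε) (suc i) = corner-≤ T ε i
corner-≤ (t ∷ T) (inside ∷ ε)  (suc i) = corner-≤ T ε i

corner-∉ : ∀ {N} (T : Vec ℕ N) ε i → i ∉ ε → lookup (corner T ε) i ≡ lookup T i
corner-∉ (t ∷ T) (outside ∷ ε) zero    i∉ = refl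
corner-∉ (t ∷ T) (inside ∷ ε)  zero    i∉ = ⊥-elim (i∉ here)
corner-∉ (t ∷ T) (outside ∷ ε) (suc i) i∉ = corner-∉ T ε i λ i∈ → i∉ (there i∈)
corner-∉ (t ∷ T) (inside ∷ ε)  (suc i) i∉ = corner-∉ T ε i λ i∈ → i∉ (there i∈)

module _ (M : ℕ) where

  ∑< : ℕ → (ℕ → ℚ) → ℚ
  ∑< zero    f = 0ℚ
  ∑< (suc k) f = f k + ∑< k f

  -- The sum over the lattice cubes that tile [0 , M]^σ.
  box : ∀ {N} → Subset N → (Vec ℕ N → ℚ) → ℚ
  box []            f = f []
  box (outside ∷ σ) f = box σ (f ∘ (0 ∷_))
  box (inside ∷ σ)  f = ∑< M λ x → box σ (f ∘ (suc x ∷_))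

  ∑<-cong : ∀ k {f g : ℕ → ℚ} → (∀ x → f x ≡ g x) → ∑< k f ≡ ∑< k g
  ∑<-cong zero    eq = refl
  ∑<-cong (suc k) eq = cong₂ _+_ (eq k) (∑<-cong k eq)

  ∑<-lin : ∀ k a (f g : ℕ → ℚ) → ∑< k (λ x → f x + a * g x) ≡ ∑< k f + a * ∑< k g
  ∑<-lin zero    a f g = solve 1 (λ a → con 0ℚ := con 0ℚ :+ a :* con 0ℚ) refl a
  ∑<-lin (suc k) a f g = trans (cong (f k + a * g k +_) (∑<-lin k a f g))
    (solve 5 (λ a f g x y → (f :+ a :* g) :+ (x :+ a :* y) := (f :+ x) :+ a :* (g :+ y)) refl
      a (f k) (g k) (∑< k f) (∑< k g))

  ∑<-telescope : ∀ k (f : ℕ → ℚ) → ∑< k (λ x → f (suc x) - f x) ≡ f k - f 0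
  ∑<-telescope zero    f = sym (ℚ.+-inverseʳ (f 0))
  ∑<-telescope (suc k) f = trans (cong (f (suc k) - f k +_) (∑<-telescope k f))
    (solve 3 (λ a b c → (a :- b) :+ (b :- c) := a :- c) refl (f (suc k)) (f k) (f 0))

  box-cong : ∀ {N} (σ : Subset N) {f g : Vec ℕ N → ℚ} → (∀ T → Carried T σ → f T ≡ g T) → box σ f ≡ box σ g
  box-cong [] eq = eq [] λ ()
  box-cong (outside ∷ σ) eq = box-cong σ λ T T⊑ → eq (0 ∷ T) λ { zero _ → refl ; (suc i) i∉ → T⊑ i λ i∈ → i∉ (there i∈) }
  box-cong (inside ∷ σ)  eq = ∑<-cong M λ x → box-cong σ λ T T⊑ →
    eq (suc x ∷ T) λ { zero i∉ → ⊥-elim (i∉ here) ; (suc i) i∉ → T⊑ i λ i∈ → i∉ (there i∈) }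

  box-lin : ∀ {N} (σ : Subset N) a (f g : Vec ℕ N → ℚ) → box σ (λ T → f T + a * g T) ≡ box σ f + a * box σ g
  box-lin []            a f g = refl
  box-lin (outside ∷ σ) a f g = box-lin σ a (f ∘ (0 ∷_)) (g ∘ (0 ∷_))
  box-lin (inside ∷ σ)  a f g = trans
    (∑<-cong M λ x → box-lin σ a (f ∘ (suc x ∷_)) (g ∘ (suc x ∷_)))
    (∑<-lin M a (λ x → box σ (f ∘ (suc x ∷_))) (λ x → box σ (g ∘ (suc x ∷_))))

  box-+ : ∀ {N} (σ : Subset N) (f g : Vec ℕ N → ℚ) → box σ (λ T → f T + g T) ≡ box σ f + box σ g
  box-+ σ f g = trans (box-cong σ λ T _ → cong (f T +_) (sym (ℚ.*-identityˡ (g T))))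
    (trans (box-lin σ 1ℚ f g) (cong (box σ f +_) (ℚ.*-identityˡ (box σ g))))

  box-∸ : ∀ {N} (σ : Subset N) (f g : Vec ℕ N → ℚ) → box σ (λ T → f T - g T) ≡ box σ f - box σ g
  box-∸ σ f g = trans
    (box-cong σ λ T _ → solve 2 (λ a b → a :- b := a :+ con (- 1ℚ) :* b) refl (f T) (g T))
    (trans (box-lin σ (- 1ℚ) f g) (solve 2 (λ a b → a :+ con (- 1ℚ) :* b := a :- b) refl (box σ f) (box σ g)))

  box-zero : ∀ {N} (σ : Subset N) {f : Vec ℕ N → ℚ} → (∀ T → Carried T σ → f T ≡ 0ℚ) → box σ f ≡ 0ℚ
  box-zero σ {f} eq = trans (box-cong σ {g = λ T → f T - f T} λ T T⊑ → trans (eq T T⊑) (sym (ℚ.+-inverseʳ (f T))))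
    (trans (box-∸ σ f f) (ℚ.+-inverseʳ (box σ f)))

  ⌟-∑< : ∀ {N} k (w : Fin N → ℚ) (c : ℕ → Subset N → ℚ) τ → (w ⌟ (λ ρ → ∑< k (λ x → c x ρ))) τ ≡ ∑< k (λ x → (w ⌟ c x) τ)
  ⌟-∑< zero    w c τ = ⌟-zero w (λ _ → refl) τ
  ⌟-∑< (suc k) w c τ = trans (⌟-+ w (c k) (λ ρ → ∑< k (λ x → c x ρ)) τ) (cong ((w ⌟ c k) τ +_) (⌟-∑< k w c τ))

  ⌟-box : ∀ {N n} (w : Fin N → ℚ) (σ : Subset n) (c : Vec ℕ n → Subset N → ℚ) τ →
    (w ⌟ (λ ρ → box σ (λ T → c T ρ))) τ ≡ box σ (λ T → (w ⌟ c T) τ)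
  ⌟-box w []            c τ = refl
  ⌟-box w (outside ∷ σ) c τ = ⌟-box w σ (c ∘ (0 ∷_)) τ
  ⌟-box w (inside ∷ σ)  c τ = trans
    (⌟-∑< M w (λ x ρ → box σ (λ T → c (suc x ∷ T) ρ)) τ)
    (∑<-cong M λ x → ⌟-box w σ (c ∘ (suc x ∷_)) τ)

  ∑<-alternating : ∀ {N} k (f : ℕ → Fin N → Subset N → ℚ) σ →
    ∑< k (λ x → alternating (f x) σ) ≡ alternating (λ i τ → ∑< k (λ x → f x i τ)) σ
  ∑<-alternating zero    f σ = sym (alternating-vanish σ λ _ → refl)
  ∑<-alternating (suc k) f σ = trans (cong (alternating (f k) σ +_) (∑<-alternating k f σ))
    (sym (alternating-+ (f k) (λ i τ → ∑< k (λ x → f x i τ)) σ))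

  -- Neighbouring cubes cancel along each axis, leaving the faces of the box.
  box-telescope : ∀ {N} (σ : Subset N) (Y : Vec ℕ N → Subset N → ℚ) →
    box σ (λ T → alternating (λ i τ → Y T τ - Y (lower T i) τ) σ)
    ≡ alternating (λ i τ → box τ (λ T → Y (T [ i ]≔ M) τ - Y T τ)) σ
  box-telescope []            Y = refl
  box-telescope (outside ∷ σ) Y = box-telescope σ λ T τ → Y (0 ∷ T) (outside ∷ τ)
  box-telescope {suc N} (inside ∷ σ) Y = begin
    ∑< M (λ x → box σ (λ T → (g (suc x) T - g x T) - alternating (λ i τ → Y₁ x T τ - Y₁ x (lower T i) τ) σ))
      ≡⟨ ∑<-cong M (λ x → trans
           (box-∸ σ (λ T → g (suc x) T - g x T) (λ T → alternating (λ i τ → Y₁ x T τ - Y₁ x (lower T i) τ) σ))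
           (cong₂ _-_ (box-∸ σ (g (suc x)) (g x)) (box-telescope σ (Y₁ x)))) ⟩
    ∑< M (λ x → (G (suc x) - G x) - alternating (A x) σ)
      ≡⟨ ∑<-cong M (λ x → solve 2 (λ a b → a :- b := a :+ con (- 1ℚ) :* b) refl (G (suc x) - G x) (alternating (A x) σ)) ⟩
    ∑< M (λ x → (G (suc x) - G x) + (- 1ℚ) * alternating (A x) σ)
      ≡⟨ ∑<-lin M (- 1ℚ) (λ x → G (suc x) - G x) (λ x → alternating (A x) σ) ⟩
    ∑< M (λ x → G (suc x) - G x) + (- 1ℚ) * ∑< M (λ x → alternating (A x) σ)
      ≡⟨ cong₂ (λ a b → a + (- 1ℚ) * b) (trans (∑<-telescope M G) (sym (box-∸ σ (g M) (g 0)))) (∑<-alternating M A σ) ⟩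
    box σ (λ T → g M T - g 0 T) + (- 1ℚ) * alternating (λ i τ → ∑< M (λ x → A x i τ)) σ
      ≡⟨ solve 2 (λ a b → a :+ con (- 1ℚ) :* b := a :- b) refl
           (box σ (λ T → g M T - g 0 T)) (alternating (λ i τ → ∑< M (λ x → A x i τ)) σ) ⟩
    box σ (λ T → g M T - g 0 T) - alternating (λ i τ → ∑< M (λ x → A x i τ)) σ ∎
    where
    open ≡-Reasoning
    g : ℕ → Vec ℕ N → ℚ
    g x T = Y (x ∷ T) (outside ∷ σ)
    G : ℕ → ℚ
    G x = box σ (g x)
    Y₁ : ℕ → Vec ℕ N → Subset N → ℚ
    Y₁ x T τ = Y (suc x ∷ T) (inside ∷ τ)
    A : ℕ → Fin N → Subset N → ℚ
    A x i τ = box τ (λ T → Y₁ x (T [ i ]≔ M) τ - Y₁ x T τ)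

point-≢∅ : ∀ {N} {σ : Subset N} → σ ≢ ∅ → point σ ≡ 0ℚ
point-≢∅ {σ = []}          σ≢ = ⊥-elim (σ≢ refl)
point-≢∅ {σ = outside ∷ σ} σ≢ = point-≢∅ {σ = σ} λ eq → σ≢ (cong (outside ∷_) eq)
point-≢∅ {σ = inside ∷ σ}  σ≢ = refl

module Cubical {N} (ℓ : Vec ℕ N → Fin N) where

  base : Subset N → Subset N → ℚ
  base σ ρ = point σ * point ρ

  private
    -- The cube is the cone from its lowest corner over its upper faces, those through `T`; `base`
    -- supplies the empty simplex to be coned when `σ` is empty. Fuel is used because the facets of
    -- `σ` are not structurally smaller.
    fueled : ℕ → Vec ℕ N → Subset N → Subset N → ℚ
    fueled zero    T σ = cone (ℓ (corner T σ)) (base σ)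
    fueled (suc k) T σ = cone (ℓ (corner T σ)) (λ ρ → base σ ρ + ∂ᵗ (λ τ → fueled k T τ ρ) σ)

  -- The image under ℓ of the cube with top corner T and directions σ, in Freudenthal's triangulation.
  chain : Vec ℕ N → Subset N → Subset N → ℚ
  chain T σ = fueled ∣ σ ∣ T σ

  top : Vec ℕ N → Subset N → Subset N → ℚ
  top T σ ρ = base σ ρ + ∂ᵗ (λ τ → chain T τ ρ) σ

  bottom : Vec ℕ N → Subset N → Subset N → ℚ
  bottom T σ ρ = alternating (λ i τ → chain (lower T i) τ ρ) σ

  chain-unfold : ∀ T σ ρ → chain T σ ρ ≡ cone (ℓ (corner T σ)) (top T σ) ρ
  chain-unfold T σ ρ = by-size ∣ σ ∣ refl
    where
    by-size : ∀ k → ∣ σ ∣ ≡ k → fueled k T σ ρ ≡ cone (ℓ (corner T σ)) (top T σ) ρ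
    by-size zero ∣σ∣≡0 = cone-local (ℓ (corner T σ)) ρ λ _ → sym (trans
      (cong (base σ υ +_) (∂ᵗ-vanish σ λ i∈ → case trans (∣p∖x∣ i∈) ∣σ∣≡0 of λ ()))
      (ℚ.+-identityʳ (base σ υ)))
      where υ = ρ ∖ ℓ (corner T σ)
    by-size (suc k) ∣σ∣≡ = cone-local (ℓ (corner T σ)) ρ λ _ → cong (base σ υ +_)
      (∂ᵗ-cong σ λ {i} i∈ → cong (λ m → fueled m T (σ ∖ i) υ) (ℕ.suc-injective (trans (sym ∣σ∣≡) (sym (∣p∖x∣ i∈)))))
      where υ = ρ ∖ ℓ (corner T σ)

  ∂-base : ∀ σ τ → (𝟙 ⌟ base σ) τ ≡ 0ℚ
  ∂-base σ τ = trans (⌟-scale 𝟙 (point σ) point τ) (trans (cong (point σ *_) (∂-point τ)) (ℚ.*-zeroʳ (point σ)))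

  -- All lower faces share their lowest corner with the whole cube, hence are cones with the same
  -- apex, and coning is linear.
  bottom≡cone : ∀ T σ τ → bottom T σ τ ≡ cone (ℓ (corner T σ)) (λ ρ → alternating (λ i υ → top (lower T i) υ ρ) σ) τ
  bottom≡cone T σ τ = trans
    (alternating-cong σ λ {i} i∈ → trans (chain-unfold (lower T i) (σ ∖ i) τ)
      (cong (λ x → cone (ℓ x) (top (lower T i) (σ ∖ i)) τ) (corner-lower T i∈)))
    (sym (cone-alternating (ℓ (corner T σ)) (λ i υ → top (lower T i) υ) σ τ))

  -- By `∂-cone` it suffices that the cone over the boundary of `top` is `bottom`. In that boundary
  -- the faces through `T` cancel, and by induction the lower faces of the upper faces remain; these
  -- are the upper faces of the lower faces.
  ∂-chain : ∀ T σ τ → (𝟙 ⌟ chain T σ) τ ≡ top T σ τ - bottom T σ τ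
  ∂-chain T σ = by-size ∣ σ ∣ σ refl
    where
    by-size : ∀ k σ → ∣ σ ∣ ≡ k → ∀ τ → (𝟙 ⌟ chain T σ) τ ≡ top T σ τ - bottom T σ τ
    by-size k σ ∣σ∣≡ τ = begin
      (𝟙 ⌟ chain T σ) τ
        ≡⟨ ⌟-congʳ 𝟙 (chain-unfold T σ) τ ⟩
      (𝟙 ⌟ cone v (top T σ)) τ
        ≡⟨ ∂-cone v (top T σ) τ ⟩
      top T σ τ - cone v (𝟙 ⌟ top T σ) τ
        ≡⟨ cong (λ z → top T σ τ - z) (cone-local v τ λ _ → ∂-top (τ ∖ v)) ⟩
      top T σ τ - cone v (λ ρ → alternating (λ i υ → top (lower T i) υ ρ) σ) τ
        ≡⟨ cong (λ z → top T σ τ - z) (sym (bottom≡cone T σ τ)) ⟩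
      top T σ τ - bottom T σ τ ∎
      where
      open ≡-Reasoning
      v = ℓ (corner T σ)
      facet : ∀ k → ∣ σ ∣ ≡ k → ∀ {i} → i ∈ σ → ∀ ρ → (𝟙 ⌟ chain T (σ ∖ i)) ρ ≡ top T (σ ∖ i) ρ - bottom T (σ ∖ i) ρ
      facet zero    ∣σ∣≡ {i} i∈ = case trans (∣p∖x∣ i∈) ∣σ∣≡ of λ ()
      facet (suc k) ∣σ∣≡ {i} i∈ = by-size k (σ ∖ i) (ℕ.suc-injective (trans (∣p∖x∣ i∈) ∣σ∣≡))
      ∂-top : ∀ ρ → (𝟙 ⌟ top T σ) ρ ≡ alternating (λ i υ → top (lower T i) υ ρ) σ
      ∂-top ρ = begin
        (𝟙 ⌟ top T σ) ρ
          ≡⟨ trans (⌟-+ 𝟙 (base σ) (λ π → ∂ᵗ (λ υ → chain T υ π) σ) ρ)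
               (cong₂ _+_ (∂-base σ ρ) (⌟-∂ᵗ 𝟙 (chain T) σ ρ)) ⟩
        0ℚ + ∂ᵗ (λ υ → (𝟙 ⌟ chain T υ) ρ) σ
          ≡⟨ cong (0ℚ +_) (trans (∂ᵗ-cong σ λ i∈ → facet k ∣σ∣≡ i∈ ρ)
               (alternating-∸ (λ _ υ → top T υ ρ) (λ _ υ → bottom T υ ρ) σ)) ⟩
        0ℚ + (∂ᵗ (λ υ → base υ ρ + ∂ᵗ (λ π → chain T π ρ) υ) σ - ∂ᵗ (λ υ → bottom T υ ρ) σ)
          ≡⟨ cong₂ (λ x y → 0ℚ + (x - y))
               (trans (∂ᵗ-+ (λ υ → base υ ρ) (∂ᵗ (λ π → chain T π ρ)) σ) (cong (∂ᵗ (λ υ → base υ ρ) σ +_) (∂ᵗ-square (λ π → chain T π ρ) σ)))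
               (∂ᵗ-alternating (λ i υ → chain (lower T i) υ ρ) σ) ⟩
        0ℚ + ((a + 0ℚ) - (- b))
          ≡⟨ solve 2 (λ a b → con 0ℚ :+ ((a :+ con 0ℚ) :- (:- b)) := a :+ b) refl a b ⟩
        a + b
          ≡⟨ sym (alternating-+ (λ _ υ → base υ ρ) (λ i υ → ∂ᵗ (λ π → chain (lower T i) π ρ) υ) σ) ⟩
        alternating (λ i υ → top (lower T i) υ ρ) σ ∎
        where
        a = ∂ᵗ (λ υ → base υ ρ) σ
        b = alternating (λ i → ∂ᵗ (λ π → chain (lower T i) π ρ)) σ

  Label : Vec ℕ N → Subset N → Fin N → Set
  Label T σ v = ∃ λ ε → ε ⊆ σ × ℓ (corner T ε) ≡ v

  Labelled : Vec ℕ N → Subset N → Subset N → Set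
  Labelled T σ ρ = ∀ v → v ∈ ρ → Label T σ v

  chain-vanish : ∀ T σ ρ → ¬ (∣ ρ ∣ ≡ suc ∣ σ ∣ × Labelled T σ ρ) → chain T σ ρ ≡ 0ℚ
  chain-vanish T σ = by-size ∣ σ ∣ σ refl
    where
    by-size : ∀ k σ → ∣ σ ∣ ≡ k → ∀ ρ → ¬ (∣ ρ ∣ ≡ suc ∣ σ ∣ × Labelled T σ ρ) → chain T σ ρ ≡ 0ℚ
    by-size k σ ∣σ∣≡ ρ ¬lab = trans (chain-unfold T σ ρ) (cone-vanish v ρ λ v∈ →
        cong₂ _+_ (base≡0 v∈ (σ ≟ₛ ∅) ((ρ ∖ v) ≟ₛ ∅)) (∂ᵗ-vanish σ λ {i} i∈ → facet k ∣σ∣≡ v∈ i∈))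
      where
      v = ℓ (corner T σ)
      extend : v ∈ ρ → ∣ ρ ∖ v ∣ ≡ ∣ σ ∣ → (∀ x → x ∈ ρ ∖ v → Label T σ x) → ∣ ρ ∣ ≡ suc ∣ σ ∣ × Labelled T σ ρ
      extend v∈ size lab = trans (sym (∣p∖x∣ v∈)) (cong suc size) , labelled
        where
        labelled : Labelled T σ ρ
        labelled x x∈ with x Fin.≟ v
        ... | yes x≡v = σ , (λ y∈ → y∈) , sym x≡v
        ... | no  x≢v = lab x (x∈p∧x≢y⇒x∈p-y x∈ x≢v)
      base≡0 : v ∈ ρ → Dec (σ ≡ ∅) → Dec (ρ ∖ v ≡ ∅) → base σ (ρ ∖ v) ≡ 0ℚ
      base≡0 v∈ (no σ≢) _ = trans (cong (_* point (ρ ∖ v)) (point-≢∅ σ≢)) (ℚ.*-zeroˡ (point (ρ ∖ v)))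
      base≡0 v∈ (yes σ≡) (no ρ≢) = trans (cong (point σ *_) (point-≢∅ ρ≢)) (ℚ.*-zeroʳ (point σ))
      base≡0 v∈ (yes σ≡) (yes ρ≡) = ⊥-elim (¬lab (extend v∈ (cong ∣_∣ (trans ρ≡ (sym σ≡)))
        λ x x∈ → ⊥-elim (∉⊥ (subst (x ∈_) ρ≡ x∈))))
      facet : ∀ k → ∣ σ ∣ ≡ k → v ∈ ρ → ∀ {i} → i ∈ σ → chain T (σ ∖ i) (ρ ∖ v) ≡ 0ℚ
      facet zero    ∣σ∣≡ v∈ i∈ = case trans (∣p∖x∣ i∈) ∣σ∣≡ of λ ()
      facet (suc k) ∣σ∣≡ v∈ {i} i∈ = by-size k (σ ∖ i) (ℕ.suc-injective (trans (∣p∖x∣ i∈) ∣σ∣≡)) (ρ ∖ v)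
        λ (size , lab) → ¬lab (extend v∈ (trans size (∣p∖x∣ i∈)) λ x x∈ →
          let ε , ε⊆ , eq = lab x x∈ in ε , ⊆-trans ε⊆ (p─q⊆p σ ⁅ i ⁆) , eq)

⊆∧∣∣≡⇒≡ : ∀ {n} {p q : Subset n} → p ⊆ q → ∣ p ∣ ≡ ∣ q ∣ → p ≡ q
⊆∧∣∣≡⇒≡ {p = p} p⊆q ∣p∣≡∣q∣ = ⊆-antisym p⊆q λ {x} x∈q → case x ∈? p of λ where
  (yes x∈p) → x∈p
  (no  x∉p) → ⊥-elim (ℕ.<-irrefl ∣p∣≡∣q∣ (p⊂q⇒∣p∣<∣q∣ (p⊆q , x , x∈q , x∉p)))

box-∅ : ∀ M {N} k → box M (∅ {N}) (λ _ → k) ≡ k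
box-∅ M {zero}  k = refl
box-∅ M {suc N} k = box-∅ M {N} k

-- The chain contraction given by a filling

∑ₛ : ∀ {N} → (Subset N → ℚ) → ℚ
∑ₛ {zero}  f = f []
∑ₛ {suc N} f = ∑ₛ (f ∘ (outside ∷_)) + ∑ₛ (f ∘ (inside ∷_))

∑ₛ-cong : ∀ {N} {f g : Subset N → ℚ} → (∀ σ → f σ ≡ g σ) → ∑ₛ f ≡ ∑ₛ g
∑ₛ-cong {zero}  eq = eq []
∑ₛ-cong {suc N} eq = cong₂ _+_ (∑ₛ-cong (eq ∘ (outside ∷_))) (∑ₛ-cong (eq ∘ (inside ∷_)))

∑ₛ-+ : ∀ {N} (f g : Subset N → ℚ) → ∑ₛ (λ σ → f σ + g σ) ≡ ∑ₛ f + ∑ₛ g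
∑ₛ-+ {zero}  f g = refl
∑ₛ-+ {suc N} f g = trans (cong₂ _+_ (∑ₛ-+ f₀ g₀) (∑ₛ-+ f₁ g₁))
  (solve 4 (λ a b c d → (a :+ b) :+ (c :+ d) := (a :+ c) :+ (b :+ d)) refl (∑ₛ f₀) (∑ₛ g₀) (∑ₛ f₁) (∑ₛ g₁))
  where
  f₀ = f ∘ (outside ∷_)
  f₁ = f ∘ (inside ∷_)
  g₀ = g ∘ (outside ∷_)
  g₁ = g ∘ (inside ∷_)

∑ₛ-neg : ∀ {N} (f : Subset N → ℚ) → ∑ₛ (λ σ → - f σ) ≡ - ∑ₛ f
∑ₛ-neg {zero}  f = refl
∑ₛ-neg {suc N} f = trans (cong₂ _+_ (∑ₛ-neg (f ∘ (outside ∷_))) (∑ₛ-neg (f ∘ (inside ∷_))))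
  (sym (ℚ.neg-distrib-+ (∑ₛ (f ∘ (outside ∷_))) (∑ₛ (f ∘ (inside ∷_)))))

∑ₛ-zero : ∀ {N} {f : Subset N → ℚ} → (∀ σ → f σ ≡ 0ℚ) → ∑ₛ f ≡ 0ℚ
∑ₛ-zero {zero}  eq = eq []
∑ₛ-zero {suc N} eq = cong₂ _+_ (∑ₛ-zero (eq ∘ (outside ∷_))) (∑ₛ-zero (eq ∘ (inside ∷_)))

∑ₛ-only : ∀ {N} (f : Subset N → ℚ) τ → (∀ σ → σ ≢ τ → f σ ≡ 0ℚ) → ∑ₛ f ≡ f τ
∑ₛ-only f []            eq = refl
∑ₛ-only f (outside ∷ τ) eq = trans (cong₂ _+_
  (∑ₛ-only (f ∘ (outside ∷_)) τ λ σ σ≢ → eq (outside ∷ σ) λ { refl → σ≢ refl })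
  (∑ₛ-zero λ σ → eq (inside ∷ σ) λ ())) (ℚ.+-identityʳ (f (outside ∷ τ)))
∑ₛ-only f (inside ∷ τ) eq = trans (cong₂ _+_
  (∑ₛ-zero λ σ → eq (outside ∷ σ) λ ())
  (∑ₛ-only (f ∘ (inside ∷_)) τ λ σ σ≢ → eq (inside ∷ σ) λ { refl → σ≢ refl })) (ℚ.+-identityˡ (f (inside ∷ τ)))

⌟-∑ₛ : ∀ {N n} (w : Fin N → ℚ) (c : Subset n → Subset N → ℚ) τ →
  (w ⌟ (λ ρ → ∑ₛ (λ σ → c σ ρ))) τ ≡ ∑ₛ (λ σ → (w ⌟ c σ) τ)
⌟-∑ₛ {n = zero}  w c τ = refl
⌟-∑ₛ {n = suc n} w c τ = trans
  (⌟-+ w (λ ρ → ∑ₛ (λ σ → c (outside ∷ σ) ρ)) (λ ρ → ∑ₛ (λ σ → c (inside ∷ σ) ρ)) τ)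
  (cong₂ _+_ (⌟-∑ₛ w (c ∘ (outside ∷_)) τ) (⌟-∑ₛ w (c ∘ (inside ∷_)) τ))

∂-adjoint : ∀ {N} (z f : Subset N → ℚ) → ∑ₛ (λ σ → z σ * ∂ᵗ f σ) ≡ ∑ₛ (λ σ → (𝟙 ⌟ z) σ * f σ)
∂-adjoint {zero}  z f = solve 2 (λ z f → z :* con 0ℚ := con 0ℚ :* f) refl (z []) (f [])
∂-adjoint {suc N} z f = begin
  ∑ₛ (λ σ → z₀ σ * ∂ᵗ f₀ σ) + ∑ₛ (λ σ → z₁ σ * (f₀ σ - ∂ᵗ f₁ σ))
    ≡⟨ cong₂ _+_ (∂-adjoint z₀ f₀) (trans
         (∑ₛ-cong λ σ → solve 3 (λ z f g → z :* (f :- g) := z :* f :+ (:- (z :* g))) refl (z₁ σ) (f₀ σ) (∂ᵗ f₁ σ))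
         (trans (∑ₛ-+ (λ σ → z₁ σ * f₀ σ) (λ σ → - (z₁ σ * ∂ᵗ f₁ σ)))
           (cong (∑ₛ (λ σ → z₁ σ * f₀ σ) +_) (trans (∑ₛ-neg (λ σ → z₁ σ * ∂ᵗ f₁ σ)) (cong -_ (∂-adjoint z₁ f₁)))))) ⟩
  a + (b + (- c))
    ≡⟨ solve 3 (λ a b c → a :+ (b :+ (:- c)) := (b :+ a) :+ (:- c)) refl a b c ⟩
  (b + a) + (- c)
    ≡⟨ cong₂ _+_ (trans (sym (∑ₛ-+ (λ σ → z₁ σ * f₀ σ) (λ σ → (𝟙 ⌟ z₀) σ * f₀ σ)))
           (∑ₛ-cong λ σ → solve 3 (λ z w f → z :* f :+ w :* f := (con 1ℚ :* z :+ w) :* f) refl (z₁ σ) ((𝟙 ⌟ z₀) σ) (f₀ σ)))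
         (trans (sym (∑ₛ-neg (λ σ → (𝟙 ⌟ z₁) σ * f₁ σ))) (∑ₛ-cong λ σ → ℚ.neg-distribˡ-* ((𝟙 ⌟ z₁) σ) (f₁ σ))) ⟩
  ∑ₛ (λ σ → (1ℚ * z₁ σ + (𝟙 ⌟ z₀) σ) * f₀ σ) + ∑ₛ (λ σ → (- (𝟙 ⌟ z₁) σ) * f₁ σ) ∎
  where
  open ≡-Reasoning
  z₀ = z ∘ (outside ∷_)
  z₁ = z ∘ (inside ∷_)
  f₀ = f ∘ (outside ∷_)
  f₁ = f ∘ (inside ∷_)
  a = ∑ₛ (λ σ → (𝟙 ⌟ z₀) σ * f₀ σ)
  b = ∑ₛ (λ σ → z₁ σ * f₀ σ)
  c = ∑ₛ (λ σ → (𝟙 ⌟ z₁) σ * f₁ σ)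

-- The coefficient of `outside ∷ σ` in the boundary of `b (inside ∷ σ)` is the diagonal entry at
-- `inside ∷ σ`, and the chain map equation makes it the diagonal entry at `outside ∷ σ`. So every
-- diagonal entry equals the one at `∅`.
diagonal-identity : ∀ {N} (b : Subset N → Subset N → ℚ) → (∀ σ ρ → σ ≢ ρ → b σ ρ ≡ 0ℚ) →
  (∀ σ τ → (𝟙 ⌟ b σ) τ ≡ ∂ᵗ (λ υ → b υ τ) σ) → b ∅ ∅ ≡ 1ℚ → ∀ σ → b σ σ ≡ 1ℚ
diagonal-identity b diag ∂b b∅ [] = b∅
diagonal-identity {suc N} b diag ∂b b∅ (s ∷ σ) = by-side s
  where
  open ≡-Reasoning
  b₀ : Subset N → Subset N → ℚ
  b₀ τ ρ = b (outside ∷ τ) (outside ∷ ρ)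
  ∂b₀ : ∀ τ ρ → (𝟙 ⌟ b₀ τ) ρ ≡ ∂ᵗ (λ υ → b₀ υ ρ) τ
  ∂b₀ τ ρ = begin
    (𝟙 ⌟ b₀ τ) ρ
      ≡⟨ solve 1 (λ x → x := con 1ℚ :* con 0ℚ :+ x) refl ((𝟙 ⌟ b₀ τ) ρ) ⟩
    1ℚ * 0ℚ + (𝟙 ⌟ b₀ τ) ρ
      ≡⟨ cong (λ z → 1ℚ * z + (𝟙 ⌟ b₀ τ) ρ) (sym (diag (outside ∷ τ) (inside ∷ ρ) λ ())) ⟩
    (𝟙 ⌟ b (outside ∷ τ)) (outside ∷ ρ)
      ≡⟨ ∂b (outside ∷ τ) (outside ∷ ρ) ⟩
    ∂ᵗ (λ υ → b₀ υ ρ) τ ∎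
  without-zero : b₀ σ σ ≡ 1ℚ
  without-zero = diagonal-identity b₀
    (λ τ ρ τ≢ρ → diag (outside ∷ τ) (outside ∷ ρ) λ { refl → τ≢ρ refl }) ∂b₀ b∅ σ
  by-side : ∀ s → b (s ∷ σ) (s ∷ σ) ≡ 1ℚ
  by-side outside = without-zero
  by-side inside = begin
    β
      ≡⟨ solve 1 (λ x → x := con 1ℚ :* x :+ con 0ℚ) refl β ⟩
    1ℚ * β + 0ℚ
      ≡⟨ cong (1ℚ * β +_) (sym (⌟-zero 𝟙 (λ ρ → diag (inside ∷ σ) (outside ∷ ρ) λ ()) σ)) ⟩
    (𝟙 ⌟ b (inside ∷ σ)) (outside ∷ σ)
      ≡⟨ ∂b (inside ∷ σ) (outside ∷ σ) ⟩
    b₀ σ σ - ∂ᵗ (λ υ → b (inside ∷ υ) (outside ∷ σ)) σ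
      ≡⟨ cong₂ _-_ without-zero (∂ᵗ-vanish σ λ {i} _ →
           diag (inside ∷ (σ ∖ i)) (outside ∷ σ) λ ()) ⟩
    1ℚ ∎
    where β = b (inside ∷ σ) (inside ∷ σ)

module Filled {N} (C : Complex N) (K : ℕ) (ℓ : Vec ℕ N → Fin N) (M : ℕ)
  (faces : ∀ σ → Face C σ → ∣ σ ∣ ℕ.< K → ∀ T → Carried T σ → ∀ ρ → Cubical.Labelled ℓ T σ ρ → Face C ρ)
  (sperner : ∀ x i → M ℕ.≤ lookup x i → 0 ℕ.< lookup x (ℓ x)) where

  open Cubical ℓ

  t : Subset N → Subset N → ℚ
  t σ ρ = box M σ (λ T → chain T σ ρ)

  outer : Fin N → Subset N → Subset N → ℚ
  outer i υ ρ = box M υ (λ T → chain (T [ i ]≔ M) υ ρ)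

  -- The image of the outer boundary of the cube. The remaining faces of the cube are the cubes of
  -- the facets of `σ`, so `t` is a homotopy between `b` and zero, and a contraction once `b` is the
  -- identity.
  b : Subset N → Subset N → ℚ
  b σ ρ = base σ ρ + alternating (λ i υ → outer i υ ρ) σ

  box-base : ∀ σ τ → box M σ (λ _ → base σ τ) ≡ base σ τ
  box-base σ τ with σ ≟ₛ ∅
  ... | yes refl = box-∅ M {N} (base ∅ τ)
  ... | no  σ≢   = trans (box-zero M σ λ _ _ → base≡0) (sym base≡0)
    where
    base≡0 : base σ τ ≡ 0ℚ
    base≡0 = trans (cong (_* point τ) (point-≢∅ σ≢)) (ℚ.*-zeroˡ (point τ))

  ∂t : ∀ σ τ → (𝟙 ⌟ t σ) τ ≡ b σ τ - ∂ᵗ (λ υ → t υ τ) σ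
  ∂t σ τ = begin
    (𝟙 ⌟ t σ) τ
      ≡⟨ ⌟-box M 𝟙 σ (λ T → chain T σ) τ ⟩
    box M σ (λ T → (𝟙 ⌟ chain T σ) τ)
      ≡⟨ box-cong M σ (λ T _ → trans (∂-chain T σ τ) (trans
           (solve 3 (λ x y z → (x :+ y) :- z := x :+ (y :- z)) refl (base σ τ) (∂ᵗ (λ υ → chain T υ τ) σ) (bottom T σ τ))
           (cong (base σ τ +_) (sym (alternating-∸ (λ _ υ → chain T υ τ) (λ i υ → chain (lower T i) υ τ) σ))))) ⟩
    box M σ (λ T → base σ τ + alternating (λ i υ → chain T υ τ - chain (lower T i) υ τ) σ)
      ≡⟨ box-+ M σ (λ _ → base σ τ) (λ T → alternating (λ i υ → chain T υ τ - chain (lower T i) υ τ) σ) ⟩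
    box M σ (λ _ → base σ τ) + box M σ (λ T → alternating (λ i υ → chain T υ τ - chain (lower T i) υ τ) σ)
      ≡⟨ cong₂ _+_ (box-base σ τ) (trans (box-telescope M σ (λ T υ → chain T υ τ))
           (trans (alternating-cong σ λ {i} _ → box-∸ M (σ ∖ i) (λ T → chain (T [ i ]≔ M) (σ ∖ i) τ) (λ T → chain T (σ ∖ i) τ))
             (alternating-∸ (λ i υ → outer i υ τ) (λ _ υ → t υ τ) σ))) ⟩
    base σ τ + (alternating (λ i υ → outer i υ τ) σ - ∂ᵗ (λ υ → t υ τ) σ)
      ≡⟨ solve 3 (λ x y z → x :+ (y :- z) := (x :+ y) :- z) refl
           (base σ τ) (alternating (λ i υ → outer i υ τ) σ) (∂ᵗ (λ υ → t υ τ) σ) ⟩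
    b σ τ - ∂ᵗ (λ υ → t υ τ) σ ∎
    where open ≡-Reasoning

  b≡ : ∀ σ τ → b σ τ ≡ (𝟙 ⌟ t σ) τ + ∂ᵗ (λ υ → t υ τ) σ
  b≡ σ τ = trans (solve 2 (λ x y → x := (x :- y) :+ y) refl (b σ τ) (∂ᵗ (λ υ → t υ τ) σ))
    (cong (_+ ∂ᵗ (λ υ → t υ τ) σ) (sym (∂t σ τ)))

  ∂b : ∀ σ τ → (𝟙 ⌟ b σ) τ ≡ ∂ᵗ (λ υ → b υ τ) σ
  ∂b σ τ = begin
    (𝟙 ⌟ b σ) τ
      ≡⟨ trans (⌟-congʳ 𝟙 (b≡ σ) τ) (⌟-+ 𝟙 (𝟙 ⌟ t σ) (λ ρ → ∂ᵗ (λ υ → t υ ρ) σ) τ) ⟩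
    (𝟙 ⌟ 𝟙 ⌟ t σ) τ + (𝟙 ⌟ (λ ρ → ∂ᵗ (λ υ → t υ ρ) σ)) τ
      ≡⟨ cong₂ _+_ (⌟-square 𝟙 (t σ) τ) (trans (⌟-∂ᵗ 𝟙 t σ τ) (trans (∂ᵗ-cong σ λ {i} _ → ∂t (σ ∖ i) τ)
           (trans (alternating-∸ (λ _ υ → b υ τ) (λ _ → ∂ᵗ (λ υ → t υ τ)) σ)
             (cong (λ z → ∂ᵗ (λ υ → b υ τ) σ - z) (∂ᵗ-square (λ υ → t υ τ) σ))))) ⟩
    0ℚ + (a - 0ℚ)
      ≡⟨ solve 1 (λ x → con 0ℚ :+ (x :- con 0ℚ) := x) refl a ⟩
    a ∎
    where
    open ≡-Reasoning
    a = ∂ᵗ (λ υ → b υ τ) σ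

  -- The outer faces of the box are labelled by the vertices of σ.
  b-diagonal : ∀ σ ρ → σ ≢ ρ → b σ ρ ≡ 0ℚ
  b-diagonal σ ρ σ≢ρ = cong₂ _+_ (base≡0 (σ ≟ₛ ∅)) (alternating-vanish σ λ {i} i∈ →
      box-zero M (σ ∖ i) λ T T⊑ → chain-vanish (T [ i ]≔ M) (σ ∖ i) ρ λ (size , lab) →
        σ≢ρ (sym (⊆∧∣∣≡⇒≡ (λ {v} v∈ → inside-σ i∈ T⊑ v (lab v v∈)) (trans size (∣p∖x∣ i∈)))))
    where
    base≡0 : Dec (σ ≡ ∅) → base σ ρ ≡ 0ℚ
    base≡0 (no σ≢)  = trans (cong (_* point ρ) (point-≢∅ σ≢)) (ℚ.*-zeroˡ (point ρ))
    base≡0 (yes σ≡) = trans (cong (point σ *_) (point-≢∅ λ ρ≡ → σ≢ρ (trans σ≡ (sym ρ≡)))) (ℚ.*-zeroʳ (point σ))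
    inside-σ : ∀ {i T} → i ∈ σ → Carried T (σ ∖ i) → ∀ v → Label (T [ i ]≔ M) (σ ∖ i) v → v ∈ σ
    inside-σ {i} {T} i∈ T⊑ v (ε , ε⊆ , refl) with v ∈? σ
    ... | yes v∈ = v∈
    ... | no  v∉ = ⊥-elim (ℕ.<-irrefl refl (begin-strict
        0                                          <⟨ sperner x i (ℕ.≤-reflexive (sym xᵢ≡M)) ⟩
        lookup x (ℓ x)                             ≤⟨ corner-≤ (T [ i ]≔ M) ε (ℓ x) ⟩
        lookup (T [ i ]≔ M) (ℓ x)                  ≡⟨ lookup∘update′ (λ v≡i → v∉ (subst (_∈ σ) (sym v≡i) i∈)) T M ⟩
        lookup T (ℓ x)                             ≡⟨ T⊑ (ℓ x) (λ v∈ → v∉ (p─q⊆p σ ⁅ i ⁆ v∈)) ⟩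
        0                                          ∎))
      where
      open ℕ.≤-Reasoning
      x = corner (T [ i ]≔ M) ε
      xᵢ≡M : lookup x i ≡ M
      xᵢ≡M = trans (corner-∉ (T [ i ]≔ M) ε i (λ i∈ε → x∉p∖x σ i (ε⊆ i∈ε))) (lookup∘update i T M)

  b-identity : ∀ σ → b σ σ ≡ 1ℚ
  b-identity σ = diagonal-identity b b-diagonal ∂b b∅ σ
    where
    b∅ : b ∅ ∅ ≡ 1ℚ
    b∅ = cong₂ _+_ (cong₂ _*_ (point-∅ {N}) (point-∅ {N})) (alternating-vanish {N} {λ i υ → outer i υ ∅} ∅ λ i∈ → ⊥-elim (∉⊥ i∈))

  t-supported : ∀ σ → Face C σ → ∣ σ ∣ ℕ.< K → Supported C (suc ∣ σ ∣) (t σ)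
  t-supported σ σ∈ σ<K ρ ρ∉ = box-zero M σ λ T T⊑ → chain-vanish T σ ρ λ (size , lab) →
    ρ∉ (faces σ σ∈ σ<K T T⊑ ρ lab , size)

  acyclic : ∀ d → d ℕ.< K → H̃[ d -1]≡0 C
  acyclic d d<K (z , z-supp) ∂z = (c , c-supp) , λ τ → trans (∂≡𝟙⌟ c τ) (∂c τ)
    where
    open ≡-Reasoning
    c : Subset N → ℚ
    c ρ = ∑ₛ λ σ → z σ * t σ ρ
    c-supp : Supported C (suc d) c
    c-supp ρ ρ∉ = ∑ₛ-zero λ σ → [ (λ (σ∈ , ∣σ∣≡) → trans
        (cong (z σ *_) (t-supported σ σ∈ (subst (ℕ._< K) (sym ∣σ∣≡) d<K) ρ λ (ρ∈ , ∣ρ∣) → ρ∉ (ρ∈ , trans ∣ρ∣ (cong suc ∣σ∣≡))))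
        (ℚ.*-zeroʳ (z σ)))
      , (λ z≡0 → trans (cong (_* t σ ρ) z≡0) (ℚ.*-zeroˡ (t σ ρ))) ]′ (Supported? {X = C} z-supp σ)
    ∂c : ∀ τ → (𝟙 ⌟ c) τ ≡ z τ
    ∂c τ = begin
      (𝟙 ⌟ c) τ
        ≡⟨ trans (⌟-∑ₛ 𝟙 (λ σ ρ → z σ * t σ ρ) τ) (∑ₛ-cong λ σ → trans (⌟-scale 𝟙 (z σ) (t σ) τ) (cong (z σ *_) (∂t σ τ))) ⟩
      ∑ₛ (λ σ → z σ * (b σ τ - ∂ᵗ (λ υ → t υ τ) σ))
        ≡⟨ trans (∑ₛ-cong λ σ → solve 3 (λ z b d → z :* (b :- d) := z :* b :+ (:- (z :* d))) refl (z σ) (b σ τ) (∂ᵗ (λ υ → t υ τ) σ))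
             (∑ₛ-+ (λ σ → z σ * b σ τ) (λ σ → - (z σ * ∂ᵗ (λ υ → t υ τ) σ))) ⟩
      ∑ₛ (λ σ → z σ * b σ τ) + ∑ₛ (λ σ → - (z σ * ∂ᵗ (λ υ → t υ τ) σ))
        ≡⟨ cong₂ _+_
             (trans (∑ₛ-only (λ σ → z σ * b σ τ) τ λ σ σ≢τ → trans (cong (z σ *_) (b-diagonal σ τ σ≢τ)) (ℚ.*-zeroʳ (z σ)))
               (trans (cong (z τ *_) (b-identity τ)) (ℚ.*-identityʳ (z τ))))
             -- Transposition moves the boundary from `t` to the cycle `z`, where it vanishes.
             (trans (∑ₛ-neg (λ σ → z σ * ∂ᵗ (λ υ → t υ τ) σ)) (cong -_ (trans (∂-adjoint z (λ υ → t υ τ))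
               (∑ₛ-zero λ σ → trans (cong (_* t σ τ) (trans (sym (∂≡𝟙⌟ z σ)) (∂z σ))) (ℚ.*-zeroˡ (t σ τ)))))) ⟩
      z τ - 0ℚ
        ≡⟨ solve 1 (λ x → x :- con 0ℚ := x) refl (z τ) ⟩
      z τ ∎

-- Interpolation over the rationals

-- Most inequalities below are proved by exhibiting the difference as a sum of products of
-- nonnegative quantities, the identity being left to the ring solver.
≤-cert : ∀ {p q} d → 0ℚ ≤ d → p + d ≡ q → p ≤ q
≤-cert {p} {q} d 0≤d eq = subst (_≤ q) (ℚ.+-identityʳ p) (subst (p + 0ℚ ≤_) eq (ℚ.+-monoʳ-≤ p 0≤d))

<-cert : ∀ {p q} d → 0ℚ < d → p + d ≡ q → p < q
<-cert {p} {q} d 0<d eq = subst (_< q) (ℚ.+-identityʳ p) (subst (p + 0ℚ <_) eq (ℚ.+-monoʳ-< p 0<d))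

0≤- : ∀ {p q} → p ≤ q → 0ℚ ≤ q - p
0≤- {p} {q} p≤q = subst (_≤ q - p) (ℚ.+-inverseʳ p) (ℚ.+-monoˡ-≤ (- p) p≤q)

0<- : ∀ {p q} → p < q → 0ℚ < q - p
0<- {p} {q} p<q = subst (_< q - p) (ℚ.+-inverseʳ p) (ℚ.+-monoˡ-< (- p) p<q)

0≤+ : ∀ {p q} → 0ℚ ≤ p → 0ℚ ≤ q → 0ℚ ≤ p + q
0≤+ 0≤p 0≤q = ℚ.+-mono-≤ 0≤p 0≤q

0<+≤ : ∀ {p q} → 0ℚ < p → 0ℚ ≤ q → 0ℚ < p + q
0<+≤ 0<p 0≤q = ℚ.+-mono-<-≤ 0<p 0≤q

0≤* : ∀ {p q} → 0ℚ ≤ p → 0ℚ ≤ q → 0ℚ ≤ p * q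
0≤* {p} {q} 0≤p 0≤q = ℚ.nonNegative⁻¹ (p * q) {{ℚ.nonNeg*nonNeg⇒nonNeg p {{ℚ.nonNegative 0≤p}} q {{ℚ.nonNegative 0≤q}}}}

0<* : ∀ {p q} → 0ℚ < p → 0ℚ < q → 0ℚ < p * q
0<* {p} {q} 0<p 0<q = ℚ.positive⁻¹ (p * q) {{ℚ.pos*pos⇒pos p {{ℚ.positive 0<p}} q {{ℚ.positive 0<q}}}}

0≤1 : 0ℚ ≤ 1ℚ
0≤1 = ℚ.nonNegative⁻¹ 1ℚ

0<1 : 0ℚ < 1ℚ
0<1 = ℚ.positive⁻¹ 1ℚ

0<½ : 0ℚ < ½
0<½ = ℚ.positive⁻¹ ½

0≤½ : 0ℚ ≤ ½
0≤½ = ℚ.<⇒≤ 0<½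

nat : ℕ → ℚ
nat zero    = 0ℚ
nat (suc n) = nat n + 1ℚ

nat-nonneg : ∀ n → 0ℚ ≤ nat n
nat-nonneg zero    = ℚ.≤-refl
nat-nonneg (suc n) = 0≤+ (nat-nonneg n) 0≤1

nat-+ : ∀ m n → nat (m ℕ.+ n) ≡ nat m + nat n
nat-+ zero    n = sym (ℚ.+-identityˡ (nat n))
nat-+ (suc m) n = trans (cong (_+ 1ℚ) (nat-+ m n))
  (solve 2 (λ m n → (m :+ n) :+ con 1ℚ := (m :+ con 1ℚ) :+ n) refl (nat m) (nat n))

nat-* : ∀ m n → nat (m ℕ.* n) ≡ nat m * nat n
nat-* zero    n = sym (ℚ.*-zeroˡ (nat n))
nat-* (suc m) n = trans (nat-+ n (m ℕ.* n)) (trans (cong (nat n +_) (nat-* m n))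
  (solve 2 (λ m n → n :+ m :* n := (m :+ con 1ℚ) :* n) refl (nat m) (nat n)))

nat-mono : ∀ {m n} → m ℕ.≤ n → nat m ≤ nat n
nat-mono {n = n} z≤n = nat-nonneg n
nat-mono (s≤s m≤n)   = ℚ.+-monoˡ-≤ 1ℚ (nat-mono m≤n)

nat-cancel-< : ∀ {m n} → nat m < nat n → m ℕ.< n
nat-cancel-< {m} {n} m<n = ℕ.≰⇒> λ n≤m → ℚ.<-irrefl refl (ℚ.<-≤-trans m<n (nat-mono n≤m))

-- Opaque, so that the comparisons inside are never unfolded; values are reached only through
-- `clamped`.
opaque
  cl : ℚ → ℚ
  cl t with t ℚ.≤? 0ℚ | 1ℚ ℚ.≤? t
  ... | yes _ | _     = 0ℚ
  ... | no _  | yes _ = 1ℚ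
  ... | no _  | no _  = t

data Clamped (t : ℚ) : Set where
  low  : t ≤ 0ℚ → cl t ≡ 0ℚ → Clamped t
  mid  : 0ℚ ≤ t → t ≤ 1ℚ → cl t ≡ t → Clamped t
  high : 1ℚ ≤ t → cl t ≡ 1ℚ → Clamped t

opaque
  unfolding cl

  clamped : ∀ t → Clamped t
  clamped t with t ℚ.≤? 0ℚ in eq₀ | 1ℚ ℚ.≤? t in eq₁
  ... | yes t≤0 | _       = low t≤0 value
    where
    value : cl t ≡ 0ℚ
    value rewrite eq₀ = refl
  ... | no t≰0  | yes 1≤t = high 1≤t value
    where
    value : cl t ≡ 1ℚ
    value rewrite eq₀ | eq₁ = refl
  ... | no t≰0  | no 1≰t  = mid (ℚ.<⇒≤ (ℚ.≰⇒> t≰0)) (ℚ.<⇒≤ (ℚ.≰⇒> 1≰t)) value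
    where
    value : cl t ≡ t
    value rewrite eq₀ | eq₁ = refl

cl-≥0 : ∀ t → 0ℚ ≤ cl t
cl-≥0 t with clamped t
... | low  _ eq   = ℚ.≤-reflexive (sym eq)
... | mid  p _ eq = subst (0ℚ ≤_) (sym eq) p
... | high _ eq   = subst (0ℚ ≤_) (sym eq) 0≤1

cl-≤1 : ∀ t → cl t ≤ 1ℚ
cl-≤1 t with clamped t
... | low  _ eq   = subst (_≤ 1ℚ) (sym eq) 0≤1
... | mid  _ p eq = subst (_≤ 1ℚ) (sym eq) p
... | high _ eq   = ℚ.≤-reflexive eq

cl-upper : ∀ {t k} → t ≤ k → 0ℚ ≤ k → cl t ≤ k
cl-upper {t} {k} t≤k 0≤k with clamped t
... | low  _ eq   = subst (_≤ k) (sym eq) 0≤k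
... | mid  _ _ eq = subst (_≤ k) (sym eq) t≤k
... | high p eq   = subst (_≤ k) (sym eq) (ℚ.≤-trans p t≤k)

cl-lower : ∀ {t k} → k ≤ t → k ≤ 1ℚ → k ≤ cl t
cl-lower {t} {k} k≤t k≤1 with clamped t
... | low  p eq   = subst (k ≤_) (sym eq) (ℚ.≤-trans k≤t p)
... | mid  _ _ eq = subst (k ≤_) (sym eq) k≤t
... | high _ eq   = subst (k ≤_) (sym eq) k≤1

cl-lipschitz : ∀ {s t δ} → 0ℚ ≤ δ → s ≤ t + δ → cl s ≤ cl t + δ
cl-lipschitz {s} {t} {δ} 0≤δ s≤t+δ with clamped t
... | low p eq = cl-upper
  (ℚ.≤-trans s≤t+δ (ℚ.+-monoˡ-≤ δ (ℚ.≤-trans p (cl-≥0 t)))) (0≤+ (cl-≥0 t) 0≤δ)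
... | mid _ _ eq = cl-upper (subst (λ z → s ≤ z + δ) (sym eq) s≤t+δ) (0≤+ (cl-≥0 t) 0≤δ)
... | high _ eq = ℚ.≤-trans (cl-≤1 s) (≤-cert δ 0≤δ (cong (_+ δ) (sym eq)))

cl-pos : ∀ {t} → 0ℚ < cl t → 0ℚ < t
cl-pos {t} 0<cl = ℚ.≰⇒> λ t≤0 → ℚ.<-irrefl refl (ℚ.<-≤-trans 0<cl (cl-upper t≤0 ℚ.≤-refl))

cl-<1 : ∀ {t} → cl t < 1ℚ → t < 1ℚ
cl-<1 {t} cl<1 = ℚ.≰⇒> λ 1≤t → ℚ.<-irrefl refl (ℚ.≤-<-trans (cl-lower 1≤t ℚ.≤-refl) cl<1)

mix : ℚ → ℚ → ℚ → ℚ
mix t a b = (1ℚ - t) * a + t * b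

Unit : ℚ → Set
Unit p = 0ℚ ≤ p × p ≤ 1ℚ

mix-≥ˡ : ∀ {t a b k} → Unit t → 0ℚ ≤ b → k ≤ 1ℚ - t → 0ℚ ≤ a → k * a ≤ mix t a b
mix-≥ˡ {t} {a} {b} {k} (0≤t , t≤1) 0≤b k≤ 0≤a = ≤-cert (((1ℚ - t) - k) * a + t * b)
  (0≤+ (0≤* (0≤- k≤) 0≤a) (0≤* 0≤t 0≤b))
  (solve 4 (λ t a b k → k :* a :+ (((con 1ℚ :- t) :- k) :* a :+ t :* b) := (con 1ℚ :- t) :* a :+ t :* b) refl t a b k)

mix-≥ʳ : ∀ {t a b k} → Unit t → 0ℚ ≤ a → k ≤ t → 0ℚ ≤ b → k * b ≤ mix t a b
mix-≥ʳ {t} {a} {b} {k} (0≤t , t≤1) 0≤a k≤ 0≤b = ≤-cert ((1ℚ - t) * a + (t - k) * b)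
  (0≤+ (0≤* (0≤- t≤1) 0≤a) (0≤* (0≤- k≤) 0≤b))
  (solve 4 (λ t a b k → k :* b :+ ((con 1ℚ :- t) :* a :+ (t :- k) :* b) := (con 1ℚ :- t) :* a :+ t :* b) refl t a b k)

mix-unit : ∀ {t a b} → Unit t → Unit a → Unit b → Unit (mix t a b)
mix-unit {t} {a} {b} (0≤t , t≤1) (0≤a , a≤1) (0≤b , b≤1) =
  0≤+ (0≤* (0≤- t≤1) 0≤a) (0≤* 0≤t 0≤b) ,
  ≤-cert ((1ℚ - t) * (1ℚ - a) + t * (1ℚ - b)) (0≤+ (0≤* (0≤- t≤1) (0≤- a≤1)) (0≤* 0≤t (0≤- b≤1)))
    (solve 3 (λ t a b → ((con 1ℚ :- t) :* a :+ t :* b) :+ ((con 1ℚ :- t) :* (con 1ℚ :- a) :+ t :* (con 1ℚ :- b)) := con 1ℚ)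
      refl t a b)

-- A change of weight moves at most `δ` of mass between two values in [0 , 1]. The case split fixes
-- the sign of `t - t′`, so that each case has a polynomial certificate.
mix-lipschitz : ∀ {t t′ a a′ b b′ e δ} → Unit t → Unit a′ → Unit b′ → 0ℚ ≤ δ →
  a ≤ a′ + e → b ≤ b′ + e → t ≤ t′ + δ → t′ ≤ t + δ → mix t a b ≤ mix t′ a′ b′ + (e + δ)
mix-lipschitz {t} {t′} {a} {a′} {b} {b′} {e} {δ} (0≤t , t≤1) (0≤a′ , a′≤1) (0≤b′ , b′≤1) 0≤δ a≤ b≤ t≤ t′≤
  with ℚ.≤-total t t′
... | inj₁ t≤t′ = ≤-cert
  ((1ℚ - t) * ((a′ + e) - a) + t * ((b′ + e) - b) + ((t′ - t) * b′ + (t′ - t) * (1ℚ - a′) + ((t + δ) - t′)))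
  (0≤+ (0≤+ (0≤* (0≤- t≤1) (0≤- a≤)) (0≤* 0≤t (0≤- b≤)))
       (0≤+ (0≤+ (0≤* (0≤- t≤t′) 0≤b′) (0≤* (0≤- t≤t′) (0≤- a′≤1))) (0≤- t′≤)))
  (solve 8 (λ t t′ a a′ b b′ e δ →
      ((con 1ℚ :- t) :* a :+ t :* b) :+
        ((con 1ℚ :- t) :* ((a′ :+ e) :- a) :+ t :* ((b′ :+ e) :- b) :+
          ((t′ :- t) :* b′ :+ (t′ :- t) :* (con 1ℚ :- a′) :+ ((t :+ δ) :- t′)))
      := ((con 1ℚ :- t′) :* a′ :+ t′ :* b′) :+ (e :+ δ)) refl t t′ a a′ b b′ e δ)
... | inj₂ t′≤t = ≤-cert
  ((1ℚ - t) * ((a′ + e) - a) + t * ((b′ + e) - b) + ((t - t′) * a′ + (t - t′) * (1ℚ - b′) + ((t′ + δ) - t)))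
  (0≤+ (0≤+ (0≤* (0≤- t≤1) (0≤- a≤)) (0≤* 0≤t (0≤- b≤)))
       (0≤+ (0≤+ (0≤* (0≤- t′≤t) 0≤a′) (0≤* (0≤- t′≤t) (0≤- b′≤1))) (0≤- t≤)))
  (solve 8 (λ t t′ a a′ b b′ e δ →
      ((con 1ℚ :- t) :* a :+ t :* b) :+
        ((con 1ℚ :- t) :* ((a′ :+ e) :- a) :+ t :* ((b′ :+ e) :- b) :+
          ((t :- t′) :* a′ :+ (t :- t′) :* (con 1ℚ :- b′) :+ ((t′ :+ δ) :- t)))
      := ((con 1ℚ :- t′) :* a′ :+ t′ :* b′) :+ (e :+ δ)) refl t t′ a a′ b b′ e δ)

*-pos⁻ : ∀ {p q} → 0ℚ ≤ p → 0ℚ ≤ q → 0ℚ < p * q → 0ℚ < p × 0ℚ < q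
*-pos⁻ {p} {q} 0≤p 0≤q 0<pq =
  ℚ.≰⇒> (λ p≤0 → ℚ.<-irrefl (sym (trans (cong (_* q) (ℚ.≤-antisym p≤0 0≤p)) (ℚ.*-zeroˡ q))) 0<pq) ,
  ℚ.≰⇒> (λ q≤0 → ℚ.<-irrefl (sym (trans (cong (p *_) (ℚ.≤-antisym q≤0 0≤q)) (ℚ.*-zeroʳ p))) 0<pq)

+-pos⁻ : ∀ {p q} → 0ℚ < p + q → 0ℚ < p ⊎ 0ℚ < q
+-pos⁻ {p} {q} 0<p+q with 0ℚ ℚ.<? p
... | yes 0<p = inj₁ 0<p
... | no  p≤0 = inj₂ (ℚ.<-≤-trans 0<p+q (subst (p + q ≤_) (ℚ.+-identityˡ q) (ℚ.+-monoˡ-≤ q (ℚ.≮⇒≥ p≤0))))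

-- Piecewise linear interpolation of the values A 0, …, A M, constant outside [0 , M].
lin : ℕ → (ℕ → ℚ) → ℚ → ℚ
lin zero    A y = A 0
lin (suc M) A y = mix (cl (y - nat M)) (lin M A y) (A (suc M))

cl-unit : ∀ t → Unit (cl t)
cl-unit t = cl-≥0 t , cl-≤1 t

lin-unit : ∀ M {A} → (∀ q → Unit (A q)) → ∀ y → Unit (lin M A y)
lin-unit zero    A-unit y = A-unit 0
lin-unit (suc M) A-unit y = mix-unit (cl-unit (y - nat M)) (lin-unit M A-unit y) (A-unit (suc M))

lin-cong : ∀ M {A B : ℕ → ℚ} → (∀ q → A q ≡ B q) → ∀ y → lin M A y ≡ lin M B y
lin-cong zero    eq y = eq 0
lin-cong (suc M) eq y = cong₂ (mix (cl (y - nat M))) (lin-cong M eq y) (eq (suc M))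

mix-idem : ∀ t k → mix t k k ≡ k
mix-idem = solve 2 (λ t k → (con 1ℚ :- t) :* k :+ t :* k := k) refl

lin-const : ∀ M k y → lin M (λ _ → k) y ≡ k
lin-const zero    k y = refl
lin-const (suc M) k y = trans (cong (λ z → mix (cl (y - nat M)) z k) (lin-const M k y)) (mix-idem (cl (y - nat M)) k)

lin-+ : ∀ M (A B : ℕ → ℚ) y → lin M (λ q → A q + B q) y ≡ lin M A y + lin M B y
lin-+ zero    A B y = refl
lin-+ (suc M) A B y = trans (cong (λ z → mix t z (A (suc M) + B (suc M))) (lin-+ M A B y))
  (solve 5 (λ t a b c d → (con 1ℚ :- t) :* (a :+ b) :+ t :* (c :+ d)
      := ((con 1ℚ :- t) :* a :+ t :* c) :+ ((con 1ℚ :- t) :* b :+ t :* d)) refl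
    t (lin M A y) (lin M B y) (A (suc M)) (B (suc M)))
  where t = cl (y - nat M)

lin-sum : ∀ M {N} (A : Fin N → ℕ → ℚ) y → foldr _+_ 0ℚ (λ v → lin M (A v) y) ≡ lin M (λ q → foldr _+_ 0ℚ (λ v → A v q)) y
lin-sum M {zero}  A y = sym (lin-const M 0ℚ y)
lin-sum M {suc N} A y = trans (cong (lin M (A zero) y +_) (lin-sum M (A ∘ suc) y))
  (sym (lin-+ M (A zero) (λ q → foldr _+_ 0ℚ (λ v → A (suc v) q)) y))

lin-lipschitz : ∀ M {A B e y y′ δ} → (∀ q → Unit (A q)) → (∀ q → Unit (B q)) → 0ℚ ≤ δ →
  (∀ q → A q ≤ B q + e) → y ≤ y′ + δ → y′ ≤ y + δ → lin M A y ≤ lin M B y′ + (e + nat M * δ)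
lin-lipschitz zero {A} {B} {e} {δ = δ} A-unit B-unit 0≤δ A≤B y≤ y′≤ =
  subst (A 0 ≤_) (solve 3 (λ b e d → b :+ e := b :+ (e :+ con 0ℚ :* d)) refl (B 0) e δ) (A≤B 0)
lin-lipschitz (suc M) {A} {B} {e} {y} {y′} {δ} A-unit B-unit 0≤δ A≤B y≤ y′≤ =
  subst (lin (suc M) A y ≤_)
    (cong (lin (suc M) B y′ +_) (solve 3 (λ e m d → (e :+ m :* d) :+ d := e :+ (m :+ con 1ℚ) :* d) refl e (nat M) δ))
    (mix-lipschitz (cl-unit (y - nat M)) (lin-unit M B-unit y′) (B-unit (suc M)) 0≤δ
      (lin-lipschitz M A-unit B-unit 0≤δ A≤B y≤ y′≤)
      (ℚ.≤-trans (A≤B (suc M)) (ℚ.+-monoʳ-≤ (B (suc M)) (≤-cert (nat M * δ) (0≤* (nat-nonneg M) 0≤δ) refl)))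
      (cl-lipschitz 0≤δ (shift y y′ y≤)) (cl-lipschitz 0≤δ (shift y′ y y′≤)))
  where
  shift : ∀ p q → p ≤ q + δ → p - nat M ≤ (q - nat M) + δ
  shift p q p≤ = subst (p - nat M ≤_) (solve 3 (λ q d m → (q :+ d) :- m := (q :- m) :+ d) refl q δ (nat M))
    (ℚ.+-monoˡ-≤ (- nat M) p≤)

-- The nodes on which lin M A y depends.
Near : ℕ → ℚ → ℕ → Set
Near M y q = q ℕ.≤ M × (q ≡ 0 ⊎ nat q < y + 1ℚ) × (q ≡ M ⊎ y < nat q + 1ℚ)

lin-pos : ∀ M {A y} → (∀ q → Unit (A q)) → 0ℚ < lin M A y → ∃ λ q → 0ℚ < A q × Near M y q
lin-pos zero    A-unit 0<lin = 0 , 0<lin , z≤n , inj₁ refl , inj₁ refl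
lin-pos (suc M) {A} {y} A-unit 0<lin
  with +-pos⁻ {(1ℚ - cl (y - nat M)) * lin M A y} {cl (y - nat M) * A (suc M)} 0<lin
... | inj₁ 0<left =
  let 0<1-t , 0<lin′ = *-pos⁻ (0≤- (cl-≤1 (y - nat M))) (proj₁ (lin-unit M A-unit y)) 0<left
      q , 0<Aq , q≤M , q-low , q-high = lin-pos M A-unit 0<lin′
      y<M+1 : y < nat M + 1ℚ
      y<M+1 = <-cert (1ℚ - (y - nat M)) (0<- (cl-<1 (<-cert (1ℚ - t) 0<1-t (solve 1 (λ t → t :+ (con 1ℚ :- t) := con 1ℚ) refl t))))
        (solve 2 (λ y m → y :+ (con 1ℚ :- (y :- m)) := m :+ con 1ℚ) refl y (nat M))
  in q , 0<Aq , ℕ.m≤n⇒m≤1+n q≤M , q-low ,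
     inj₂ ([ (λ q≡M → subst (λ p → y < nat p + 1ℚ) (sym q≡M) y<M+1) , (λ lt → lt) ]′ q-high)
  where t = cl (y - nat M)
... | inj₂ 0<right =
  let 0<t , 0<A = *-pos⁻ (cl-≥0 (y - nat M)) (proj₁ (A-unit (suc M))) 0<right
  in suc M , 0<A , ℕ.≤-refl ,
     inj₂ (<-cert (y - nat M) (cl-pos 0<t) (solve 2 (λ y m → (m :+ con 1ℚ) :+ (y :- m) := y :+ con 1ℚ) refl y (nat M))) ,
     inj₁ refl

¼ : ℚ
¼ = ½ * ½

Rounds : ℕ → ℚ → ℕ → Set
Rounds M y q = q ℕ.≤ M × (q ≡ 0 ⊎ nat q ≤ y + ½) × (q ≡ M ⊎ y ≤ nat q + ½)

½*≤ : ∀ {p} → 0ℚ ≤ p → ½ * p ≤ p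
½*≤ {p} 0≤p = ≤-cert (½ * p) (0≤* 0≤½ 0≤p) (solve 1 (λ p → con ½ :* p :+ con ½ :* p := p) refl p)

lin-top : ∀ M {A y} → (∀ q → Unit (A q)) → M ≡ 0 ⊎ nat M ≤ y + ½ → ½ * A M ≤ lin M A y
lin-top zero    A-unit _ = ½*≤ (proj₁ (A-unit 0))
lin-top (suc M) {A} {y} A-unit (inj₂ M+1≤) = mix-≥ʳ (cl-unit (y - nat M)) (proj₁ (lin-unit M A-unit y))
  (cl-lower (≤-cert ((y + ½) - (nat M + 1ℚ)) (0≤- M+1≤)
      (solve 2 (λ y m → con ½ :+ ((y :+ con ½) :- (m :+ con 1ℚ)) := y :- m) refl y (nat M)))
    (ℚ.<⇒≤ (<-cert ½ 0<½ refl)))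
  (proj₁ (A-unit (suc M)))

-- The step that brings in a nearest node gives it weight at least ½, the next step takes away at
-- most half of that, and later steps have weight 0 at `y`. Hence the factor ¼.
lin-round : ∀ M {A y q} → (∀ q → Unit (A q)) → Rounds M y q → ¼ * A q ≤ lin M A y
lin-round zero {A} {q = zero} A-unit _ = ℚ.≤-trans
  (subst (_≤ ½ * A 0) (solve 1 (λ a → con ½ :* (con ½ :* a) := con ¼ :* a) refl (A 0)) (½*≤ (0≤* 0≤½ (proj₁ (A-unit 0)))))
  (½*≤ (proj₁ (A-unit 0)))
lin-round (suc M) {A} {y} {q} A-unit (q≤ , lo , hi) with q ℕ.≟ suc M
... | yes refl = ℚ.≤-trans
  (subst (_≤ ½ * A q) (solve 1 (λ a → con ½ :* (con ½ :* a) := con ¼ :* a) refl (A q)) (½*≤ (0≤* 0≤½ (proj₁ (A-unit q)))))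
  (lin-top (suc M) A-unit lo)
... | no q≢ with q ℕ.≟ M
...   | yes refl = ℚ.≤-trans
  (subst (_≤ ½ * lin M A y) (solve 1 (λ a → con ½ :* (con ½ :* a) := con ¼ :* a) refl (A M))
    (ℚ.*-monoˡ-≤-nonNeg ½ (lin-top M A-unit lo)))
  (mix-≥ˡ {k = ½} (cl-unit (y - nat M)) (proj₁ (A-unit (suc M)))
    (≤-cert (½ - t) (0≤- (cl-upper y-M≤½ 0≤½)) (solve 1 (λ t → con ½ :+ (con ½ :- t) := con 1ℚ :- t) refl t))
    (proj₁ (lin-unit M A-unit y)))
  where
  t = cl (y - nat M)
  y-M≤½ : y - nat M ≤ ½
  y-M≤½ = ≤-cert ((nat M + ½) - y) (0≤- ([ (λ M≡ → ⊥-elim (q≢ M≡)) , (λ le → le) ]′ hi))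
    (solve 2 (λ y m → (y :- m) :+ ((m :+ con ½) :- y) := con ½) refl y (nat M))
...   | no q≢M = ℚ.≤-trans (lin-round M A-unit (q≤M , lo , inj₂ y≤))
  (subst (_≤ lin (suc M) A y) (ℚ.*-identityˡ (lin M A y))
    (mix-≥ˡ {k = 1ℚ} (cl-unit (y - nat M)) (proj₁ (A-unit (suc M)))
      (≤-cert (0ℚ - t) (0≤- (cl-upper y-M≤0 ℚ.≤-refl)) (solve 1 (λ t → con 1ℚ :+ (con 0ℚ :- t) := con 1ℚ :- t) refl t))
      (proj₁ (lin-unit M A-unit y))))
  where
  t = cl (y - nat M)
  q≤M : q ℕ.≤ M
  q≤M = ℕ.≤-pred (ℕ.≤∧≢⇒< q≤ q≢)
  y≤ : y ≤ nat q + ½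
  y≤ = [ (λ q≡ → ⊥-elim (q≢ q≡)) , (λ le → le) ]′ hi
  y-M≤0 : y - nat M ≤ 0ℚ
  y-M≤0 = ≤-cert (((nat q + ½) - y) + ((nat M - (nat q + 1ℚ)) + ½))
    (0≤+ (0≤- y≤) (0≤+ (0≤- (nat-mono (ℕ.≤∧≢⇒< q≤M q≢M))) 0≤½))
    (solve 3 (λ y m q → (y :- m) :+ (((q :+ con ½) :- y) :+ ((m :- (q :+ con 1ℚ)) :+ con ½)) := con 0ℚ) refl y (nat M) (nat q))

Lin : ∀ M {d} → (Vec ℕ d → ℚ) → (Fin d → ℚ) → ℚ
Lin M {zero}  A y = A []
Lin M {suc d} A y = lin M (λ q → Lin M (A ∘ (q ∷_)) (y ∘ suc)) (y zero)

Lin-unit : ∀ M {d} {A : Vec ℕ d → ℚ} → (∀ q → Unit (A q)) → ∀ y → Unit (Lin M A y)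
Lin-unit M {zero}  A-unit y = A-unit []
Lin-unit M {suc d} A-unit y = lin-unit M (λ q → Lin-unit M (A-unit ∘ (q ∷_)) (y ∘ suc)) (y zero)

Lin-sum : ∀ M {d N} (A : Fin N → Vec ℕ d → ℚ) → (∀ q → foldr _+_ 0ℚ (λ v → A v q) ≡ 1ℚ) → ∀ y →
  foldr _+_ 0ℚ (λ v → Lin M (A v) y) ≡ 1ℚ
Lin-sum M {zero}  A A-sum y = A-sum []
Lin-sum M {suc d} A A-sum y = trans (lin-sum M (λ v q → Lin M (A v ∘ (q ∷_)) (y ∘ suc)) (y zero))
  (trans (lin-cong M (λ q → Lin-sum M (λ v → A v ∘ (q ∷_)) (A-sum ∘ (q ∷_)) (y ∘ suc)) (y zero)) (lin-const M 1ℚ (y zero)))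

Lin-lipschitz : ∀ M {d} {A : Vec ℕ d → ℚ} {y y′ δ} → (∀ q → Unit (A q)) → 0ℚ ≤ δ →
  (∀ i → y i ≤ y′ i + δ) → (∀ i → y′ i ≤ y i + δ) → Lin M A y ≤ Lin M A y′ + nat d * (nat M * δ)
Lin-lipschitz M {zero} {A} {δ = δ} A-unit 0≤δ y≤ y′≤ =
  ℚ.≤-reflexive (solve 2 (λ a x → a := a :+ con 0ℚ :* x) refl (A []) (nat M * δ))
Lin-lipschitz M {suc d} {A} {y} {y′} {δ} A-unit 0≤δ y≤ y′≤ =
  subst (Lin M A y ≤_) (cong (Lin M A y′ +_) (solve 2 (λ d x → d :* x :+ x := (d :+ con 1ℚ) :* x) refl (nat d) (nat M * δ)))
    (lin-lipschitz M (λ q → Lin-unit M (A-unit ∘ (q ∷_)) (y ∘ suc)) (λ q → Lin-unit M (A-unit ∘ (q ∷_)) (y′ ∘ suc)) 0≤δ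
      (λ q → Lin-lipschitz M (A-unit ∘ (q ∷_)) 0≤δ (y≤ ∘ suc) (y′≤ ∘ suc)) (y≤ zero) (y′≤ zero))

Lin-pos : ∀ M {d} {A : Vec ℕ d → ℚ} {y} → (∀ q → Unit (A q)) → 0ℚ < Lin M A y →
  ∃ λ q → 0ℚ < A q × (∀ i → Near M (y i) (lookup q i))
Lin-pos M {zero}  A-unit 0<Lin = [] , 0<Lin , λ ()
Lin-pos M {suc d} {A} {y} A-unit 0<Lin =
  let q , 0<q , near = lin-pos M (λ q → Lin-unit M (A-unit ∘ (q ∷_)) (y ∘ suc)) 0<Lin
      qs , 0<A , nears = Lin-pos M (A-unit ∘ (q ∷_)) 0<q
  in q ∷ qs , 0<A , λ { zero → near ; (suc i) → nears i }

¼^_ : ℕ → ℚ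
¼^ zero  = 1ℚ
¼^ suc d = ¼ * (¼^ d)

Lin-round : ∀ M {d} {A : Vec ℕ d → ℚ} {y} → (∀ q → Unit (A q)) → ∀ q → (∀ i → Rounds M (y i) (lookup q i)) →
  (¼^ d) * A q ≤ Lin M A y
Lin-round M {zero}  {A} A-unit [] rounds = ℚ.≤-reflexive (ℚ.*-identityˡ (A []))
Lin-round M {suc d} {A} {y} A-unit (q ∷ qs) rounds = ℚ.≤-trans
  (subst (_≤ ¼ * Lin M (A ∘ (q ∷_)) (y ∘ suc)) (sym (ℚ.*-assoc ¼ (¼^ d) (A (q ∷ qs))))
    (ℚ.*-monoˡ-≤-nonNeg ¼ (Lin-round M (A-unit ∘ (q ∷_)) qs (rounds ∘ suc))))
  (lin-round M (λ q → Lin-unit M (A-unit ∘ (q ∷_)) (y ∘ suc)) (rounds zero))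

-- Approximation of reals

½^_ : ℕ → ℚ
½^ zero  = 1ℚ
½^ suc n = ½ * (½^ n)

½^-pos : ∀ n → 0ℚ < ½^ n
½^-pos zero    = 0<1
½^-pos (suc n) = 0<* 0<½ (½^-pos n)

½^-nonneg : ∀ n → 0ℚ ≤ ½^ n
½^-nonneg n = ℚ.<⇒≤ (½^-pos n)

½^-halves : ∀ n → ½^ suc n + ½^ suc n ≡ ½^ n
½^-halves n = solve 1 (λ x → con ½ :* x :+ con ½ :* x := x) refl (½^ n)

½^-mono : ∀ {m n} → m ℕ.≤ n → ½^ n ≤ ½^ m
½^-mono {m} m≤n = go (ℕ.≤⇒≤′ m≤n)
  where
  go : ∀ {n} → m ℕ.≤′ n → ½^ n ≤ ½^ m
  go (ℕ.≤′-reflexive refl) = ℚ.≤-refl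
  go (ℕ.≤′-step {n} m≤n)   = ℚ.≤-trans (½*≤ (½^-nonneg n)) (go m≤n)

½^≤1 : ∀ n → ½^ n ≤ 1ℚ
½^≤1 n = ½^-mono {0} {n} z≤n

2^*½^ : ∀ n → nat (2 ℕ.^ n) * ½^ n ≡ 1ℚ
2^*½^ zero    = refl
2^*½^ (suc n) = trans (cong (_* ½^ suc n) (nat-* 2 (2 ℕ.^ n)))
  (trans (solve 2 (λ a b → (con (nat 2) :* a) :* (con ½ :* b) := a :* b) refl (nat (2 ℕ.^ n)) (½^ n)) (2^*½^ n))

n≤2^n : ∀ n → n ℕ.≤ 2 ℕ.^ n
n≤2^n zero    = z≤n
n≤2^n (suc n) = ℕ.≤-trans (ℕ.+-mono-≤ (ℕ.m^n>0 2 n) (n≤2^n n)) (ℕ.≤-reflexive (cong (2 ℕ.^ n ℕ.+_) (sym (ℕ.+-identityʳ (2 ℕ.^ n)))))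

n*½^n≤1 : ∀ n → nat n * ½^ n ≤ 1ℚ
n*½^n≤1 n = subst (nat n * ½^ n ≤_) (2^*½^ n) (ℚ.*-monoʳ-≤-nonNeg (½^ n) {{ℚ.nonNegative (½^-nonneg n)}} (nat-mono (n≤2^n n)))

toℚᵘ-nat : ∀ n → toℚᵘ (nat n) ℚᵘ.≃ ℚᵘ.mkℚᵘ (ℤ.+ n) 0
toℚᵘ-nat zero    = ℚᵘ.≃-refl
toℚᵘ-nat (suc n) = ℚᵘ.≃-trans (ℚ.toℚᵘ-homo-+ (nat n) 1ℚ) (ℚᵘ.≃-trans (ℚᵘ.+-congˡ ℚᵘ.1ℚᵘ (toℚᵘ-nat n))
  (ℚᵘ.*≡* (cong (ℤ._* ℤ.+ 1) (trans (cong₂ ℤ._+_ (ℤ.*-identityʳ (ℤ.+ n)) (ℤ.*-identityʳ (ℤ.+ 1))) (cong ℤ.+_ (ℕ.+-comm n 1))))))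

d≤d*a : ∀ a d → ℚᵘ.1ℚᵘ ℚᵘ.≤ ℚᵘ.mkℚᵘ (ℤ.+ suc d) 0 ℚᵘ.* ℚᵘ.mkℚᵘ (ℤ.+ suc a) d
d≤d*a a d = ℚᵘ.*≤* (subst (ℤ._≤ (ℤ.+ suc d ℤ.* ℤ.+ suc a) ℤ.* ℤ.+ 1) (sym (ℤ.*-identityˡ (ℤ.+ suc (d ℕ.+ 0))))
  (subst (ℤ.+ suc (d ℕ.+ 0) ℤ.≤_) (sym (ℤ.*-identityʳ (ℤ.+ suc d ℤ.* ℤ.+ suc a)))
    (ℤ.+≤+ (ℕ.≤-trans (ℕ.≤-reflexive (cong suc (ℕ.+-identityʳ d))) (ℕ.m≤m*n (suc d) (suc a))))))

-- The denominator of `ε` serves as `n`: the product is the numerator, a positive integer.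
archimedean : ∀ ε → 0ℚ < ε → ∃ λ n → 1ℚ ≤ nat n * ε
archimedean ε@(mkℚ (ℤ.+ zero) _ _) 0<ε = ⊥-elim (ℤ.<-irrefl refl (ℚ.drop-*<* 0<ε))
archimedean ε@(mkℚ ℤ.-[1+ _ ] _ _) 0<ε = case ℚ.drop-*<* 0<ε of λ ()
archimedean ε@(mkℚ (ℤ.+ suc a) d _) 0<ε = suc d , ℚ.toℚᵘ-cancel-≤ (ℚᵘ.≤-respʳ-≃ (ℚᵘ.≃-sym value) (d≤d*a a d))
  where
  value : toℚᵘ (nat (suc d) * ε) ℚᵘ.≃ ℚᵘ.mkℚᵘ (ℤ.+ suc d) 0 ℚᵘ.* toℚᵘ ε
  value = ℚᵘ.≃-trans (ℚ.toℚᵘ-homo-* (nat (suc d)) ε) (ℚᵘ.*-congʳ {toℚᵘ ε} (toℚᵘ-nat (suc d)))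

½^-small : ∀ ε → 0ℚ < ε → ∃ λ n → ½^ n < ε
½^-small ε 0<ε with archimedean ε 0<ε
... | n , 1≤nε = suc n , ℚ.<-≤-trans
  (<-cert (½^ suc n) (½^-pos (suc n)) (½^-halves n))
  (≤-cert (½^ n * (nat n * ε - 1ℚ) + (1ℚ - nat n * ½^ n) * ε)
    (0≤+ (0≤* (½^-nonneg n) (0≤- 1≤nε)) (0≤* (0≤- (n*½^n≤1 n)) (ℚ.<⇒≤ 0<ε)))
    (solve 3 (λ h n e → h :+ (h :* (n :* e :- con 1ℚ) :+ (con 1ℚ :- n :* h) :* e) := e) refl (½^ n) (nat n) ε))

½^-+ : ∀ m n → ½^ (m ℕ.+ n) ≡ ½^ m * ½^ n
½^-+ zero    n = sym (ℚ.*-identityˡ (½^ n))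
½^-+ (suc m) n = trans (cong (½ *_) (½^-+ m n)) (sym (ℚ.*-assoc ½ (½^ m) (½^ n)))

L*½^≤ : ∀ L n → nat L * ½^ (L ℕ.+ n) ≤ ½^ n
L*½^≤ L n = ≤-cert ((1ℚ - nat L * ½^ L) * ½^ n) (0≤* (0≤- (n*½^n≤1 L)) (½^-nonneg n))
  (trans (cong (λ z → nat L * z + (1ℚ - nat L * ½^ L) * ½^ n) (½^-+ L n))
    (solve 3 (λ l h k → l :* (h :* k) :+ (con 1ℚ :- l :* h) :* k := k) refl (nat L) (½^ L) (½^ n)))

½^-small* : ∀ L ε → 0ℚ < ε → ∃ λ n → nat L * ½^ n < ε
½^-small* L ε 0<ε = let n , ½^n<ε = ½^-small ε 0<ε in L ℕ.+ n , ℚ.≤-<-trans (L*½^≤ L n) ½^n<ε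

p≤∣p∣ : ∀ p → p ≤ ℚ.∣ p ∣
p≤∣p∣ p with ℚ.≤-total 0ℚ p
... | inj₁ 0≤p = ℚ.≤-reflexive (sym (ℚ.0≤p⇒∣p∣≡p 0≤p))
... | inj₂ p≤0 = ℚ.≤-trans p≤0 (ℚ.0≤∣p∣ p)

∣p-q∣<⇒p< : ∀ {p q δ} → ℚ.∣ p - q ∣ < δ → p < q + δ
∣p-q∣<⇒p< {p} {q} {δ} lt = <-cert (δ - (p - q)) (0<- (ℚ.≤-<-trans (p≤∣p∣ (p - q)) lt))
  (solve 3 (λ p q d → p :+ (d :- (p :- q)) := q :+ d) refl p q δ)

∣-∣-sym : ∀ p q → ℚ.∣ p - q ∣ ≡ ℚ.∣ q - p ∣
∣-∣-sym p q = trans (sym (ℚ.∣-p∣≡∣p∣ (p - q))) (cong ℚ.∣_∣ (solve 2 (λ p q → :- (p :- q) := q :- p) refl p q))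

∣p-q∣<⇒q< : ∀ {p q δ} → ℚ.∣ p - q ∣ < δ → q < p + δ
∣p-q∣<⇒q< {p} {q} {δ} lt = ∣p-q∣<⇒p< (subst (_< δ) (∣-∣-sym p q) lt)

∣p-q∣< : ∀ {p q δ} → p < q + δ → q < p + δ → ℚ.∣ p - q ∣ < δ
∣p-q∣< {p} {q} {δ} p< q< with ℚ.∣p∣≡p∨∣p∣≡-p (p - q)
... | inj₁ eq = subst (_< δ) (sym eq)
  (<-cert ((q + δ) - p) (0<- p<) (solve 3 (λ p q d → (p :- q) :+ ((q :+ d) :- p) := d) refl p q δ))
... | inj₂ eq = subst (_< δ) (sym eq)
  (<-cert ((p + δ) - q) (0<- q<) (solve 3 (λ p q d → (:- (p :- q)) :+ ((p :+ d) :- q) := d) refl p q δ))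

maximum : ∀ {n} → (Fin n → ℕ) → ℕ
maximum {zero}  f = 0
maximum {suc n} f = f zero ℕ.⊔ maximum (f ∘ suc)

≤-maximum : ∀ {n} (f : Fin n → ℕ) i → f i ℕ.≤ maximum f
≤-maximum f zero    = ℕ.m≤m⊔n (f zero) (maximum (f ∘ suc))
≤-maximum f (suc i) = ℕ.≤-trans (≤-maximum (f ∘ suc) i) (ℕ.m≤n⊔m (f zero) (maximum (f ∘ suc)))

at : ∀ {d} → Vector ℝ d → ℕ → Fin d → ℚ
at x n i = seq (x i) n

sumℚ : ∀ {d} → (Fin d → ℚ) → ℚ
sumℚ = foldr _+_ 0ℚ

sq : ∀ {d} → (Fin d → ℚ) → ℚ
sq y = sumℚ (λ i → y i * y i)

seq-sum : ∀ {d} (x : Vector ℝ d) n → seq (ℝ.sum x) n ≡ sumℚ (at x n)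
seq-sum {zero}  x n = refl
seq-sum {suc d} x n = cong (seq (x zero) n +_) (seq-sum (x ∘ suc) n)

seq-normSq : ∀ {d} (x : Vector ℝ d) n → seq (normSq x) n ≡ sq (at x n)
seq-normSq x n = seq-sum (λ i → x i ℝ.* x i) n

sumℚ-≤ : ∀ {d} {a b : Fin d → ℚ} k → (∀ i → a i ≤ b i + k) → sumℚ a ≤ sumℚ b + nat d * k
sumℚ-≤ {zero}  k le = ℚ.≤-reflexive (solve 1 (λ k → con 0ℚ := con 0ℚ :+ con 0ℚ :* k) refl k)
sumℚ-≤ {suc d} {a} {b} k le = subst (sumℚ a ≤_)
  (solve 4 (λ b t n k → (b :+ k) :+ (t :+ n :* k) := (b :+ t) :+ (n :+ con 1ℚ) :* k) refl (b zero) (sumℚ (b ∘ suc)) (nat d) k)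
  (ℚ.+-mono-≤ (le zero) (sumℚ-≤ k (le ∘ suc)))

sumℚ-zero : ∀ n → sumℚ {n} (λ _ → 0ℚ) ≡ 0ℚ
sumℚ-zero zero    = refl
sumℚ-zero (suc n) = trans (ℚ.+-identityˡ (sumℚ {n} (λ _ → 0ℚ))) (sumℚ-zero n)

sumℚ-nonneg : ∀ {d} {a : Fin d → ℚ} → (∀ i → 0ℚ ≤ a i) → 0ℚ ≤ sumℚ a
sumℚ-nonneg {zero}  le = ℚ.≤-refl
sumℚ-nonneg {suc d} le = 0≤+ (le zero) (sumℚ-nonneg (le ∘ suc))

term≤sumℚ : ∀ {d} {a : Fin d → ℚ} → (∀ i → 0ℚ ≤ a i) → ∀ i → a i ≤ sumℚ a
term≤sumℚ {a = a} le zero    = ≤-cert (sumℚ (a ∘ suc)) (sumℚ-nonneg (le ∘ suc)) refl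
term≤sumℚ {a = a} le (suc i) = ℚ.≤-trans (term≤sumℚ (le ∘ suc) i)
  (≤-cert (a zero) (le zero) (ℚ.+-comm (sumℚ (a ∘ suc)) (a zero)))

0≤² : ∀ p → 0ℚ ≤ p * p
0≤² p with ℚ.≤-total 0ℚ p
... | inj₁ 0≤p = 0≤* 0≤p 0≤p
... | inj₂ p≤0 = subst (0ℚ ≤_) (solve 1 (λ p → (con 0ℚ :- p) :* (con 0ℚ :- p) := p :* p) refl p) (0≤* (0≤- p≤0) (0≤- p≤0))

²≤1⇒≤1 : ∀ {p} → p * p ≤ 1ℚ → p ≤ 1ℚ
²≤1⇒≤1 {p} p²≤1 = ℚ.≮⇒≥ λ 1<p → ℚ.<-irrefl refl (ℚ.<-≤-trans
  (<-cert ((p - 1ℚ) + p * (p - 1ℚ)) (0<+≤ (0<- 1<p) (0≤* (ℚ.≤-trans 0≤1 (ℚ.<⇒≤ 1<p)) (0≤- (ℚ.<⇒≤ 1<p))))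
    (solve 1 (λ p → con 1ℚ :+ ((p :- con 1ℚ) :+ p :* (p :- con 1ℚ)) := p :* p) refl p)) p²≤1)

²≤1⇒≥-1 : ∀ {p} → p * p ≤ 1ℚ → - 1ℚ ≤ p
²≤1⇒≥-1 {p} p²≤1 = subst (- 1ℚ ≤_) (solve 1 (λ p → :- (:- p) := p) refl p)
  (ℚ.neg-antimono-≤ (²≤1⇒≤1 (subst (_≤ 1ℚ) (solve 1 (λ p → p :* p := (:- p) :* (:- p)) refl p) p²≤1)))

-- A point of the sphere on a segment that leaves the ball, by bisection.
module Bisection {d} (p q : Fin d → ℚ) (p-in : sq p ≤ 1ℚ) (q-out : 1ℚ < sq q)
  (η : ℚ) (0≤η : 0ℚ ≤ η) (η≤1 : η ≤ 1ℚ) (q≤ : ∀ i → q i ≤ p i + η) (p≤ : ∀ i → p i ≤ q i + η) where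

  u : Fin d → ℚ
  u i = q i - p i

  along : ℚ → Fin d → ℚ
  along t i = p i + t * u i

  record Bracket (n : ℕ) : Set where
    field
      lo      : ℚ
      lo≥0    : 0ℚ ≤ lo
      hi≤1    : lo + ½^ n ≤ 1ℚ
      lo-in   : sq (along lo) ≤ 1ℚ
      hi-out  : 1ℚ < sq (along (lo + ½^ n))

  open Bracket

  sq-cong : ∀ {a b : Fin d → ℚ} → (∀ i → a i ≡ b i) → sq a ≡ sq b
  sq-cong eq = foldr-cong λ i → cong₂ _*_ (eq i) (eq i)

  start : Bracket 0
  start = record
    { lo = 0ℚ ; lo≥0 = ℚ.≤-refl ; hi≤1 = ℚ.≤-refl
    ; lo-in  = subst (_≤ 1ℚ) (sq-cong λ i → solve 2 (λ p u → p := p :+ con 0ℚ :* u) refl (p i) (u i)) p-in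
    ; hi-out = subst (1ℚ <_) (sq-cong λ i → solve 2 (λ p q → q := p :+ (con 0ℚ :+ con 1ℚ) :* (q :- p)) refl (p i) (q i)) q-out
    }

  step : ∀ {n} → Bracket n → Bracket (suc n)
  step {n} B with sq (along (lo B + ½^ suc n)) ℚ.≤? 1ℚ
  ... | yes in′ = record
    { lo = lo B + ½^ suc n
    ; lo≥0 = 0≤+ (lo≥0 B) (½^-nonneg (suc n))
    ; hi≤1 = subst (_≤ 1ℚ) (sym split) (hi≤1 B)
    ; lo-in = in′
    ; hi-out = subst (λ t → 1ℚ < sq (along t)) (sym split) (hi-out B) }
    where
    split : (lo B + ½^ suc n) + ½^ suc n ≡ lo B + ½^ n
    split = trans (ℚ.+-assoc (lo B) (½^ suc n) (½^ suc n)) (cong (lo B +_) (½^-halves n))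
  ... | no out = record
    { lo = lo B
    ; lo≥0 = lo≥0 B
    ; hi≤1 = ℚ.≤-trans (ℚ.+-monoʳ-≤ (lo B) (½*≤ (½^-nonneg n))) (hi≤1 B)
    ; lo-in = lo-in B
    ; hi-out = ℚ.≰⇒> out }

  bracket : ∀ n → Bracket n
  bracket zero    = start
  bracket (suc n) = step (bracket n)

  t : ℕ → ℚ
  t n = lo (bracket n)

  step-bounds : ∀ {n} (B : Bracket n) → lo B ≤ lo (step B) × lo (step B) + ½^ suc n ≤ lo B + ½^ n
  step-bounds {n} B with sq (along (lo B + ½^ suc n)) ℚ.≤? 1ℚ
  ... | yes _ = ≤-cert (½^ suc n) (½^-nonneg (suc n)) refl ,
    ℚ.≤-reflexive (trans (ℚ.+-assoc (lo B) (½^ suc n) (½^ suc n)) (cong (lo B +_) (½^-halves n)))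
  ... | no  _ = ℚ.≤-refl , ℚ.+-monoʳ-≤ (lo B) (½*≤ (½^-nonneg n))

  t-bounds : ∀ {m n} → m ℕ.≤ n → t m ≤ t n × t n + ½^ n ≤ t m + ½^ m
  t-bounds {m} m≤n = go (ℕ.≤⇒≤′ m≤n)
    where
    go : ∀ {n} → m ℕ.≤′ n → t m ≤ t n × t n + ½^ n ≤ t m + ½^ m
    go (ℕ.≤′-reflexive refl) = ℚ.≤-refl , ℚ.≤-refl
    go (ℕ.≤′-step {n} m≤n) =
      let tm≤ , ≤tm = go m≤n ; tn≤ , ≤tn = step-bounds (bracket n)
      in ℚ.≤-trans tm≤ tn≤ , ℚ.≤-trans ≤tn ≤tm

  t-close : ∀ k {m n} → k ℕ.≤ m → k ℕ.≤ n → t m ≤ t n + ½^ k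
  t-close k {m} {n} k≤m k≤n = ℚ.≤-trans (≤-cert (½^ m) (½^-nonneg m) refl)
    (ℚ.≤-trans (proj₂ (t-bounds k≤m)) (ℚ.+-monoˡ-≤ (½^ k) (proj₁ (t-bounds k≤n))))

  -1≤u : ∀ i → - 1ℚ ≤ u i
  -1≤u i = ≤-cert (((q i + η) - p i) + (1ℚ - η)) (0≤+ (0≤- (p≤ i)) (0≤- η≤1))
    (solve 3 (λ p q e → (con (- 1ℚ)) :+ (((q :+ e) :- p) :+ (con 1ℚ :- e)) := q :- p) refl (p i) (q i) η)

  u≤1 : ∀ i → u i ≤ 1ℚ
  u≤1 i = ≤-cert (((p i + η) - q i) + (1ℚ - η)) (0≤+ (0≤- (q≤ i)) (0≤- η≤1))
    (solve 3 (λ p q e → (q :- p) :+ (((p :+ e) :- q) :+ (con 1ℚ :- e)) := con 1ℚ) refl (p i) (q i) η)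

  along-close : ∀ {s t h} i → s ≤ t + h → t ≤ s + h → along s i ≤ along t i + h
  along-close {s} {t} {h} i s≤ t≤ = ≤-cert
    (½ * (((t + h) - s) * (1ℚ + u i) + ((s + h) - t) * (1ℚ - u i)))
    (0≤* 0≤½ (0≤+ (0≤* (0≤- s≤) 0≤1+u) (0≤* (0≤- t≤) (0≤- (u≤1 i)))))
    (solve 5 (λ p u s t h → (p :+ s :* u) :+ (con ½ :* (((t :+ h) :- s) :* (con 1ℚ :+ u) :+ ((s :+ h) :- t) :* (con 1ℚ :- u)))
        := (p :+ t :* u) :+ h) refl (p i) (u i) s t h)
    where
    0≤1+u : 0ℚ ≤ 1ℚ + u i
    0≤1+u = subst (0ℚ ≤_) (solve 1 (λ u → u :- (con (- 1ℚ)) := con 1ℚ :+ u) refl (u i)) (0≤- (-1≤u i))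

  boundary : Vector ℝ d
  boundary i = record { seq = λ n → along (t n) i ; cauchy = λ ε 0<ε →
    let k , ½^k<ε = ½^-small ε 0<ε
        close : ∀ m n → k ℕ.≤ m → k ℕ.≤ n → along (t m) i < along (t n) i + ε
        close m n k≤m k≤n = ℚ.≤-<-trans (along-close i (t-close k k≤m k≤n) (t-close k k≤n k≤m))
          (ℚ.+-monoʳ-< (along (t n) i) ½^k<ε)
    in k , λ m n k≤m k≤n → ∣p-q∣< (close m n k≤m k≤n) (close n m k≤n k≤m) }

  -- The increment is 2hxu + h²u², at most 2h + h², and `h ≤ 1` gives the constant 3.
  square-step : ∀ x u h → - 1ℚ ≤ x → x ≤ 1ℚ → - 1ℚ ≤ u → u ≤ 1ℚ → 0ℚ ≤ h → h ≤ 1ℚ →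
    (x + h * u) * (x + h * u) ≤ x * x + nat 3 * h
  square-step x u h -1≤x x≤1 -1≤u u≤1 0≤h h≤1 = ≤-cert
    (h * (((1ℚ - x) * (u - (- 1ℚ)) + (x - (- 1ℚ)) * (1ℚ - u)) + ((1ℚ - h) + h * ((1ℚ - u) * (u - (- 1ℚ))))))
    (0≤* 0≤h (0≤+ (0≤+ (0≤* (0≤- x≤1) (0≤- -1≤u)) (0≤* (0≤- -1≤x) (0≤- u≤1)))
      (0≤+ (0≤- h≤1) (0≤* 0≤h (0≤* (0≤- u≤1) (0≤- -1≤u))))))
    (solve 3 (λ x u h → (x :+ h :* u) :* (x :+ h :* u) :+
        h :* (((con 1ℚ :- x) :* (u :- con (- 1ℚ)) :+ (x :- con (- 1ℚ)) :* (con 1ℚ :- u)) :+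
          ((con 1ℚ :- h) :+ h :* ((con 1ℚ :- u) :* (u :- con (- 1ℚ)))))
        := x :* x :+ con (nat 3) :* h) refl x u h)

  almost-one : ∀ n → 1ℚ < sq (along (t n)) + nat d * (nat 3 * ½^ n)
  almost-one n = ℚ.<-≤-trans (hi-out (bracket n)) (sumℚ-≤ (nat 3 * ½^ n) λ i →
    subst (_≤ x i * x i + nat 3 * h)
      (cong₂ _*_ (shift i) (shift i))
      (square-step (x i) (u i) h (²≤1⇒≥-1 (x²≤1 i)) (²≤1⇒≤1 (x²≤1 i)) (-1≤u i) (u≤1 i) (½^-nonneg n) (½^≤1 n)))
    where
    h = ½^ n
    x = along (t n)
    x²≤1 : ∀ i → x i * x i ≤ 1ℚ
    x²≤1 i = ℚ.≤-trans (term≤sumℚ {a = λ i → x i * x i} (λ i → 0≤² (x i)) i) (lo-in (bracket n))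
    shift : ∀ i → x i + h * u i ≡ along (t n + h) i
    shift i = solve 4 (λ p t u h → (p :+ t :* u) :+ h :* u := p :+ (t :+ h) :* u) refl (p i) (t n) (u i) h

  on-sphere : Sphere d boundary
  on-sphere ε 0<ε =
    let k , small = ½^-small* (d ℕ.* 3) ε 0<ε
    in k , λ n k≤n → ∣p-q∣<
      (ℚ.≤-<-trans (ℚ.≤-trans (ℚ.≤-reflexive (seq-normSq boundary n)) (lo-in (bracket n)))
        (<-cert ε 0<ε refl))
      (ℚ.<-trans (almost-one n) (subst (λ z → sq (along (t n)) + nat d * (nat 3 * ½^ n) < z + ε) (sym (seq-normSq boundary n))
        (ℚ.+-monoʳ-< (sq (along (t n))) (ℚ.≤-<-trans (bound k n k≤n) small))))
    where
    bound : ∀ k n → k ℕ.≤ n → nat d * (nat 3 * ½^ n) ≤ nat (d ℕ.* 3) * ½^ k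
    bound k n k≤n = subst (nat d * (nat 3 * ½^ n) ≤_)
      (trans (sym (ℚ.*-assoc (nat d) (nat 3) (½^ k))) (cong (_* ½^ k) (sym (nat-* d 3))))
      (≤-cert (nat d * (nat 3 * (½^ k - ½^ n)))
        (0≤* (nat-nonneg d) (0≤* (nat-nonneg 3) (0≤- (½^-mono k≤n))))
        (solve 4 (λ a b x y → a :* (b :* x) :+ a :* (b :* (y :- x)) := a :* (b :* y)) refl (nat d) (nat 3) (½^ n) (½^ k)))

  t-unit : ∀ n → 0ℚ ≤ t n × t n ≤ 1ℚ
  t-unit n = lo≥0 (bracket n) , ℚ.≤-trans (≤-cert (½^ n) (½^-nonneg n) refl) (hi≤1 (bracket n))

  -- Every approximation of `boundary` lies on the segment from `p` to `q`, whose ends differ by at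
  -- most `η` in each coordinate.
  near : ∀ n i → (p i ≤ at boundary n i + η × at boundary n i ≤ p i + η) × (q i ≤ at boundary n i + η × at boundary n i ≤ q i + η)
  near n i =
    ( ≤-cert (t n * ((q i + η) - p i) + (1ℚ - t n) * η) (0≤+ (0≤* 0≤t (0≤- (p≤ i))) (0≤* (0≤- t≤1) 0≤η))
        (solve 4 (λ p q e t → p :+ (t :* ((q :+ e) :- p) :+ (con 1ℚ :- t) :* e) := (p :+ t :* (q :- p)) :+ e) refl (p i) (q i) η (t n))
    , ≤-cert (t n * ((p i + η) - q i) + (1ℚ - t n) * η) (0≤+ (0≤* 0≤t (0≤- (q≤ i))) (0≤* (0≤- t≤1) 0≤η))
        (solve 4 (λ p q e t → (p :+ t :* (q :- p)) :+ (t :* ((p :+ e) :- q) :+ (con 1ℚ :- t) :* e) := p :+ e) refl (p i) (q i) η (t n)) ) ,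
    ( ≤-cert ((1ℚ - t n) * ((p i + η) - q i) + t n * η) (0≤+ (0≤* (0≤- t≤1) (0≤- (q≤ i))) (0≤* 0≤t 0≤η))
        (solve 4 (λ p q e t → q :+ ((con 1ℚ :- t) :* ((p :+ e) :- q) :+ t :* e) := (p :+ t :* (q :- p)) :+ e) refl (p i) (q i) η (t n))
    , ≤-cert ((1ℚ - t n) * ((q i + η) - p i) + t n * η) (0≤+ (0≤* (0≤- t≤1) (0≤- (p≤ i))) (0≤* 0≤t 0≤η))
        (solve 4 (λ p q e t → (p :+ t :* (q :- p)) :+ ((con 1ℚ :- t) :* ((q :+ e) :- p) :+ t :* e) := q :+ e) refl (p i) (q i) η (t n)) )
    where
    0≤t = proj₁ (t-unit n)
    t≤1 = proj₂ (t-unit n)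

Lipschitz : ∀ {d} → ((Fin d → ℚ) → ℚ) → ℕ → Set
Lipschitz g L = ∀ y y′ δ → 0ℚ ≤ δ → (∀ i → y i ≤ y′ i + δ) → (∀ i → y′ i ≤ y i + δ) → g y ≤ g y′ + nat L * δ

-- `g` is applied termwise to the approximating sequences. A Lipschitz bound at rational points
-- gives both the Cauchy condition and uniform continuity.
module Lift {d} (g : (Fin d → ℚ) → ℚ) (L : ℕ) (lip : Lipschitz g L) where

  lip-< : ∀ {ε} k → nat L * ½^ k < ε → ∀ y y′ → (∀ i → y i < y′ i + ½^ k) → (∀ i → y′ i < y i + ½^ k) → g y < g y′ + ε
  lip-< k small y y′ y< y′< = ℚ.≤-<-trans (lip y y′ (½^ k) (½^-nonneg k) (ℚ.<⇒≤ ∘ y<) (ℚ.<⇒≤ ∘ y′<)) (ℚ.+-monoʳ-< (g y′) small)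

  lift : Vector ℝ d → ℝ
  lift x = record { seq = λ n → g (at x n) ; cauchy = λ ε 0<ε →
    let k , small = ½^-small* L ε 0<ε
        modulus = λ i → cauchy (x i) (½^ k) (½^-pos k)
        M = maximum (proj₁ ∘ modulus)
        close : ∀ m n → M ℕ.≤ m → M ℕ.≤ n → ∀ i → at x m i < at x n i + ½^ k
        close m n M≤m M≤n i = ∣p-q∣<⇒p< (proj₂ (modulus i) m n
          (ℕ.≤-trans (≤-maximum (proj₁ ∘ modulus) i) M≤m) (ℕ.≤-trans (≤-maximum (proj₁ ∘ modulus) i) M≤n))
    in M , λ m n M≤m M≤n → ∣p-q∣<
      (lip-< k small (at x m) (at x n) (close m n M≤m M≤n) (close n m M≤n M≤m))
      (lip-< k small (at x n) (at x m) (close n m M≤n M≤m) (close m n M≤m M≤n)) }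

  lift-continuous : ∀ ε → 0ℚ < ε → ∃ λ δ → 0ℚ < δ × (∀ x y → Close δ x y → lift x ℝ.< lift y ℝ.+ fromℚ ε)
  lift-continuous ε 0<ε = ½^ k , ½^-pos k , λ x y close →
    let bound₁ = λ i → proj₁ (proj₂ (proj₂ (proj₁ (close i))))
        bound₂ = λ i → proj₁ (proj₂ (proj₂ (proj₂ (close i))))
        M = maximum bound₁ ℕ.⊔ maximum bound₂
    -- Half of `ε` is kept as the gap that `_<_` on the reals demands; the other half bounds the
    -- variation of `g`.
    in ½ * ε , 0<½ε , M , λ n M≤n →
      let x< : ∀ i → at x n i < at y n i + ½^ k
          x< i = let e , 0<e , m , lt = proj₁ (close i) in ℚ.<-trans (<-cert e 0<e refl)
            (lt n (ℕ.≤-trans (ℕ.≤-trans (≤-maximum bound₁ i) (ℕ.m≤m⊔n (maximum bound₁) (maximum bound₂))) M≤n))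
          y< : ∀ i → at y n i < at x n i + ½^ k
          y< i = let e , 0<e , m , lt = proj₂ (close i) in ℚ.<-trans (<-cert e 0<e refl)
            (lt n (ℕ.≤-trans (ℕ.≤-trans (≤-maximum bound₂ i) (ℕ.m≤n⊔m (maximum bound₁) (maximum bound₂))) M≤n))
      in subst (g (at x n) + ½ * ε <_) (solve 2 (λ a e → (a :+ con ½ :* e) :+ con ½ :* e := a :+ e) refl (g (at y n)) ε)
           (ℚ.+-monoˡ-< (½ * ε) (lip-< k small (at x n) (at y n) x< y<))
    where
    0<½ε : 0ℚ < ½ * ε
    0<½ε = 0<* 0<½ 0<ε
    modulus : ∃ λ k → nat L * ½^ k < ½ * ε
    modulus = ½^-small* L (½ * ε) 0<½ε
    k = proj₁ modulus
    small = proj₂ modulus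

θ : ℕ → ℚ
θ N = ½^ (3 ℕ.+ N)

-- If at stage `n₀` every coordinate were at most `½^ (1 + N)`, the sum would be at most ½, although
-- it is less than ½ away from 1. Later stages can lower the coordinate found by less than
-- `½^ (2 + N)`, which leaves more than twice `θ N`: once for the bound and once for the gap in
-- `_<_`.
heavy-vertex : ∀ {N} (x : Vector ℝ N) → ℝ.sum x ℝ.≃ 1ℝ → ∃ λ v → fromℚ (θ N) ℝ.< x v
heavy-vertex {N} x sum≃1 = heavy (any? λ v → ½^ (1 ℕ.+ N) ℚ.<? at x n₀ v)
  where
  ν : ℚ
  ν = ½^ (2 ℕ.+ N)
  modulus : ∀ v → ∃ λ M → ∀ m n → M ℕ.≤ m → M ℕ.≤ n → ℚ.∣ seq (x v) m - seq (x v) n ∣ < ν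
  modulus v = cauchy (x v) ν (½^-pos (2 ℕ.+ N))
  near-1 : ∃ λ M → ∀ n → M ℕ.≤ n → ℚ.∣ seq (ℝ.sum x) n - 1ℚ ∣ < ½
  near-1 = sum≃1 ½ 0<½
  n₀ : ℕ
  n₀ = proj₁ near-1 ℕ.⊔ maximum (proj₁ ∘ modulus)
  ½<sum : ½ < sumℚ (at x n₀)
  ½<sum = <-cert ((sumℚ (at x n₀) + ½) - 1ℚ)
    (0<- (subst (λ z → 1ℚ < z + ½) (seq-sum x n₀)
      (∣p-q∣<⇒q< {seq (ℝ.sum x) n₀} {1ℚ} (proj₂ near-1 n₀ (ℕ.m≤m⊔n (proj₁ near-1) (maximum (proj₁ ∘ modulus)))))))
    (solve 1 (λ s → con ½ :+ ((s :+ con ½) :- con 1ℚ) := s) refl (sumℚ (at x n₀)))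
  M≤n₀ : ∀ v → proj₁ (modulus v) ℕ.≤ n₀
  M≤n₀ v = ℕ.≤-trans (≤-maximum (proj₁ ∘ modulus) v) (ℕ.m≤n⊔m (proj₁ near-1) (maximum (proj₁ ∘ modulus)))
  heavy : Dec (∃ λ v → ½^ (1 ℕ.+ N) < at x n₀ v) → ∃ λ v → fromℚ (θ N) ℝ.< x v
  heavy (yes (v , lt)) = v , θ N , ½^-pos (3 ℕ.+ N) , n₀ , λ n n₀≤n →
    subst (_< seq (x v) n) (sym (½^-halves (2 ℕ.+ N)))
      (<-cert ((at x n₀ v - ½^ (1 ℕ.+ N)) + ((at x n v + ν) - at x n₀ v))
        (ℚ.+-mono-< (0<- lt) (0<- (∣p-q∣<⇒p< {at x n₀ v} {at x n v} (proj₂ (modulus v) n₀ n (M≤n₀ v) (ℕ.≤-trans (M≤n₀ v) n₀≤n)))))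
        (trans (cong (λ z → ν + ((at x n₀ v - z) + ((at x n v + ν) - at x n₀ v))) (sym (½^-halves (1 ℕ.+ N))))
          (solve 3 (λ e a b → e :+ ((a :- (e :+ e)) :+ ((b :+ e) :- a)) := b) refl ν (at x n₀ v) (at x n v))))
  heavy (no light) = ⊥-elim (ℚ.<-irrefl refl (ℚ.<-≤-trans ½<sum (ℚ.≤-trans
    (sumℚ-≤ {b = λ _ → 0ℚ} (½^ (1 ℕ.+ N)) λ v → subst (at x n₀ v ≤_) (sym (ℚ.+-identityˡ (½^ (1 ℕ.+ N)))) (ℚ.≮⇒≥ λ lt → light (v , lt)))
    (≤-cert (½ * (1ℚ - nat N * ½^ N)) (0≤* 0≤½ (0≤- (n*½^n≤1 N)))
      (trans (cong (λ z → (z + nat N * (½ * ½^ N)) + ½ * (1ℚ - nat N * ½^ N)) (sumℚ-zero N))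
        (solve 2 (λ n h → (con 0ℚ :+ n :* (con ½ :* h)) :+ con ½ :* (con 1ℚ :- n :* h) := con ½) refl (nat N) (½^ N)))))))

-- Interpolating a labelling of the boundary of a cube

ext : ∀ {N} (σ : Subset N) → Vec ℕ ∣ σ ∣ → Vec ℕ N
ext []            q       = []
ext (outside ∷ σ) q       = 0 ∷ ext σ q
ext (inside ∷ σ)  (x ∷ q) = x ∷ ext σ q

elem : ∀ {N} (σ : Subset N) → Fin ∣ σ ∣ → Fin N
elem (outside ∷ σ) i       = suc (elem σ i)
elem (inside ∷ σ)  zero    = zero
elem (inside ∷ σ)  (suc i) = suc (elem σ i)

elem∈ : ∀ {N} (σ : Subset N) i → elem σ i ∈ σ
elem∈ (outside ∷ σ) i       = there (elem∈ σ i)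
elem∈ (inside ∷ σ)  zero    = here
elem∈ (inside ∷ σ)  (suc i) = there (elem∈ σ i)

lookup-ext : ∀ {N} (σ : Subset N) q i → lookup (ext σ q) (elem σ i) ≡ lookup q i
lookup-ext (outside ∷ σ) q       i       = lookup-ext σ q i
lookup-ext (inside ∷ σ)  (x ∷ q) zero    = refl
lookup-ext (inside ∷ σ)  (x ∷ q) (suc i) = lookup-ext σ q i

ext-carried : ∀ {N} (σ : Subset N) q → Carried (ext σ q) σ
ext-carried (outside ∷ σ) q       zero    k∉ = refl
ext-carried (outside ∷ σ) q       (suc k) k∉ = ext-carried σ q k λ k∈ → k∉ (there k∈)
ext-carried (inside ∷ σ)  (x ∷ q) zero    k∉ = ⊥-elim (k∉ here)
ext-carried (inside ∷ σ)  (x ∷ q) (suc k) k∉ = ext-carried σ q k λ k∈ → k∉ (there k∈)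

ext-rel : ∀ {N} (σ : Subset N) (R : ℕ → ℕ → Set) → R 0 0 → ∀ q q′ → (∀ i → R (lookup q i) (lookup q′ i)) →
  ∀ k → R (lookup (ext σ q) k) (lookup (ext σ q′) k)
ext-rel (outside ∷ σ) R R0 q q′ rel zero    = R0
ext-rel (outside ∷ σ) R R0 q q′ rel (suc k) = ext-rel σ R R0 q q′ rel k
ext-rel (inside ∷ σ)  R R0 (x ∷ q) (x′ ∷ q′) rel zero    = rel zero
ext-rel (inside ∷ σ)  R R0 (x ∷ q) (x′ ∷ q′) rel (suc k) = ext-rel σ R R0 q q′ (rel ∘ suc) k

ext-restrict : ∀ {N} (σ : Subset N) x → Carried x σ → ext σ (tabulate (λ i → lookup x (elem σ i))) ≡ x
ext-restrict []            []      x⊑ = refl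
ext-restrict (outside ∷ σ) (k ∷ x) x⊑ = cong₂ _∷_ (sym (x⊑ zero λ ())) (ext-restrict σ x λ i i∉ → x⊑ (suc i) λ { (there i∈) → i∉ i∈ })
ext-restrict (inside ∷ σ)  (k ∷ x) x⊑ = cong (k ∷_) (ext-restrict σ x λ i i∉ → x⊑ (suc i) λ { (there i∈) → i∉ i∈ })

OneBelow : ℕ → ℕ → Set
OneBelow x t = x ≡ t ⊎ x ≡ ℕ.pred t

decide : ∀ {P A : Set} → Dec P → A → A → A
decide (yes _) a b = a
decide (no _)  a b = b

differ : ∀ {N} → Vec ℕ N → Vec ℕ N → Subset N
differ []      []      = []
differ (t ∷ T) (x ∷ X) = decide (x ℕ.≟ t) outside inside ∷ differ T X

corner-differ : ∀ {N} (T X : Vec ℕ N) → (∀ k → OneBelow (lookup X k) (lookup T k)) → corner T (differ T X) ≡ X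
corner-differ []      []      near = refl
corner-differ (t ∷ T) (x ∷ X) near with x ℕ.≟ t
... | yes x≡t = cong₂ _∷_ (sym x≡t) (corner-differ T X (near ∘ suc))
... | no  x≢t = cong₂ _∷_ ([ (λ x≡t → ⊥-elim (x≢t x≡t)) , sym ]′ (near zero)) (corner-differ T X (near ∘ suc))

differ-∈ : ∀ {N} (T X : Vec ℕ N) {k} → k ∈ differ T X → lookup X k ≢ lookup T k
differ-∈ (t ∷ T) (x ∷ X) {suc k} (there k∈) = differ-∈ T X k∈
differ-∈ (t ∷ T) (x ∷ X) {zero} k∈ with x ℕ.≟ t
differ-∈ (t ∷ T) (x ∷ X) {zero} () | yes _
... | no x≢t = x≢t

-- In each coordinate, the top of the lattice interval around `y`, truncated to [0 , M]. By
-- `near-ceil` all nodes that influence the interpolation at a point are corners of one lattice cube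
-- with this top corner.
ceil : ℕ → ℚ → ℕ
ceil zero    y = 0
ceil (suc M) y = decide (nat (suc M) ℚ.<? y + 1ℚ) (suc M) (ceil M y)

ceil-spec : ∀ M y → ceil M y ℕ.≤ M × (ceil M y ≡ 0 ⊎ nat (ceil M y) < y + 1ℚ) ×
  (∀ q → q ℕ.≤ M → q ≡ 0 ⊎ nat q < y + 1ℚ → q ℕ.≤ ceil M y)
ceil-spec zero    y = z≤n , inj₁ refl , λ q q≤ _ → q≤
ceil-spec (suc M) y with nat (suc M) ℚ.<? y + 1ℚ
... | yes lt = ℕ.≤-refl , inj₂ lt , λ q q≤ _ → q≤
... | no ¬lt = let c≤ , c< , max = ceil-spec M y in ℕ.m≤n⇒m≤1+n c≤ , c< , λ q q≤ q< → case q ℕ.≟ suc M of λ where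
  (yes refl) → ⊥-elim ([ (λ ()) , ¬lt ]′ q<)
  (no  q≢)   → max q (ℕ.≤-pred (ℕ.≤∧≢⇒< q≤ q≢)) q<

near-ceil : ∀ {M y q} → Near M y q → OneBelow q (ceil M y)
near-ceil {M} {y} {q} (q≤M , q< , <q) = cases <q
  where
  c = ceil M y
  c≤M = proj₁ (ceil-spec M y)
  c< = proj₁ (proj₂ (ceil-spec M y))
  q≤c : q ℕ.≤ c
  q≤c = proj₂ (proj₂ (ceil-spec M y)) q q≤M q<
  c≤1+q : y < nat q + 1ℚ → c ≡ 0 ⊎ nat c < y + 1ℚ → c ℕ.≤ suc q
  c≤1+q y< (inj₁ c≡0)   = subst (ℕ._≤ suc q) (sym c≡0) z≤n
  c≤1+q y< (inj₂ c<y+1) = ℕ.≤-pred (nat-cancel-< (ℚ.<-trans c<y+1 (ℚ.+-monoˡ-< 1ℚ y<)))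
  cases : q ≡ M ⊎ y < nat q + 1ℚ → OneBelow q c
  cases (inj₁ q≡M) = inj₁ (ℕ.≤-antisym q≤c (subst (c ℕ.≤_) (sym q≡M) c≤M))
  cases (inj₂ y<) with q ℕ.≟ c
  ... | yes q≡c = inj₁ q≡c
  ... | no  q≢c = inj₂ (ℕ.≤-antisym (ℕ.pred-mono-≤ (ℕ.≤∧≢⇒< q≤c q≢c)) (ℕ.pred-mono-≤ (c≤1+q y< c<)))

indicator : ∀ {N} → Fin N → Fin N → ℚ
indicator w v = decide (w Fin.≟ v) 1ℚ 0ℚ

indicator-unit : ∀ {N} (w v : Fin N) → Unit (indicator w v)
indicator-unit w v with w Fin.≟ v
... | yes _ = 0≤1 , ℚ.≤-refl
... | no _  = ℚ.≤-refl , 0≤1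

indicator-pos : ∀ {N} (w v : Fin N) → 0ℚ < indicator w v → w ≡ v
indicator-pos w v 0< with w Fin.≟ v
... | yes w≡v = w≡v
... | no  _   = ⊥-elim (ℚ.<-irrefl refl 0<)

indicator-refl : ∀ {N} (w : Fin N) → indicator w w ≡ 1ℚ
indicator-refl w with w Fin.≟ w
... | yes _   = refl
... | no  w≢w = ⊥-elim (w≢w refl)

indicator-sum : ∀ {N} (w : Fin N) → sumℚ (indicator w) ≡ 1ℚ
indicator-sum {suc N} zero = trans (cong (1ℚ +_) (sumℚ-zero N)) (ℚ.+-identityʳ 1ℚ)
indicator-sum {suc N} (suc w) = trans (ℚ.+-identityˡ (sumℚ (λ v → indicator (suc w) (suc v))))
  (trans (foldr-cong shift) (indicator-sum w))
  where
  shift : ∀ v → indicator (suc w) (suc v) ≡ indicator w v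
  shift v with w Fin.≟ v
  ... | yes _ = refl
  ... | no  _ = refl

-- `G` interpolates the labels over all of [0 , M]^σ, though only the facet cubes are known to be
-- labelled by faces. The region where `G` is not controlled is the cube of half side `c` about 0,
-- which `b-large` keeps well inside the sphere.
module Cell {N} (C : Complex N) (ℓ : Vec ℕ N → Fin N) (m b : ℕ) (σ : Subset N) (σ∈ : Face C σ)
  (b-large : (m ℕ.+ m) ℕ.* suc ∣ σ ∣ ℕ.≤ 2 ℕ.^ b)
  (facets : ∀ e → e ∈ σ → ∀ T → Carried T (σ ∖ e) → ∀ ρ → Cubical.Labelled ℓ T (σ ∖ e) ρ → Face C ρ)
  (sperner : ∀ x i → m ℕ.+ m ℕ.≤ lookup x i → 0 ℕ.< lookup x (ℓ x)) where

  open Cubical ℓ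

  d M : ℕ
  d = ∣ σ ∣
  M = m ℕ.+ m

  β h c : ℚ
  β = nat (2 ℕ.^ b)
  h = ½^ b
  c = h * nat m

  A : Fin N → Vec ℕ d → ℚ
  A v q = indicator (ℓ (ext σ q)) v

  A-unit : ∀ v q → Unit (A v q)
  A-unit v q = indicator-unit (ℓ (ext σ q)) v

  -- The coordinates of the ball are stretched so that outside a small ball some coordinate leaves [0 , M].
  Y : (Fin d → ℚ) → Fin d → ℚ
  Y r i = nat m + β * r i

  G : Fin N → (Fin d → ℚ) → ℚ
  G v r = Lin M (A v) (Y r)

  G-unit : ∀ v r → Unit (G v r)
  G-unit v r = Lin-unit M (A-unit v) (Y r)

  G-sum : ∀ r → sumℚ (λ v → G v r) ≡ 1ℚ
  G-sum r = Lin-sum M A (λ q → indicator-sum (ℓ (ext σ q))) (Y r)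

  L : ℕ
  L = d ℕ.* (M ℕ.* 2 ℕ.^ b)

  G-lipschitz : ∀ v → Lipschitz (G v) L
  G-lipschitz v r r′ δ 0≤δ r≤ r′≤ = subst (λ z → G v r ≤ G v r′ + z)
    (trans (solve 4 (λ d M b e → d :* (M :* (b :* e)) := (d :* (M :* b)) :* e) refl (nat d) (nat M) β δ)
      (cong (_* δ) (sym (trans (nat-* d (M ℕ.* 2 ℕ.^ b)) (cong (nat d *_) (nat-* M (2 ℕ.^ b)))))))
    (Lin-lipschitz M {y = Y r} {Y r′} {β * δ} (A-unit v) (0≤* (nat-nonneg (2 ℕ.^ b)) 0≤δ) (scaled r r′ r≤) (scaled r′ r r′≤))
    where
    scaled : ∀ r r′ → (∀ i → r i ≤ r′ i + δ) → ∀ i → Y r i ≤ Y r′ i + β * δ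
    scaled r r′ r≤ i = ≤-cert (β * ((r′ i + δ) - r i)) (0≤* (nat-nonneg (2 ℕ.^ b)) (0≤- (r≤ i)))
      (solve 5 (λ m b r s e → (m :+ b :* r) :+ b :* ((s :+ e) :- r) := (m :+ b :* s) :+ b :* e) refl (nat m) β (r i) (r′ i) δ)

  c≥0 : 0ℚ ≤ c
  c≥0 = 0≤* (½^-nonneg b) (nat-nonneg m)

  c-small : (nat d + 1ℚ) * (c + c) ≤ 1ℚ
  c-small = subst (_≤ 1ℚ)
    (trans (cong (_* h) (trans (nat-* M (suc d)) (cong (_* (nat d + 1ℚ)) (nat-+ m m))))
      (solve 3 (λ m d h → ((m :+ m) :* (d :+ con 1ℚ)) :* h := (d :+ con 1ℚ) :* (h :* m :+ h :* m)) refl (nat m) (nat d) h))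
    (subst (nat (M ℕ.* suc d) * h ≤_) (2^*½^ b)
      (ℚ.*-monoʳ-≤-nonNeg h {{ℚ.nonNegative (½^-nonneg b)}} (nat-mono b-large)))

  small-square : ∀ r i → 0ℚ ≤ Y r i → Y r i ≤ nat M → r i * r i ≤ 0ℚ + c * c
  small-square r i 0≤Y Y≤M = ≤-cert ((h * (nat M - Y r i)) * (h * Y r i))
    (0≤* (0≤* (½^-nonneg b) (0≤- Y≤M)) (0≤* (½^-nonneg b) 0≤Y))
    (trans (cong₂ (λ x y → r i * r i + x * y) left right)
      (solve 2 (λ c r → r :* r :+ (c :- r) :* (c :+ r) := con 0ℚ :+ c :* c) refl c (r i)))
    where
    left : h * (nat M - Y r i) ≡ c - r i
    left = trans (cong (λ z → h * (z - Y r i)) (nat-+ m m))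
      (trans (solve 4 (λ h m b r → h :* ((m :+ m) :- (m :+ b :* r)) := h :* m :- (b :* h) :* r) refl h (nat m) β (r i))
        (trans (cong (λ z → c - z * r i) (2^*½^ b)) (cong (λ z → c - z) (ℚ.*-identityˡ (r i)))))
    right : h * Y r i ≡ c + r i
    right = trans (solve 4 (λ h m b r → h :* (m :+ b :* r) := h :* m :+ (b :* h) :* r) refl h (nat m) β (r i))
      (trans (cong (λ z → c + z * r i) (2^*½^ b)) (cong (c +_) (ℚ.*-identityˡ (r i))))

  -- Otherwise all coordinates are at most `c` in absolute value and `sq r` is at most `d` times
  -- `c * c`, hence at most ¼ by `c-small`. The threshold ½ instead of 1 leaves room for
  -- approximations of points of the sphere.
  exit : ∀ r → ½ ≤ sq r → ∃ λ i → Y r i ≤ 0ℚ ⊎ nat M ≤ Y r i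
  exit r ½≤ with any? (λ i → Y r i ℚ.≤? 0ℚ) | any? (λ i → nat M ℚ.≤? Y r i)
  ... | yes (i , le) | _            = i , inj₁ le
  ... | no _         | yes (i , le) = i , inj₂ le
  ... | no ¬low      | no ¬high     = ⊥-elim (ℚ.<-irrefl refl (ℚ.<-≤-trans ¼<½ (ℚ.≤-trans ½≤ (ℚ.≤-trans
      (sumℚ-≤ {b = λ _ → 0ℚ} (c * c) λ i → small-square r i (ℚ.<⇒≤ (ℚ.≰⇒> λ le → ¬low (i , le))) (ℚ.<⇒≤ (ℚ.≰⇒> λ le → ¬high (i , le))))
      (≤-cert (½ * c * (1ℚ - (nat d + 1ℚ) * (c + c)) + ((½ - c) * (½ - c) + ½ * c))
        (0≤+ (0≤* (0≤* 0≤½ c≥0) (0≤- c-small)) (0≤+ (0≤² (½ - c)) (0≤* 0≤½ c≥0)))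
        (trans (cong (λ z → (z + nat d * (c * c)) + (½ * c * (1ℚ - (nat d + 1ℚ) * (c + c)) + ((½ - c) * (½ - c) + ½ * c))) (sumℚ-zero d))
          (solve 2 (λ d c → (con 0ℚ :+ d :* (c :* c)) :+
              (con ½ :* c :* (con 1ℚ :- (d :+ con 1ℚ) :* (c :+ c)) :+ ((con ½ :- c) :* (con ½ :- c) :+ con ½ :* c))
              := con ¼) refl (nat d) c)))))))
    where
    ¼<½ : ¼ < ½
    ¼<½ = <-cert ¼ (0<* 0<½ 0<½) refl

  -- Where a coordinate reaches the upper end, only nodes with value `M` there have weight, and the
  -- Sperner condition puts their labels in `σ`. At the lower end only nodes with value 0 have
  -- weight; they are corners of a single cube belonging to a facet, which is already filled.
  support-face : ∀ r → ½ ≤ sq r → ∀ τ → (∀ v → v ∈ τ → 0ℚ < G v r) → Face C τ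
  support-face r ½≤ τ pos = on-exit (exit r ½≤)
    where
    node : ∀ {v} → v ∈ τ → ∃ λ q → ℓ (ext σ q) ≡ v × (∀ i → Near M (Y r i) (lookup q i))
    node {v} v∈ = let q , 0<A , near = Lin-pos M (A-unit v) (pos v v∈) in q , indicator-pos (ℓ (ext σ q)) v 0<A , near
    on-exit : (∃ λ i → Y r i ≤ 0ℚ ⊎ nat M ≤ Y r i) → Face C τ
    on-exit (i , inj₂ M≤Y) = down-closed C τ⊆σ σ∈
      where
      τ⊆σ : τ ⊆ σ
      τ⊆σ {v} v∈ = vertex (node v∈)
        where
        vertex : (∃ λ q → ℓ (ext σ q) ≡ v × (∀ i → Near M (Y r i) (lookup q i))) → v ∈ σ
        vertex (q , refl , near) with ℓ (ext σ q) ∈? σ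
        ... | yes ∈σ = ∈σ
        ... | no  ∉σ = ⊥-elim (ℕ.<-irrefl (sym (ext-carried σ q (ℓ (ext σ q)) ∉σ))
                (sperner (ext σ q) (elem σ i) (subst (M ℕ.≤_) (sym (lookup-ext σ q i)) (M≤q (proj₂ (proj₂ (near i)))))))
          where
          M≤q : lookup q i ≡ M ⊎ Y r i < nat (lookup q i) + 1ℚ → M ℕ.≤ lookup q i
          M≤q (inj₁ q≡M) = ℕ.≤-reflexive (sym q≡M)
          M≤q (inj₂ Y<)  = ℕ.≤-pred (nat-cancel-< (ℚ.≤-<-trans M≤Y Y<))
    on-exit (i , inj₁ Y≤0) = facets e (elem∈ σ i) T T⊑ τ labelled
      where
      e = elem σ i
      tops : Vec ℕ d
      tops = tabulate (λ k → ceil M (Y r k))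
      T : Vec ℕ N
      T = ext σ tops
      top-i≡0 : lookup tops i ≡ 0
      top-i≡0 = trans (lookup∘tabulate (λ k → ceil M (Y r k)) i)
        ([ (λ eq → eq) , (λ lt → ℕ.n≤0⇒n≡0 (ℕ.≤-pred (nat-cancel-< (ℚ.<-≤-trans lt (ℚ.+-monoˡ-≤ 1ℚ Y≤0))))) ]′
          (proj₁ (proj₂ (ceil-spec M (Y r i)))))
      T⊑ : Carried T (σ ∖ e)
      T⊑ k k∉ with k ∈? σ
      ... | no  k∉σ = ext-carried σ tops k k∉σ
      ... | yes k∈σ with k Fin.≟ e
      ...   | yes refl = trans (lookup-ext σ tops i) top-i≡0
      ...   | no  k≢e  = ⊥-elim (k∉ (x∈p∧x≢y⇒x∈p-y k∈σ k≢e))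
      labelled : Labelled T (σ ∖ e) τ
      labelled v v∈ = label (node v∈)
        where
        label : (∃ λ q → ℓ (ext σ q) ≡ v × (∀ i → Near M (Y r i) (lookup q i))) → Label T (σ ∖ e) v
        label (q , refl , near) = differ T X , ⊆σ∖e , cong ℓ (corner-differ T X X-near)
          where
          X = ext σ q
          X-near : ∀ k → OneBelow (lookup X k) (lookup T k)
          X-near = ext-rel σ OneBelow (inj₁ refl) q tops λ k →
            subst (OneBelow (lookup q k)) (sym (lookup∘tabulate (λ k → ceil M (Y r k)) k)) (near-ceil (near k))
          ⊆σ∖e : differ T X ⊆ σ ∖ e
          ⊆σ∖e {k} k∈ with k ∈? σ ∖ e
          ... | yes k∈′ = k∈′
          ... | no  k∉′ = ⊥-elim (differ-∈ T X k∈ (both-zero (X-near k)))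
            where
            both-zero : OneBelow (lookup X k) (lookup T k) → lookup X k ≡ lookup T k
            both-zero (inj₁ eq) = eq
            both-zero (inj₂ eq) = trans eq (trans (cong ℕ.pred (T⊑ k k∉′)) (sym (T⊑ k k∉′)))

one-below : ∀ {x t} → x ℕ.≤ t → t ℕ.≤ suc x → OneBelow x t
one-below {x} {t} x≤t t≤1+x with x ℕ.≟ t
... | yes x≡t = inj₁ x≡t
... | no  x≢t = inj₂ (cong ℕ.pred (ℕ.≤-antisym (ℕ.≤∧≢⇒< x≤t x≢t) t≤1+x))

-- A grid of mesh ½^ (suc j) on [- ½^ b * (m + 2^b) , ½^ b * (m + 2^b)]: the lattice point x has
-- coordinate r x in the ball and y x in the range [0 , m + m] of the interpolation, and round x is the integer of
-- that range nearest to y x.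
module Grid (m b j : ℕ) (0<m : 0 ℕ.< m) where

  k M m′ : ℕ
  k = 2 ℕ.^ suc j
  M = m ℕ.+ m
  -- With this half side, `r` sends the end coordinates 0 and `m′ + m′` to minus and plus `1 + μ`,
  -- just outside the unit ball.
  m′ = k ℕ.* (m ℕ.+ 2 ℕ.^ b)

  instance
    k≢0 : ℕ.NonZero k
    k≢0 = ℕ.m^n≢0 2 (suc j)

  κ h β : ℚ
  κ = ½^ suc j
  h = ½^ b
  β = nat (2 ℕ.^ b)

  y r : ℕ → ℚ
  y x = nat x * κ - β
  r x = (y x - nat m) * h

  -- Adding half of `k` turns the rounding down of the division into rounding to the nearest.
  quot : ℕ → ℕ
  quot x = (x ℕ.+ 2 ℕ.^ j) ℕ./ k

  round : ℕ → ℕ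
  round x = M ℕ.⊓ (quot x ℕ.∸ 2 ℕ.^ b)

  κ≥0 : 0ℚ ≤ κ
  κ≥0 = ½^-nonneg (suc j)

  kκ≡1 : nat k * κ ≡ 1ℚ
  kκ≡1 = 2^*½^ (suc j)

  half : nat (2 ℕ.^ j) * κ ≡ ½
  half = trans (solve 2 (λ a e → a :* (con ½ :* e) := con ½ :* (a :* e)) refl (nat (2 ℕ.^ j)) (½^ j))
    (trans (cong (½ *_) (2^*½^ j)) (ℚ.*-identityʳ ½))

  scale-≤ : ∀ {p q} → p ≤ q → p * κ ≤ q * κ
  scale-≤ = ℚ.*-monoʳ-≤-nonNeg κ {{ℚ.nonNegative κ≥0}}

  shifted : ∀ x → nat (x ℕ.+ 2 ℕ.^ j) * κ ≡ nat x * κ + ½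
  shifted x = trans (cong (_* κ) (nat-+ x (2 ℕ.^ j)))
    (trans (ℚ.*-distribʳ-+ κ (nat x) (nat (2 ℕ.^ j))) (cong (nat x * κ +_) half))

  cells : ∀ n → nat (n ℕ.* k) * κ ≡ nat n
  cells n = trans (cong (_* κ) (nat-* n k)) (trans (ℚ.*-assoc (nat n) (nat k) κ)
    (trans (cong (nat n *_) kκ≡1) (ℚ.*-identityʳ (nat n))))

  quot-lower : ∀ x → nat (quot x) ≤ nat x * κ + ½
  quot-lower x = subst (_≤ nat x * κ + ½) (cells (quot x)) (subst (nat (quot x ℕ.* k) * κ ≤_) (shifted x)
    (scale-≤ (nat-mono (m/n*n≤m (x ℕ.+ 2 ℕ.^ j) k))))

  quot-upper : ∀ x → nat x * κ + ½ ≤ nat (quot x) + 1ℚ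
  quot-upper x = subst (_≤ nat (suc (quot x))) (shifted x) (subst (nat (x ℕ.+ 2 ℕ.^ j) * κ ≤_) (cells (suc (quot x)))
    (scale-≤ (nat-mono bound)))
    where
    n = x ℕ.+ 2 ℕ.^ j
    bound : n ℕ.≤ suc (quot x) ℕ.* k
    bound = subst (ℕ._≤ suc (quot x) ℕ.* k) (sym (m≡m%n+[m/n]*n n k)) (ℕ.+-monoˡ-≤ (quot x ℕ.* k) (m%n≤n n k))

  rounds : ∀ x → Rounds M (y x) (round x)
  rounds x = ℕ.m⊓n≤m M (Q ℕ.∸ a) , low-side (ℕ.≤-total Q a) , high-side (ℕ.≤-total M (Q ℕ.∸ a))
    where
    Q = quot x
    a = 2 ℕ.^ b
    low-side : Q ℕ.≤ a ⊎ a ℕ.≤ Q → round x ≡ 0 ⊎ nat (round x) ≤ y x + ½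
    low-side (inj₁ Q≤a) = inj₁ (trans (cong (M ℕ.⊓_) (ℕ.m≤n⇒m∸n≡0 Q≤a)) (ℕ.⊓-zeroʳ M))
    low-side (inj₂ a≤Q) = inj₂ (ℚ.≤-trans (nat-mono (ℕ.m⊓n≤n M (Q ℕ.∸ a)))
      (≤-cert ((nat x * κ + ½) - nat Q) (0≤- (quot-lower x))
        (trans (cong (λ z → nat (Q ℕ.∸ a) + ((nat x * κ + ½) - z)) (trans (cong nat (sym (ℕ.m∸n+n≡m a≤Q))) (nat-+ (Q ℕ.∸ a) a)))
          (solve 4 (λ p x k b → p :+ ((x :* k :+ con ½) :- (p :+ b)) := (x :* k :- b) :+ con ½) refl (nat (Q ℕ.∸ a)) (nat x) κ β))))
    high-side : M ℕ.≤ Q ℕ.∸ a ⊎ Q ℕ.∸ a ℕ.≤ M → round x ≡ M ⊎ y x ≤ nat (round x) + ½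
    high-side (inj₁ M≤) = inj₁ (ℕ.m≤n⇒m⊓n≡m M≤)
    high-side (inj₂ ≤M) = inj₂ (subst (λ z → y x ≤ nat z + ½) (sym (ℕ.m≥n⇒m⊓n≡n ≤M))
      (≤-cert (((nat Q + 1ℚ) - (nat x * κ + ½)) + ((nat a + nat (Q ℕ.∸ a)) - nat Q))
        (0≤+ (0≤- (quot-upper x)) (0≤- (subst (nat Q ≤_) (nat-+ a (Q ℕ.∸ a)) (nat-mono (ℕ.m≤n+m∸n Q a)))))
        (solve 5 (λ p q x k b → (x :* k :- b) :+ (((q :+ con 1ℚ) :- (x :* k :+ con ½)) :+ ((b :+ p) :- q)) := p :+ con ½) refl
          (nat (Q ℕ.∸ a)) (nat Q) (nat x) κ β)))

  round-0 : round 0 ≡ 0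
  round-0 = trans (cong (λ q → M ℕ.⊓ (q ℕ.∸ 2 ℕ.^ b)) (m<n⇒m/n≡0 2^j<k))
    (trans (cong (M ℕ.⊓_) (ℕ.0∸n≡0 (2 ℕ.^ b))) (ℕ.⊓-zeroʳ M))
    where
    2^j<k : 2 ℕ.^ j ℕ.< k
    2^j<k = ℕ.≤-trans (ℕ.+-monoˡ-≤ (2 ℕ.^ j) (ℕ.m^n>0 2 j)) (ℕ.≤-reflexive (cong (2 ℕ.^ j ℕ.+_) (sym (ℕ.+-identityʳ (2 ℕ.^ j)))))

  m′+m′≡ : m′ ℕ.+ m′ ≡ ((m ℕ.+ 2 ℕ.^ b) ℕ.+ (m ℕ.+ 2 ℕ.^ b)) ℕ.* k
  m′+m′≡ = trans (cong₂ ℕ._+_ (ℕ.*-comm k (m ℕ.+ 2 ℕ.^ b)) (ℕ.*-comm k (m ℕ.+ 2 ℕ.^ b)))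
    (sym (ℕ.*-distribʳ-+ k (m ℕ.+ 2 ℕ.^ b) (m ℕ.+ 2 ℕ.^ b)))

  round-top : ∀ {x} → m′ ℕ.+ m′ ℕ.≤ x → M ℕ.≤ round x
  round-top {x} top = ℕ.⊓-glb ℕ.≤-refl (begin
    M                                                       ≤⟨ ℕ.m+n≤o⇒m≤o∸n M M+a≤ ⟩
    (s ℕ.+ s) ℕ.∸ 2 ℕ.^ b                                   ≡⟨ cong (ℕ._∸ 2 ℕ.^ b) (sym (m*n/n≡m (s ℕ.+ s) k)) ⟩
    ((s ℕ.+ s) ℕ.* k) ℕ./ k ℕ.∸ 2 ℕ.^ b                     ≤⟨ ℕ.∸-monoˡ-≤ (2 ℕ.^ b) (/-monoˡ-≤ k (ℕ.≤-trans (subst (ℕ._≤ x) m′+m′≡ top) (ℕ.m≤m+n x (2 ℕ.^ j)))) ⟩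
    quot x ℕ.∸ 2 ℕ.^ b                                      ∎)
    where
    open ℕ.≤-Reasoning
    s = m ℕ.+ 2 ℕ.^ b
    M+a≤ : M ℕ.+ 2 ℕ.^ b ℕ.≤ s ℕ.+ s
    M+a≤ = subst (ℕ._≤ s ℕ.+ s) (sym (ℕ.+-assoc m m (2 ℕ.^ b))) (ℕ.+-monoˡ-≤ s (ℕ.m≤m+n m (2 ℕ.^ b)))

  -- One lattice step is shorter than the unit `k`, so `quot` changes by at most 1, and truncation
  -- does not increase distances.
  round-pred : ∀ t → OneBelow (round (ℕ.pred t)) (round t)
  round-pred t = one-below
    (ℕ.⊓-monoʳ-≤ M (ℕ.∸-monoˡ-≤ a (/-monoˡ-≤ k (ℕ.+-monoˡ-≤ (2 ℕ.^ j) ℕ.pred[n]≤n))))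
    (ℕ.⊓-mono-≤ (ℕ.n≤1+n M) (ℕ.m≤n+o⇒m∸n≤o (quot t) a quot≤))
    where
    a = 2 ℕ.^ b
    p = ℕ.pred t
    step : quot t ℕ.≤ suc (quot p)
    step = ℕ.≤-pred (m<n*o⇒m/o<n {t ℕ.+ 2 ℕ.^ j} {suc (suc (quot p))} {k} bounded)
      where
      open ℕ.≤-Reasoning
      t≤ : ∀ t → t ℕ.≤ suc (ℕ.pred t)
      t≤ zero    = z≤n
      t≤ (suc t) = ℕ.≤-refl
      n = p ℕ.+ 2 ℕ.^ j
      bounded : t ℕ.+ 2 ℕ.^ j ℕ.< suc (suc (quot p)) ℕ.* k
      bounded = begin-strict
        t ℕ.+ 2 ℕ.^ j                  ≤⟨ ℕ.+-monoˡ-≤ (2 ℕ.^ j) (t≤ t) ⟩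
        suc n                          ≡⟨ cong suc (m≡m%n+[m/n]*n n k) ⟩
        suc (n ℕ.% k) ℕ.+ quot p ℕ.* k ≤⟨ ℕ.+-monoˡ-≤ (quot p ℕ.* k) (m%n<n n k) ⟩
        suc (quot p) ℕ.* k             <⟨ ℕ.m<n+m (suc (quot p) ℕ.* k) (ℕ.m^n>0 2 (suc j)) ⟩
        suc (suc (quot p)) ℕ.* k       ∎
    quot≤ : quot t ℕ.≤ a ℕ.+ suc (quot p ℕ.∸ a)
    quot≤ = ℕ.≤-trans step (ℕ.≤-trans (s≤s (ℕ.m≤n+m∸n (quot p) a)) (ℕ.≤-reflexive (sym (ℕ.+-suc a (quot p ℕ.∸ a)))))

  r-close : ∀ {x x′} → x ℕ.≤ suc x′ → r x ≤ r x′ + κ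
  r-close {x} {x′} x≤ = ≤-cert (κ * h * ((nat x′ + 1ℚ) - nat x) + κ * (1ℚ - h))
    (0≤+ (0≤* (0≤* κ≥0 (½^-nonneg b)) (0≤- (nat-mono x≤))) (0≤* κ≥0 (0≤- (½^≤1 b))))
    (solve 6 (λ x x′ k b m h → ((x :* k :- b) :- m) :* h :+ (k :* h :* ((x′ :+ con 1ℚ) :- x) :+ k :* (con 1ℚ :- h))
        := ((x′ :* k :- b) :- m) :* h :+ k) refl (nat x) (nat x′) κ β (nat m) h)

  μ : ℚ
  μ = nat m * h

  0<μ : 0ℚ < μ
  0<μ = 0<* (ℚ.<-≤-trans 0<1 (subst (_≤ nat m) (ℚ.+-identityˡ 1ℚ) (nat-mono {1} 0<m))) (½^-pos b)

  1<[1+μ+δ]² : ∀ δ → 0ℚ ≤ δ → 1ℚ < (1ℚ + μ + δ) * (1ℚ + μ + δ)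
  1<[1+μ+δ]² δ 0≤δ = <-cert (μ + (μ + (δ + δ) + (μ + δ) * (μ + δ)))
    (0<+≤ 0<μ (0≤+ (0≤+ (ℚ.<⇒≤ 0<μ) (0≤+ 0≤δ 0≤δ)) (0≤² (μ + δ))))
    (solve 2 (λ u d → con 1ℚ :+ (u :+ (u :+ (d :+ d) :+ (u :+ d) :* (u :+ d))) := (con 1ℚ :+ u :+ d) :* (con 1ℚ :+ u :+ d)) refl μ δ)

  -- A lattice point with a zero coordinate in a direction of a simplex thus lies strictly outside
  -- the ball of that simplex and keeps its old label, which lets cubes agree on common faces.
  out-low : 1ℚ < r 0 * r 0
  out-low = subst (1ℚ <_)
    (trans (cong (λ z → (z + μ + 0ℚ) * (z + μ + 0ℚ)) (sym (2^*½^ b)))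
      (solve 4 (λ b h m k → (b :* h :+ m :* h :+ con 0ℚ) :* (b :* h :+ m :* h :+ con 0ℚ)
        := (((con 0ℚ :* k :- b) :- m) :* h) :* (((con 0ℚ :* k :- b) :- m) :* h)) refl β h (nat m) κ))
    (1<[1+μ+δ]² 0ℚ ℚ.≤-refl)

  out-high : ∀ {x} → m′ ℕ.+ m′ ℕ.≤ x → 1ℚ < r x * r x
  out-high {x} top = subst (1ℚ <_) (cong₂ _*_ value value) (1<[1+μ+δ]² δ (0≤* (0≤- bound) (½^-nonneg b)))
    where
    S : ℚ
    S = (nat m + β) + (nat m + β)
    bound : S ≤ nat x * κ
    bound = subst (_≤ nat x * κ) (trans (cells ((m ℕ.+ 2 ℕ.^ b) ℕ.+ (m ℕ.+ 2 ℕ.^ b))) (trans (nat-+ (m ℕ.+ 2 ℕ.^ b) (m ℕ.+ 2 ℕ.^ b)) (cong (λ z → z + z) (nat-+ m (2 ℕ.^ b)))))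
      (scale-≤ (nat-mono (subst (ℕ._≤ x) m′+m′≡ top)))
    δ = (nat x * κ - S) * h
    value : 1ℚ + μ + δ ≡ r x
    value = trans (cong (λ z → z + μ + δ) (sym (2^*½^ b)))
      (solve 5 (λ x k b m h → (b :* h :+ m :* h :+ (x :* k :- ((m :+ b) :+ (m :+ b))) :* h) := ((x :* k :- b) :- m) :* h) refl
        (nat x) κ β (nat m) h)

-- Labelling a new cube

¼^-pos : ∀ d → 0ℚ < ¼^ d
¼^-pos zero    = 0<1
¼^-pos (suc d) = 0<* (0<* 0<½ 0<½) (¼^-pos d)

corner-step : ∀ {N} (T : Vec ℕ N) ε ε′ k → lookup (corner T ε) k ℕ.≤ suc (lookup (corner T ε′) k)
corner-step T ε ε′ k = ℕ.≤-trans (corner-≤ T ε k) (≤-suc-corner T ε′ k)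
  where
  ≤-suc-corner : ∀ {N} (T : Vec ℕ N) ε k → lookup T k ℕ.≤ suc (lookup (corner T ε) k)
  ≤-suc-corner (t ∷ T)     (outside ∷ ε) zero    = ℕ.n≤1+n t
  ≤-suc-corner (zero ∷ T)  (inside ∷ ε)  zero    = z≤n
  ≤-suc-corner (suc t ∷ T) (inside ∷ ε)  zero    = ℕ.≤-refl
  ≤-suc-corner (t ∷ T)     (outside ∷ ε) (suc k) = ≤-suc-corner T ε k
  ≤-suc-corner (t ∷ T)     (inside ∷ ε)  (suc k) = ≤-suc-corner T ε k

corner-below : ∀ {N} (T : Vec ℕ N) ε k → OneBelow (lookup (corner T ε) k) (lookup T k)
corner-below (t ∷ T) (outside ∷ ε) zero    = inj₁ refl
corner-below (t ∷ T) (inside ∷ ε)  zero    = inj₂ refl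
corner-below (t ∷ T) (outside ∷ ε) (suc k) = corner-below T ε k
corner-below (t ∷ T) (inside ∷ ε)  (suc k) = corner-below T ε k

corner-carried : ∀ {N} (T : Vec ℕ N) {σ} ε → Carried T σ → Carried (corner T ε) σ
corner-carried T ε T⊑ i i∉ = ℕ.n≤0⇒n≡0 (subst (lookup (corner T ε) i ℕ.≤_) (T⊑ i i∉) (corner-≤ T ε i))

module CellFilling {N} (C : Complex N) (ℓ : Vec ℕ N → Fin N) (m b : ℕ) (0<m : 0 ℕ.< m)
  (σ : Subset N) (σ∈ : Face C σ)
  (b-large : (m ℕ.+ m) ℕ.* suc ∣ σ ∣ ℕ.≤ 2 ℕ.^ b)
  (facets : ∀ e → e ∈ σ → ∀ T → Carried T (σ ∖ e) → ∀ ρ → Cubical.Labelled ℓ T (σ ∖ e) ρ → Face C ρ)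
  (sperner : ∀ x i → m ℕ.+ m ℕ.≤ lookup x i → 0 ℕ.< lookup x (ℓ x))
  (extends : SphereMapsExtend ∣ σ ∣ C) where

  open Cubical ℓ

  open Cell C ℓ m b σ σ∈ b-large facets sperner

  sphere-map : ∃ (Sphere d) → ∃ ∥ C ∥
  sphere-map (s , s∈) = (λ v → Lift.lift (G v) L (G-lipschitz v) s) , nonneg , sums , support
    where
    nonneg : ∀ v → 0ℝ ℝ.≤ Lift.lift (G v) L (G-lipschitz v) s
    nonneg v (ε , 0<ε , n , lt) = ℚ.<-asym negative positive
      where
      g = G v (at s n)
      negative : g + ε < 0ℚ
      negative = lt n ℕ.≤-refl
      positive : 0ℚ < g + ε
      positive = <-cert (ε + g) (0<+≤ 0<ε (proj₁ (G-unit v (at s n)))) (trans (ℚ.+-identityˡ (ε + g)) (ℚ.+-comm ε g))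
    coordinates : Vector ℝ N
    coordinates v = Lift.lift (G v) L (G-lipschitz v) s
    sums : ℝ.sum coordinates ℝ.≃ 1ℝ
    sums ε 0<ε = 0 , λ n _ → ∣p-q∣< {seq (ℝ.sum coordinates) n} {1ℚ}
        (subst (_< 1ℚ + ε) (sym (value n)) 1<1+ε) (subst (λ z → 1ℚ < z + ε) (sym (value n)) 1<1+ε)
      where
      1<1+ε : 1ℚ < 1ℚ + ε
      1<1+ε = <-cert ε 0<ε refl
      value : ∀ n → seq (ℝ.sum coordinates) n ≡ 1ℚ
      value n = trans (seq-sum coordinates n) (G-sum (at s n))
    support : ∀ τ → (∀ v → v ∈ τ → 0ℝ ℝ.< Lift.lift (G v) L (G-lipschitz v) s) → Face C τ
    support τ pos = support-face (at s n) ½≤sq τ λ v v∈ → Gv>0 v v∈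
      where
      bound : ∀ {v} → Dec (v ∈ τ) → ℕ
      bound (yes v∈) = proj₁ (proj₂ (proj₂ (pos _ v∈)))
      -- The finitely many coordinates in `τ` are positive from a common stage on; other indices
      -- impose no bound.
      bound (no _)   = 0
      near-1 : ∃ λ n → ∀ m → n ℕ.≤ m → ℚ.∣ seq (normSq s) m - 1ℚ ∣ < ½
      near-1 = s∈ ½ 0<½
      bounds : Fin N → ℕ
      bounds v = bound (v ∈? τ)
      n : ℕ
      n = proj₁ near-1 ℕ.⊔ maximum bounds
      ½≤sq : ½ ≤ sq (at s n)
      ½≤sq = ≤-cert ((sq (at s n) + ½) - 1ℚ)
        (0≤- (ℚ.<⇒≤ (subst (λ z → 1ℚ < z + ½) (seq-normSq s n)
          (∣p-q∣<⇒q< {seq (normSq s) n} {1ℚ} (proj₂ near-1 n (ℕ.m≤m⊔n (proj₁ near-1) (maximum bounds)))))))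
        (solve 1 (λ s → con ½ :+ ((s :+ con ½) :- con 1ℚ) := s) refl (sq (at s n)))
      Gv>0 : ∀ v → v ∈ τ → 0ℚ < G v (at s n)
      Gv>0 v v∈ = by-dec (v ∈? τ) (ℕ.≤-trans (≤-maximum bounds v) (ℕ.m≤n⊔m (proj₁ near-1) (maximum bounds)))
        where
        by-dec : (v∈? : Dec (v ∈ τ)) → bound v∈? ℕ.≤ n → 0ℚ < G v (at s n)
        by-dec (no v∉)   _   = ⊥-elim (v∉ v∈)
        by-dec (yes v∈′) le = let ε , 0<ε , _ , lt = pos v v∈′ in
          ℚ.<-trans (<-cert ε 0<ε refl) (lt n le)

  sphere-map-continuous : Continuous {X = Sphere d} {Y = ∥ C ∥} sphere-map
  sphere-map-continuous ε 0<ε = ½^ k , ½^-pos k , λ x y close v →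
    proj₂ (proj₂ (Lift.lift-continuous (G v) L (G-lipschitz v) ε 0<ε)) (proj₁ x) (proj₁ y) close ,
    proj₂ (proj₂ (Lift.lift-continuous (G v) L (G-lipschitz v) ε 0<ε)) (proj₁ y) (proj₁ x) (λ i → proj₂ (close i) , proj₁ (close i))
    where k = proj₁ (½^-small* L (½ * ε) (0<* 0<½ 0<ε))

  F : ∃ (Ball d) → ∃ ∥ C ∥
  F = proj₁ (extends sphere-map sphere-map-continuous)

  F-continuous : Continuous {X = Ball d} {Y = ∥ C ∥} F
  F-continuous = proj₁ (proj₂ (extends sphere-map sphere-map-continuous))

  F-extends : ∀ x v → proj₁ (F (Sphere⊆Ball x)) v ℝ.≃ proj₁ (sphere-map x) v
  F-extends = proj₂ (proj₂ (extends sphere-map sphere-map-continuous))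

  -- A quarter of `θ N`. A heavy coordinate followed across the sphere loses less than `ε₀` three
  -- times: by continuity of `F`, by its agreement with the boundary map, and by the variation of
  -- `G`. The fourth quarter keeps it positive.
  ε₀ : ℚ
  ε₀ = ½^ (5 ℕ.+ N)

  θ≡4ε₀ : θ N ≡ (ε₀ + ε₀) + (ε₀ + ε₀)
  θ≡4ε₀ = trans (sym (½^-halves (3 ℕ.+ N))) (cong₂ _+_ (sym (½^-halves (4 ℕ.+ N))) (sym (½^-halves (4 ℕ.+ N))))

  module Labelling (j : ℕ) where
    open Grid m b j 0<m using (κ; κ≥0; r; y; round; rounds; r-close)

    R : Vec ℕ N → Fin d → ℚ
    R x i = r (lookup x (elem σ i))

    ball : ∀ x → sq (R x) ≤ 1ℚ → ∃ (Ball d)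
    ball x in-ball = (λ i → fromℚ (R x i)) , λ (ε , 0<ε , n , lt) → ℚ.<-irrefl refl (ℚ.<-≤-trans
      (ℚ.<-trans (<-cert ε 0<ε refl) (lt n ℕ.≤-refl))
      (subst (_≤ 1ℚ) (sym (seq-normSq (λ i → fromℚ (R x i)) n)) in-ball))

    heavy : ∀ x (in-ball : sq (R x) ≤ 1ℚ) → ∃ λ v → fromℚ (θ N) ℝ.< proj₁ (F (ball x in-ball)) v
    heavy x in-ball = let p , _ , sums , _ = F (ball x in-ball) in heavy-vertex p sums

    label′ : ∀ x → Dec (sq (R x) ≤ 1ℚ) → Fin N
    label′ x (yes in-ball) = proj₁ (heavy x in-ball)
    label′ x (no _)        = ℓ (map round x)

    label : Vec ℕ N → Fin N
    label x = label′ x (sq (R x) ℚ.≤? 1ℚ)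

    Y-R : ∀ x i → Y (R x) i ≡ y (lookup x (elem σ i))
    Y-R x i = trans (solve 4 (λ m b y h → m :+ b :* ((y :- m) :* h) := m :+ (b :* h) :* (y :- m)) refl (nat m) β yᵢ h)
      (trans (cong (λ z → nat m + z * (yᵢ - nat m)) (2^*½^ b))
        (solve 2 (λ m y → m :+ con 1ℚ :* (y :- m) := y) refl (nat m) yᵢ))
      where yᵢ = y (lookup x (elem σ i))

    -- The rounded point is a nearest node in each of the `d` coordinates, and each coordinate costs
    -- a factor ¼ by `lin-round`.
    outside-value : ∀ x → Carried x σ → ¼^ d ≤ G (ℓ (map round x)) (R x)
    outside-value x x⊑ = subst (_≤ G v (R x)) (trans (cong (λ z → (¼^ d) * indicator (ℓ z) v) ext-q) (trans (cong ((¼^ d) *_) (indicator-refl v)) (ℚ.*-identityʳ (¼^ d))))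
      (Lin-round M {y = Y (R x)} (A-unit v) q λ i →
        subst (λ z → Rounds M z (lookup q i)) (sym (Y-R x i)) (subst (Rounds M (y (lookup x (elem σ i)))) (sym (lookup-q i)) (rounds (lookup x (elem σ i)))))
      where
      v = ℓ (map round x)
      q : Vec ℕ d
      q = tabulate (λ i → lookup (map round x) (elem σ i))
      lookup-q : ∀ i → lookup q i ≡ round (lookup x (elem σ i))
      lookup-q i = trans (lookup∘tabulate (λ i → lookup (map round x) (elem σ i)) i) (lookup-map (elem σ i) round x)
      ext-q : ext σ q ≡ map round x
      ext-q = ext-restrict σ (map round x) λ i i∉ → trans (lookup-map i round x) (trans (cong round (x⊑ i i∉)) (Grid.round-0 m b j 0<m))

  module Fine (j : ℕ) (δ : ℚ) (δ-close : ∀ (x y : ∃ (Ball d)) → Close δ (proj₁ x) (proj₁ y) → Close ε₀ (proj₁ (F x)) (proj₁ (F y)))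
    (mesh<δ : ½^ j < δ) (mesh<ε₀ : nat L * ½^ j < ε₀) (mesh<¼ : nat L * ½^ j < ¼^ d) where
    open Labelling j
    open Grid m b j 0<m using (κ; κ≥0; r; r-close)

    κ≤½^j : κ ≤ ½^ j
    κ≤½^j = ½*≤ (½^-nonneg j)

    R-close : ∀ T ε ε′ i → R (corner T ε) i ≤ R (corner T ε′) i + κ
    R-close T ε ε′ i = r-close (corner-step T ε ε′ (elem σ i))

    F-close : ∀ (p q : ∃ (Ball d)) → (∀ n i → at (proj₁ p) n i ≤ at (proj₁ q) n i + κ × at (proj₁ q) n i ≤ at (proj₁ p) n i + κ) →
      ∀ v → proj₁ (F p) v ℝ.< proj₁ (F q) v ℝ.+ fromℚ ε₀
    F-close p q near v = proj₁ (δ-close p q (λ i → less (proj₁ p i) (proj₁ q i) (λ n → proj₁ (near n i)) , less (proj₁ q i) (proj₁ p i) (λ n → proj₂ (near n i))) v)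
      where
      less : ∀ (x y : ℝ) → (∀ n → seq x n ≤ seq y n + κ) → x ℝ.< y ℝ.+ fromℚ δ
      less x y le = κ , ½^-pos (suc j) , 0 , λ n _ → ℚ.≤-<-trans (ℚ.+-monoˡ-≤ κ (le n))
        (subst (_< seq y n + δ) (trans (cong (seq y n +_) (sym (½^-halves j))) (sym (ℚ.+-assoc (seq y n) κ κ)))
          (ℚ.+-monoʳ-< (seq y n) mesh<δ))

    G-close : ∀ v {p q : Fin d → ℚ} → (∀ i → p i ≤ q i + κ) → (∀ i → q i ≤ p i + κ) → G v p ≤ G v q + nat L * ½^ j
    G-close v {p} {q} p≤ q≤ = ℚ.≤-trans (G-lipschitz v p q κ κ≥0 p≤ q≤)
      (ℚ.+-monoʳ-≤ (G v q) (ℚ.*-monoˡ-≤-nonNeg (nat L) {{ℚ.nonNegative (nat-nonneg L)}} κ≤½^j))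

    -- Across the sphere the label of an inside point is still carried by the boundary map.
    crossing : ∀ {x q : Vec ℕ N} (x-in : sq (R x) ≤ 1ℚ) → 1ℚ < sq (R q) →
      (∀ i → R x i ≤ R q i + κ) → (∀ i → R q i ≤ R x i + κ) → 0ℚ < G (proj₁ (heavy x x-in)) (R q)
    crossing {x} {q} x-in q-out x≤ q≤ = positive (proj₂ (heavy x x-in)) (F-close (ball x x-in) (Sphere⊆Ball s) close v) (F-extends s v ε₀ (½^-pos (5 ℕ.+ N)))
      where
      -- The segment from the inside point to the outside one meets the sphere, where `F` agrees
      -- with the boundary map, within `κ` of both ends.
      open Bisection (R x) (R q) x-in q-out κ κ≥0 (½^≤1 (suc j)) q≤ x≤
      v = proj₁ (heavy x x-in)
      s : ∃ (Sphere d)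
      s = boundary , on-sphere
      close : ∀ n i → R x i ≤ at boundary n i + κ × at boundary n i ≤ R x i + κ
      close n i = proj₁ (near n i)
      a = proj₁ (F (ball x x-in)) v
      z = proj₁ (F (Sphere⊆Ball s)) v
      w = proj₁ (sphere-map s) v
      positive : fromℚ (θ N) ℝ.< a → a ℝ.< z ℝ.+ fromℚ ε₀ → (∃ λ n₀ → ∀ n → n₀ ℕ.≤ n → ℚ.∣ seq z n - seq w n ∣ < ε₀) → 0ℚ < G v (R q)
      positive (e₁ , 0<e₁ , n₁ , θ<a) (e₂ , 0<e₂ , n₂ , a<z) (n₃ , z~w) = 0<G
        where
        n = n₁ ℕ.⊔ (n₂ ℕ.⊔ n₃)
        n₁≤n = ℕ.m≤m⊔n n₁ (n₂ ℕ.⊔ n₃)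
        n₂≤n = ℕ.≤-trans (ℕ.m≤m⊔n n₂ n₃) (ℕ.m≤n⊔m n₁ (n₂ ℕ.⊔ n₃))
        n₃≤n = ℕ.≤-trans (ℕ.m≤n⊔m n₂ n₃) (ℕ.m≤n⊔m n₁ (n₂ ℕ.⊔ n₃))
        θ<aₙ : θ N < seq a n
        θ<aₙ = ℚ.<-trans (<-cert e₁ 0<e₁ refl) (θ<a n n₁≤n)
        aₙ<zₙ : seq a n < seq z n + ε₀
        aₙ<zₙ = ℚ.<-trans (<-cert e₂ 0<e₂ refl) (a<z n n₂≤n)
        zₙ<wₙ : seq z n < seq w n + ε₀
        zₙ<wₙ = ∣p-q∣<⇒p< {seq z n} {seq w n} (z~w n n₃≤n)
        wₙ≤ : seq w n ≤ G v (R q) + nat L * ½^ j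
        wₙ≤ = G-close v (λ i → proj₂ (proj₂ (near n i))) (λ i → proj₁ (proj₂ (near n i)))
        0<G : 0ℚ < G v (R q)
        0<G = <-cert ((seq a n - θ N) + ((seq z n + ε₀) - seq a n) + ((seq w n + ε₀) - seq z n)
            + ((G v (R q) + nat L * ½^ j) - seq w n) + ((ε₀ - nat L * ½^ j) + ε₀))
          (0<+≤ (0<+≤ (0<+≤ (0<+≤ (0<- θ<aₙ) (ℚ.<⇒≤ (0<- aₙ<zₙ))) (ℚ.<⇒≤ (0<- zₙ<wₙ))) (0≤- wₙ≤))
            (0≤+ (ℚ.<⇒≤ (0<- mesh<ε₀)) (½^-nonneg (5 ℕ.+ N))))
          (trans (cong (λ t → 0ℚ + ((seq a n - t) + ((seq z n + ε₀) - seq a n) + ((seq w n + ε₀) - seq z n)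
              + ((G v (R q) + nat L * ½^ j) - seq w n) + ((ε₀ - nat L * ½^ j) + ε₀))) θ≡4ε₀)
            (solve 6 (λ a z w g l e → con 0ℚ :+ ((a :- ((e :+ e) :+ (e :+ e))) :+ ((z :+ e) :- a) :+ ((w :+ e) :- z)
                :+ ((g :+ l) :- w) :+ ((e :- l) :+ e)) := g) refl (seq a n) (seq z n) (seq w n) (G v (R q)) (nat L * ½^ j) ε₀))

    all-inside : ∀ {x q : Vec ℕ N} (x-in : sq (R x) ≤ 1ℚ) (q-in : sq (R q) ≤ 1ℚ) →
      (∀ i → R x i ≤ R q i + κ) → (∀ i → R q i ≤ R x i + κ) → 0ℝ ℝ.< proj₁ (F (ball q q-in)) (proj₁ (heavy x x-in))
    all-inside {x} {q} x-in q-in x≤ q≤ = positive (proj₂ (heavy x x-in)) (F-close (ball x x-in) (ball q q-in) (λ n i → x≤ i , q≤ i) v)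
      where
      v = proj₁ (heavy x x-in)
      a = proj₁ (F (ball x x-in)) v
      z = proj₁ (F (ball q q-in)) v
      positive : fromℚ (θ N) ℝ.< a → a ℝ.< z ℝ.+ fromℚ ε₀ → 0ℝ ℝ.< z
      positive (e₁ , 0<e₁ , n₁ , θ<a) (e₂ , 0<e₂ , n₂ , a<z) = e₁ , 0<e₁ , n₁ ℕ.⊔ n₂ , λ n le →
        <-cert ((seq a n - (θ N + e₁)) + (((seq z n + ε₀) - (seq a n + e₂)) + (e₂ + ((ε₀ + ε₀) + ε₀))))
          (0<+≤ (0<- (θ<a n (ℕ.≤-trans (ℕ.m≤m⊔n n₁ n₂) le)))
            (0≤+ (ℚ.<⇒≤ (0<- (a<z n (ℕ.≤-trans (ℕ.m≤n⊔m n₁ n₂) le))))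
              (0≤+ (ℚ.<⇒≤ 0<e₂) (0≤+ (0≤+ ε₀≥0 ε₀≥0) ε₀≥0))))
          (trans (cong (λ t → (0ℚ + e₁) + ((seq a n - (t + e₁)) + (((seq z n + ε₀) - (seq a n + e₂)) + (e₂ + ((ε₀ + ε₀) + ε₀))))) θ≡4ε₀)
            (solve 5 (λ a z e f g → (con 0ℚ :+ f) :+ ((a :- (((e :+ e) :+ (e :+ e)) :+ f)) :+ (((z :+ e) :- (a :+ g)) :+ (g :+ ((e :+ e) :+ e)))) := z) refl
              (seq a n) (seq z n) ε₀ e₁ e₂))
        where ε₀≥0 = ½^-nonneg (5 ℕ.+ N)

    -- If some corner is outside the ball, every label has positive weight in `G` at that corner and
    -- `support-face` applies. If none is, every label has a positive coordinate in `F` at one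
    -- common corner, and the support condition of the realization applies.
    cube-face : ∀ T → Carried T σ → ∀ τ → (∀ v → v ∈ τ → ∃ λ ε → ε ⊆ σ × label (corner T ε) ≡ v) → Face C τ
    cube-face T T⊑ τ labels = by-position (anySubset? λ ε → (ε ⊆? σ) ×-dec (1ℚ ℚ.<? sq (R (corner T ε))))
      where
      by-position : Dec (∃ λ ε → ε ⊆ σ × 1ℚ < sq (R (corner T ε))) → Face C τ
      by-position (yes (ε₁ , _ , q-out)) = support-face (R q) (ℚ.≤-trans (≤-cert ½ 0≤½ refl) (ℚ.<⇒≤ q-out)) τ λ v v∈ →
          let ε , _ , eq = labels v v∈ in subst (λ v → 0ℚ < G v (R q)) eq (value ε (sq (R (corner T ε)) ℚ.≤? 1ℚ))
        where
        q = corner T ε₁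
        value : ∀ ε (x-in? : Dec (sq (R (corner T ε)) ≤ 1ℚ)) → 0ℚ < G (label′ (corner T ε) x-in?) (R q)
        value ε (yes x-in) = crossing {corner T ε} {q} x-in q-out (R-close T ε ε₁) (R-close T ε₁ ε)
        value ε (no _) = <-cert ((¼^ d - nat L * ½^ j) + (((G v (R q) + nat L * ½^ j) - G v (R x)) + (G v (R x) - ¼^ d)))
          (0<+≤ (0<- mesh<¼) (0≤+ (0≤- (G-close v (R-close T ε ε₁) (R-close T ε₁ ε))) (0≤- (outside-value x (corner-carried T ε T⊑)))))
          (solve 4 (λ f l g x → con 0ℚ :+ ((f :- l) :+ (((g :+ l) :- x) :+ (x :- f))) := g) refl (¼^ d) (nat L * ½^ j) (G v (R q)) (G v (R x)))
          where
          x = corner T ε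
          v = ℓ (map (Grid.round m b j 0<m) x)
      by-position (no all-in) = proj₂ (proj₂ (proj₂ (F (ball q q-in)))) τ λ v v∈ →
          let ε , ε⊆ , eq = labels v v∈ in subst (λ v → 0ℝ ℝ.< proj₁ (F (ball q q-in)) v) eq
            (value ε (sq (R (corner T ε)) ℚ.≤? 1ℚ) ε⊆)
        where
        q = corner T σ
        inside-ball : ∀ ε → ε ⊆ σ → sq (R (corner T ε)) ≤ 1ℚ
        inside-ball ε ε⊆ = ℚ.≮⇒≥ λ out → all-in (ε , ε⊆ , out)
        q-in : sq (R q) ≤ 1ℚ
        q-in = inside-ball σ (λ x∈ → x∈)
        value : ∀ ε (x-in? : Dec (sq (R (corner T ε)) ≤ 1ℚ)) → ε ⊆ σ → 0ℝ ℝ.< proj₁ (F (ball q q-in)) (label′ (corner T ε) x-in?)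
        value ε (yes x-in) ε⊆ = all-inside {corner T ε} {q} x-in q-in (R-close T ε σ) (R-close T σ ε)
        value ε (no x-out) ε⊆ = ⊥-elim (x-out (inside-ball ε ε⊆))

  -- The bound holds for all later `j`, since a single grid must serve all simplices of the same
  -- size.
  fine-enough : ∃ λ j₀ → ∀ j → j₀ ℕ.≤ j → ∀ T → Carried T σ → ∀ τ →
    (∀ v → v ∈ τ → ∃ λ ε → ε ⊆ σ × Labelling.label j (corner T ε) ≡ v) → Face C τ
  fine-enough = j₁ ℕ.⊔ (j₂ ℕ.⊔ j₃) , λ j j₀≤j →
    let j₁≤j = ℕ.≤-trans (ℕ.m≤m⊔n j₁ (j₂ ℕ.⊔ j₃)) j₀≤j
        j₂≤j = ℕ.≤-trans (ℕ.≤-trans (ℕ.m≤m⊔n j₂ j₃) (ℕ.m≤n⊔m j₁ (j₂ ℕ.⊔ j₃))) j₀≤j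
        j₃≤j = ℕ.≤-trans (ℕ.≤-trans (ℕ.m≤n⊔m j₂ j₃) (ℕ.m≤n⊔m j₁ (j₂ ℕ.⊔ j₃))) j₀≤j
    in Fine.cube-face j δ δ-close (ℚ.≤-<-trans (½^-mono j₁≤j) (proj₂ small₁))
         (ℚ.≤-<-trans (scaled j₂≤j) (proj₂ small₂)) (ℚ.≤-<-trans (scaled j₃≤j) (proj₂ small₃))
    where
    δ = proj₁ (F-continuous ε₀ (½^-pos (5 ℕ.+ N)))
    0<δ = proj₁ (proj₂ (F-continuous ε₀ (½^-pos (5 ℕ.+ N))))
    δ-close = proj₂ (proj₂ (F-continuous ε₀ (½^-pos (5 ℕ.+ N))))
    small₁ : ∃ λ j → ½^ j < δ
    small₁ = ½^-small δ 0<δ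
    small₂ : ∃ λ j → nat L * ½^ j < ε₀
    small₂ = ½^-small* L ε₀ (½^-pos (5 ℕ.+ N))
    small₃ : ∃ λ j → nat L * ½^ j < ¼^ d
    small₃ = ½^-small* L (¼^ d) (¼^-pos d)
    j₁ = proj₁ small₁
    j₂ = proj₁ small₂
    j₃ = proj₁ small₃
    scaled : ∀ {i j} → i ℕ.≤ j → nat L * ½^ j ≤ nat L * ½^ i
    scaled i≤j = ℚ.*-monoˡ-≤-nonNeg (nat L) {{ℚ.nonNegative (nat-nonneg L)}} (½^-mono i≤j)

-- Filling the cubes skeleton by skeleton

support : ∀ {N} → Vec ℕ N → Subset N
support []          = []
support (zero ∷ x)  = outside ∷ support x
support (suc _ ∷ x) = inside ∷ support x

support-carries : ∀ {N} (x : Vec ℕ N) {i} → i ∈ support x → 0 ℕ.< lookup x i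
support-carries (zero ∷ x)  (there i∈) = support-carries x i∈
support-carries (suc _ ∷ x) here       = s≤s z≤n
support-carries (suc _ ∷ x) (there i∈) = support-carries x i∈

∈-support : ∀ {N} (x : Vec ℕ N) i → 0 ℕ.< lookup x i → i ∈ support x
∈-support (suc _ ∷ x) zero    _  = here
∈-support (zero ∷ x)  (suc i) 0< = there (∈-support x i 0<)
∈-support (suc _ ∷ x) (suc i) 0< = there (∈-support x i 0<)

support-⊆ : ∀ {N} (x : Vec ℕ N) {σ} → Carried x σ → support x ⊆ σ
support-⊆ x {σ} x⊑ {i} i∈ with i ∈? σ
... | yes i∈σ = i∈σ
... | no  i∉σ = ⊥-elim (ℕ.<-irrefl (sym (x⊑ i i∉σ)) (support-carries x i∈))

elem-surjective : ∀ {N} (σ : Subset N) {e} → e ∈ σ → ∃ λ i → elem σ i ≡ e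
elem-surjective (inside ∷ σ)  here       = zero , refl
elem-surjective (inside ∷ σ)  (there e∈) = let i , eq = elem-surjective σ e∈ in suc i , cong suc eq
elem-surjective (outside ∷ σ) (there e∈) = let i , eq = elem-surjective σ e∈ in i , cong suc eq

maximumₛ : ∀ {N} → (Subset N → ℕ) → ℕ
maximumₛ {zero}  f = f []
maximumₛ {suc N} f = maximumₛ (f ∘ (outside ∷_)) ℕ.⊔ maximumₛ (f ∘ (inside ∷_))

≤-maximumₛ : ∀ {N} (f : Subset N → ℕ) σ → f σ ℕ.≤ maximumₛ f
≤-maximumₛ f []            = ℕ.≤-refl
≤-maximumₛ f (outside ∷ σ) = ℕ.≤-trans (≤-maximumₛ (f ∘ (outside ∷_)) σ) (ℕ.m≤m⊔n (maximumₛ (f ∘ (outside ∷_))) (maximumₛ (f ∘ (inside ∷_))))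
≤-maximumₛ f (inside ∷ σ)  = ℕ.≤-trans (≤-maximumₛ (f ∘ (inside ∷_)) σ) (ℕ.m≤n⊔m (maximumₛ (f ∘ (outside ∷_))) (maximumₛ (f ∘ (inside ∷_))))

-- A discrete map to C from the cubes [0 , m + m]^σ, for the simplices σ with fewer than K vertices.  The cube
-- [0 , m + m]^σ is the cone over σ with apex 0, and its outer faces are mapped to σ by the Sperner condition.
record Filling {N} (C : Complex N) (K : ℕ) : Set where
  field
    ℓ       : Vec ℕ N → Fin N
    m       : ℕ
    0<m     : 0 ℕ.< m
    faces   : ∀ σ → Face C σ → ∣ σ ∣ ℕ.< K → ∀ T → Carried T σ → ∀ ρ → Cubical.Labelled ℓ T σ ρ → Face C ρ
    sperner : ∀ x i → m ℕ.+ m ℕ.≤ lookup x i → 0 ℕ.< lookup x (ℓ x)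

module Step {N} {C : Complex N} {K} (fill : Filling C K) (extends : SphereMapsExtend K C) where
  open Filling fill

  b : ℕ
  -- As `n ≤ 2 ^ n`, this exponent makes `2 ^ b` as large as `b-large` asks.
  b = (m ℕ.+ m) ℕ.* suc K

  module Filler (σ : Subset N) (σ∈ : Face C σ) (∣σ∣≡K : ∣ σ ∣ ≡ K) = CellFilling C ℓ m b 0<m σ σ∈
    (subst (λ d → (m ℕ.+ m) ℕ.* suc d ℕ.≤ 2 ℕ.^ b) (sym ∣σ∣≡K) (n≤2^n b))
    (λ e e∈ → faces (σ ∖ e) (down-closed C (p─q⊆p σ ⁅ e ⁆) σ∈) (ℕ.≤-reflexive (trans (∣p∖x∣ e∈) ∣σ∣≡K)))
    sperner
    (subst (λ d → SphereMapsExtend d C) (sym ∣σ∣≡K) extends)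

  mesh : ∀ σ → Dec (Face C σ) → Dec (∣ σ ∣ ≡ K) → ℕ
  mesh σ (yes σ∈) (yes ∣σ∣≡) = proj₁ (Filler.fine-enough σ σ∈ ∣σ∣≡)
  mesh σ _        _          = 0

  j : ℕ
  j = maximumₛ λ σ → mesh σ (Face? C σ) (∣ σ ∣ ℕ.≟ K)

  open Grid m b j 0<m using (r; round; round-0; round-top; round-pred; out-low; out-high; m′)

  label-on : ∀ σ → Dec (Face C σ) → Dec (∣ σ ∣ ≡ K) → Vec ℕ N → Fin N
  label-on σ (yes σ∈) (yes ∣σ∣≡) x = Filler.Labelling.label σ σ∈ ∣σ∣≡ j x
  label-on σ (yes _)  (no _)     x = ℓ (map round x)
  label-on σ (no _)   _          x = ℓ (map round x)

  ℓ′ : Vec ℕ N → Fin N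
  ℓ′ x = label-on (support x) (Face? C (support x)) (∣ support x ∣ ℕ.≟ K) x

  label-outside : ∀ σ σ∈? ∣σ∣≡? x → (∃ λ e → e ∈ σ × 1ℚ < r (lookup x e) * r (lookup x e)) →
    label-on σ σ∈? ∣σ∣≡? x ≡ ℓ (map round x)
  label-outside σ (no _)   _          x _ = refl
  label-outside σ (yes _)  (no _)     x _ = refl
  label-outside σ (yes σ∈) (yes ∣σ∣≡) x (e , e∈ , 1<) = by-dec (sq (R x) ℚ.≤? 1ℚ)
    where
    open Filler.Labelling σ σ∈ ∣σ∣≡ j using (R; label′)
    by-dec : ∀ in? → label′ x in? ≡ ℓ (map round x)
    by-dec (no _) = refl
    by-dec (yes x-in) = let i , eq = elem-surjective σ e∈ in
      ⊥-elim (ℚ.<-irrefl refl (ℚ.<-≤-trans (subst (λ e → 1ℚ < r (lookup x e) * r (lookup x e)) (sym eq) 1<)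
        (ℚ.≤-trans (term≤sumℚ {a = λ i → R x i * R x i} (λ i → 0≤² (R x i)) i) x-in)))

  label-small : ∀ σ σ∈? ∣σ∣≡? x → ∣ σ ∣ ≢ K → label-on σ σ∈? ∣σ∣≡? x ≡ ℓ (map round x)
  label-small σ (no _)   _          x _ = refl
  label-small σ (yes _)  (no _)     x _ = refl
  label-small σ (yes _)  (yes ∣σ∣≡) x ∣σ∣≢ = ⊥-elim (∣σ∣≢ ∣σ∣≡)

  -- If the support of `x` is smaller than `σ`, then `x` has a zero coordinate in `σ` and lies
  -- outside the ball of `σ`, where `label-on σ` is the old label of the rounded point. The support
  -- has fewer than `K` elements and prescribes the same label.
  ℓ′≡label-on : ∀ σ x → Carried x σ → ∣ σ ∣ ≡ K → ℓ′ x ≡ label-on σ (Face? C σ) (∣ σ ∣ ℕ.≟ K) x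
  ℓ′≡label-on σ x x⊑ ∣σ∣≡ = by-support (support x ≟ₛ σ)
    where
    by-support : Dec (support x ≡ σ) → ℓ′ x ≡ label-on σ (Face? C σ) (∣ σ ∣ ℕ.≟ K) x
    by-support (yes eq) = cong (λ σ → label-on σ (Face? C σ) (∣ σ ∣ ℕ.≟ K) x) eq
    by-support (no supp≢) = by-missing (any? λ e → (e ∈? σ) ×-dec ¬? (e ∈? support x))
      where
      by-missing : Dec (∃ λ e → e ∈ σ × e ∉ support x) → ℓ′ x ≡ label-on σ (Face? C σ) (∣ σ ∣ ℕ.≟ K) x
      by-missing (no none) = ⊥-elim (supp≢ (⊆-antisym (support-⊆ x x⊑) λ {e} e∈ → decidable-stable (e ∈? support x) λ e∉ → none (e , e∈ , e∉)))
      by-missing (yes (e , e∈ , e∉)) = trans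
        (label-small (support x) (Face? C (support x)) (∣ support x ∣ ℕ.≟ K) x λ ∣supp∣≡ →
          supp≢ (⊆∧∣∣≡⇒≡ (support-⊆ x x⊑) (trans ∣supp∣≡ (sym ∣σ∣≡))))
        (sym (label-outside σ (Face? C σ) (∣ σ ∣ ℕ.≟ K) x (e , e∈ , subst (λ n → 1ℚ < r n * r n) (sym xₑ≡0) out-low)))
        where
        xₑ≡0 : lookup x e ≡ 0
        xₑ≡0 = ℕ.n≤0⇒n≡0 (ℕ.≮⇒≥ λ 0<xₑ → e∉ (∈-support x e 0<xₑ))

  new-faces : ∀ σ → Face C σ → ∣ σ ∣ ≡ K → ∀ T → Carried T σ → ∀ ρ → Cubical.Labelled ℓ′ T σ ρ → Face C ρ
  new-faces σ σ∈ ∣σ∣≡ T T⊑ ρ labelled = by-dec (Face? C σ) (∣ σ ∣ ℕ.≟ K) (≤-maximumₛ (λ σ → mesh σ (Face? C σ) (∣ σ ∣ ℕ.≟ K)) σ)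
    λ v v∈ → let ε , ε⊆ , eq = labelled v v∈ in ε , ε⊆ , trans (sym (ℓ′≡label-on σ (corner T ε) (corner-carried T ε T⊑) ∣σ∣≡)) eq
    where
    by-dec : ∀ σ∈? ∣σ∣≡? → mesh σ σ∈? ∣σ∣≡? ℕ.≤ j → (∀ v → v ∈ ρ → ∃ λ ε → ε ⊆ σ × label-on σ σ∈? ∣σ∣≡? (corner T ε) ≡ v) → Face C ρ
    by-dec (no σ∉)   _           _    _      = ⊥-elim (σ∉ σ∈)
    by-dec (yes _)   (no ∣σ∣≢)   _    _      = ⊥-elim (∣σ∣≢ ∣σ∣≡)
    by-dec (yes σ∈′) (yes ∣σ∣≡′) fine labels = proj₂ (Filler.fine-enough σ σ∈′ ∣σ∣≡′) j fine T T⊑ ρ labels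

  -- Rounding maps a unit cube into a unit cube.
  old-faces : ∀ σ → Face C σ → ∣ σ ∣ ℕ.< K → ∀ T → Carried T σ → ∀ ρ → Cubical.Labelled ℓ′ T σ ρ → Face C ρ
  old-faces σ σ∈ ∣σ∣<K T T⊑ ρ labelled = faces σ σ∈ ∣σ∣<K T′ T′⊑ ρ λ v v∈ → relabel v (labelled v v∈)
    where
    T′ = map round T
    T′⊑ : Carried T′ σ
    T′⊑ i i∉ = trans (lookup-map i round T) (trans (cong round (T⊑ i i∉)) round-0)
    relabel : ∀ v → Cubical.Label ℓ′ T σ v → Cubical.Label ℓ T′ σ v
    relabel v (ε , _ , eq) = differ T′ X , ⊆σ , trans (cong ℓ (corner-differ T′ X near)) (trans (sym old) eq)
      where
      x = corner T ε
      X = map round x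
      x⊑ : Carried x σ
      x⊑ = corner-carried T ε T⊑
      old : ℓ′ x ≡ ℓ X
      old = label-small (support x) (Face? C (support x)) (∣ support x ∣ ℕ.≟ K) x
        λ eq → ℕ.<-irrefl eq (ℕ.≤-<-trans (p⊆q⇒∣p∣≤∣q∣ (support-⊆ x x⊑)) ∣σ∣<K)
      near : ∀ k → OneBelow (lookup X k) (lookup T′ k)
      near k = subst₂ OneBelow (sym (lookup-map k round x)) (sym (lookup-map k round T))
        ([ (λ eq → inj₁ (cong round eq)) , (λ eq → subst (λ z → OneBelow (round z) (round (lookup T k))) (sym eq) (round-pred (lookup T k))) ]′
          (corner-below T ε k))
      ⊆σ : differ T′ X ⊆ σ
      ⊆σ {k} k∈ with k ∈? σ
      ... | yes k∈σ = k∈σ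
      ... | no  k∉σ = ⊥-elim (differ-∈ T′ X k∈ (trans (trans (lookup-map k round x) (trans (cong round (x⊑ k k∉σ)) round-0)) (sym (T′⊑ k k∉σ))))

  next : Filling C (suc K)
  next = record
    { ℓ = ℓ′
    ; m = m′
    ; 0<m = ℕ.*-mono-≤ (ℕ.m^n>0 2 (suc j)) (ℕ.≤-trans 0<m (ℕ.m≤m+n m (2 ℕ.^ b)))
    ; faces = λ σ σ∈ ∣σ∣≤K → case ∣ σ ∣ ℕ.≟ K of λ where
        (yes ∣σ∣≡) → new-faces σ σ∈ ∣σ∣≡
        (no  ∣σ∣≢) → old-faces σ σ∈ (ℕ.≤∧≢⇒< (ℕ.≤-pred ∣σ∣≤K) ∣σ∣≢)
    -- A top coordinate puts `x` outside the ball, so the label is the old one of the rounded point;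
    -- as rounding fixes 0, a coordinate that is positive after rounding was positive before.
    ; sperner = λ x i top →
        let 0<xᵢ : 0 ℕ.< lookup x i
            0<xᵢ = ℕ.≰⇒> λ xᵢ≤0 → ℕ.<-irrefl refl (ℕ.<-≤-trans (ℕ.≤-trans 0<m (ℕ.≤-trans (ℕ.m≤m+n m m) (round-top top)))
              (ℕ.≤-reflexive (trans (cong round (ℕ.n≤0⇒n≡0 xᵢ≤0)) round-0)))
            old : ℓ′ x ≡ ℓ (map round x)
            old = label-outside (support x) (Face? C (support x)) (∣ support x ∣ ℕ.≟ K) x (i , ∈-support x i 0<xᵢ , out-high top)
            0<round : 0 ℕ.< round (lookup x (ℓ′ x))
            0<round = subst (0 ℕ.<_) (trans (lookup-map (ℓ (map round x)) round x) (cong (λ v → round (lookup x v)) (sym old)))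
              (sperner (map round x) i (subst (m ℕ.+ m ℕ.≤_) (sym (lookup-map i round x)) (round-top top)))
        in ℕ.≰⇒> λ ≤0 → ℕ.<-irrefl refl (ℕ.<-≤-trans 0<round (ℕ.≤-reflexive (trans (cong round (ℕ.n≤0⇒n≡0 ≤0)) round-0)))
    }

-- With no simplices of negative size only the Sperner condition is left, and any positive
-- coordinate satisfies it; `v₀` labels the origin.
initial : ∀ {N} (C : Complex N) → Fin N → Filling C 0
initial {N} C v₀ = record
  { ℓ = λ x → pick x (any? λ i → 0 ℕ.<? lookup x i)
  ; m = 1
  ; 0<m = s≤s z≤n
  ; faces = λ _ _ ()
  ; sperner = λ x i 2≤xᵢ → picked x i (ℕ.≤-trans (s≤s z≤n) 2≤xᵢ) (any? λ i → 0 ℕ.<? lookup x i)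
  }
  where
  pick : ∀ (x : Vec ℕ N) → Dec (∃ λ i → 0 ℕ.< lookup x i) → Fin N
  pick x (yes (i , _)) = i
  pick x (no _)        = v₀
  picked : ∀ x i → 0 ℕ.< lookup x i → (found : Dec (∃ λ i → 0 ℕ.< lookup x i)) → 0 ℕ.< lookup x (pick x found)
  picked x i 0<xᵢ (yes (_ , 0<)) = 0<
  picked x i 0<xᵢ (no none)      = ⊥-elim (none (i , 0<xᵢ))

filling : ∀ {N} (C : Complex N) → Fin N → ∀ K → (∀ d → d ℕ.< K → SphereMapsExtend d C) → Filling C K
filling C v₀ zero    extends = initial C v₀
filling C v₀ (suc K) extends = Step.next (filling C v₀ K λ d d<K → extends d (ℕ.m<n⇒m<1+n d<K)) (extends K ℕ.≤-refl)

-- `Sphere 0` is empty because 0 is not 1, so extending the empty map over the point `Ball 0`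
-- produces a point of the realization, and some coordinate of it is heavy.
ground-element : ∀ {N} (C : Complex N) → SphereMapsExtend 0 C → Fin N
ground-element {N} C extends = proj₁ (heavy-vertex (proj₁ p) (proj₁ (proj₂ (proj₂ p))))
  where
  no-sphere : ∃ (Sphere 0) → ∀ {A : Set} → A
  no-sphere (_ , 0≃1) = let n , close = 0≃1 1ℚ 0<1 in ⊥-elim (ℚ.<-irrefl refl (close n ℕ.≤-refl))
  p : ∃ ∥ C ∥
  p = proj₁ (extends (λ s → no-sphere s) λ ε 0<ε → 1ℚ , 0<1 , λ s → no-sphere s)
        ((λ ()) , λ (ε , 0<ε , n , lt) → ℚ.<-asym 0<1 (ℚ.<-trans (<-cert ε 0<ε refl) (lt n ℕ.≤-refl)))

connected⇒acyclic : ∀ {N} (C : Complex N) K → (∀ d → d ℕ.< K → SphereMapsExtend d C) → ∀ d → d ℕ.< K → H̃[ d -1]≡0 C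
connected⇒acyclic C K extends d d<K = Filled.acyclic C K ℓ (m ℕ.+ m) faces sperner d d<K
  -- From `d < K` follows `0 < K`, so maps from the empty sphere extend as well.
  where open Filling (filling C (ground-element C (extends 0 (ℕ.≤-trans (s≤s z≤n) d<K))) K extends)

admissible⇒acyclic : ∀ {N} η (C : Complex N) {k} → η ⟨ C ⟩≥ k → ∀ d → d ℕ.< k → H̃[ d -1]≡0 C
admissible⇒acyclic η-H C (K , k≤K , acyclic) d d<k = acyclic d (ℕ.<-≤-trans d<k k≤K)
admissible⇒acyclic η-π C (K , k≤K , extends) d d<k = connected⇒acyclic C K (extends K ℕ.≤-refl) d (ℕ.<-≤-trans d<k k≤K)

theorem2p2 : ∀ {N n : ℕ} (C : Complex N) (𝒱 : Partition C n) (η : Parameter) →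
    (∀ (I : Subset n) → Nonempty I → η ⟨ C [ V[ 𝒱 , I ] ] ⟩≥ (∣ I ∣ ℕ.+ 1)) →
    Connected (RG C 𝒱)
theorem2p2 C 𝒱 η large = Connectivity.connected C 𝒱 λ I d ne → admissible⇒acyclic η (C [ V[ 𝒱 , I ] ]) (large I ne) d
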